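{- Let $\mathcal{M}$ be a regular matroid of rank $r>0$ on $n$ elements and let $M\in\mathbb{Z}^{r\times n}$ be any full-rank weakly unimodular matrix representing $\mathcal{M}$. Then: (i) $\mathcal{P}_M$ is centrally symmetric; (ii) $\dim(\mathcal{P}_M)=\mathrm{rk}(\mathcal{M})$; (iii) $\mathcal{P}_M$ is reflexive; (iv) $\mathcal{P}_M$ is terminal, i.e., the only points of $\mathcal{P}_M$ with integer coordinates are its vertices and the origin; (v) the number of vertices of $\mathcal{P}_M$ is twice the number of atoms (rank-one flats) of the lattice of flats of $\mathcal{M}$; in particular, if $\mathcal{M}$ is simple, every antipodal pair of vertices of $\mathcal{P}_M$ corresponds to an element of the ground set of $\mathcal{M}$ (namely the vertices are exactly the $2n$ columns $\pm M\mathbf{e}_i$ of $[M\mid -M]$).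
   Context: A matrix $M\in\mathbb{Z}^{r\times n}$ with $0<r\le n$ is full-rank weakly unimodular if it has rank $r$ and every $r\times r$ minor lies in $\{0,\pm1\}$. $M$ represents the matroid $\mathcal{M}$ if the matroid on $[n]$ whose independent sets are the sets of linearly independent columns of $M$ is isomorphic to $\mathcal{M}$; a matroid of positive rank is regular if it has such a representation. $\mathcal{P}_M\subseteq\mathbb{R}^r$ is the convex hull of the columns of $[M\mid -M]$ (this is the generalized symmetric edge polytope of $\mathcal{M}$, well defined up to unimodular equivalence fixing the origin). A full-dimensional lattice polytope $P$ with the origin in its interior is reflexive if its polar $P^\Delta=\{\mathbf{u}:\mathbf{u}\cdot\mathbf{x}\le 1\ \forall \mathbf{x}\in P\}$ is a lattice polytope.
   Formalization: The polytope P_M and its polar are taken as sets of rational points, with convex combinations, vertices, dimension, interior and polarity all over the rationals instead of in real r-space; since both are rational polyhedra, the real statements correspond. -}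

module Defs where

open import Data.Nat as ℕ using (ℕ; zero; suc)
open import Data.Integer as ℤ using (ℤ; +_)
open import Data.Rational as ℚ using (ℚ; 0ℚ; 1ℚ)
open import Data.Fin as Fin using (Fin; zero; suc; toℕ; punchIn; splitAt)
open import Data.Fin.Subset using (Subset; ⊥; ⊤; ⁅_⁆; _∪_; _∈_; _∉_; _⊆_; ∣_∣)
open import Data.Fin.Permutation using (Permutation′; _⟨$⟩ʳ_; _⟨$⟩ˡ_)
open import Data.Vec as Vec using (Vec; tabulate; lookup)
open import Data.Product using (Σ; Σ-syntax; ∃; ∃-syntax; _×_; _,_)
open import Data.Sum using (_⊎_; inj₁; inj₂; [_,_]′)
open import Function.Bundles using (_⇔_)
open import Function.Definitions using (Injective)
open import Relation.Binary.PropositionalEquality using (_≡_; _≢_)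
open import Relation.Nullary using (¬_)

sumℤ : ∀ {k} → (Fin k → ℤ) → ℤ
sumℤ {zero}  f = + 0
sumℤ {suc k} f = f zero ℤ.+ sumℤ (λ i → f (suc i))

sumℚ : ∀ {k} → (Fin k → ℚ) → ℚ
sumℚ {zero}  f = 0ℚ
sumℚ {suc k} f = f zero ℚ.+ sumℚ (λ i → f (suc i))

Mat : ℕ → ℕ → Set
Mat r n = Fin r → Fin n → ℤ

sgn : ∀ {k} → Fin k → ℤ
sgn j with toℕ j ℕ.% 2
... | zero = + 1
... | suc _ = ℤ.- (+ 1)

det : ∀ k → (Fin k → Fin k → ℤ) → ℤ
det zero    A = + 1
det (suc k) A =
  sumℤ (λ j → sgn j ℤ.* (A zero j ℤ.* det k (λ a b → A (suc a) (punchIn j b))))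

-- the r × r minor of M given by the column choice c (column b of the
-- minor is column c b of M); non-injective c give determinant 0, and
-- reorderings only change the sign, so ranging over all c covers exactly
-- the r × r minors up to sign.
minor : ∀ {r n} → Mat r n → (Fin r → Fin n) → ℤ
minor {r} M c = det r (λ a b → M a (c b))

WeaklyUnimodular : ∀ {r n} → Mat r n → Set
WeaklyUnimodular {r} {n} M =
  ∀ (c : Fin r → Fin n) →
    minor M c ≡ + 0 ⊎ minor M c ≡ + 1 ⊎ minor M c ≡ ℤ.- (+ 1)

toℚ : ℤ → ℚ
toℚ z = z ℚ./ 1

FullRank : ∀ {r n} → Mat r n → Set
FullRank {r} {n} M =
  ∀ (μ : Fin r → ℚ) →
    (∀ j → sumℚ (λ i → μ i ℚ.* toℚ (M i j)) ≡ 0ℚ) →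
    ∀ i → μ i ≡ 0ℚ

ColIndep : ∀ {r n} → Mat r n → Subset n → Set
ColIndep {r} {n} M S =
  ∀ (λ′ : Fin n → ℚ) →
    (∀ j → j ∉ S → λ′ j ≡ 0ℚ) →
    (∀ i → sumℚ (λ j → λ′ j ℚ.* toℚ (M i j)) ≡ 0ℚ) →
    ∀ j → λ′ j ≡ 0ℚ

record Matroid (n : ℕ) : Set₁ where
  field
    Ind        : Subset n → Set
    ind-empty  : Ind ⊥
    ind-hered  : ∀ {S T} → Ind T → S ⊆ T → Ind S
    ind-exch   : ∀ {S T} → Ind S → Ind T → ∣ S ∣ ℕ.< ∣ T ∣ →
                 ∃[ e ] (e ∈ T × e ∉ S × Ind (S ∪ ⁅ e ⁆))
open Matroid public

image : ∀ {n} → Permutation′ n → Subset n → Subset n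
image σ S = tabulate (λ j → lookup S (σ ⟨$⟩ˡ j))

Represents : ∀ {r n} → Mat r n → Matroid n → Set
Represents {r} {n} M 𝓜 =
  Σ[ σ ∈ Permutation′ n ] (∀ S → Ind 𝓜 S ⇔ ColIndep M (image σ S))

Regular : ∀ {n} → Matroid n → Set
Regular {n} 𝓜 =
  Σ[ r ∈ ℕ ] Σ[ M ∈ Mat r n ]
    (0 ℕ.< r × FullRank M × WeaklyUnimodular M × Represents M 𝓜)

HasRank : ∀ {n} → Matroid n → Subset n → ℕ → Set
HasRank 𝓜 S k =
  (∃[ T ] (T ⊆ S × Ind 𝓜 T × ∣ T ∣ ≡ k)) ×
  (∀ T → T ⊆ S → Ind 𝓜 T → ∣ T ∣ ℕ.≤ k)

IsFlat : ∀ {n} → Matroid n → Subset n → Set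
IsFlat 𝓜 F = ∀ e → e ∉ F → ∀ k → HasRank 𝓜 F k → ¬ HasRank 𝓜 (F ∪ ⁅ e ⁆) k

IsAtom : ∀ {n} → Matroid n → Subset n → Set
IsAtom 𝓜 F = IsFlat 𝓜 F × HasRank 𝓜 F 1

Simple : ∀ {n} → Matroid n → Set
Simple 𝓜 = (∀ e → Ind 𝓜 ⁅ e ⁆) × (∀ e f → e ≢ f → Ind 𝓜 (⁅ e ⁆ ∪ ⁅ f ⁆))

Pt : ℕ → Set
Pt r = Vec ℚ r

0v : ∀ {r} → Pt r
0v = tabulate (λ _ → 0ℚ)

negv : ∀ {r} → Pt r → Pt r
negv x = Vec.map ℚ.-_ x

ofℤ : ∀ {r} → Vec ℤ r → Pt r
ofℤ z = Vec.map toℚ z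

lincomb : ∀ {r m} → (Fin m → ℚ) → (Fin m → Pt r) → Pt r
lincomb λ′ p = tabulate (λ i → sumℚ (λ j → λ′ j ℚ.* lookup (p j) i))

InConv : ∀ {r m} → (Fin m → Pt r) → Pt r → Set
InConv {r} {m} p x =
  Σ[ λ′ ∈ (Fin m → ℚ) ]
    ((∀ j → 0ℚ ℚ.≤ λ′ j) × sumℚ λ′ ≡ 1ℚ × x ≡ lincomb λ′ p)

col : ∀ {r n} → Mat r n → Fin n → Pt r
col M j = tabulate (λ i → toℚ (M i j))

genPM : ∀ {r n} → Mat r n → Fin (n ℕ.+ n) → Pt r
genPM {n = n} M k = [ col M , (λ j → negv (col M j)) ]′ (splitAt n k)

PM : ∀ {r n} → Mat r n → Pt r → Set
PM M = InConv (genPM M)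

AffIndep : ∀ {r m} → (Fin m → Pt r) → Set
AffIndep {r} {m} p =
  ∀ (λ′ : Fin m → ℚ) → sumℚ λ′ ≡ 0ℚ → lincomb λ′ p ≡ 0v → ∀ j → λ′ j ≡ 0ℚ

HasDim : ∀ {r} → (Pt r → Set) → ℕ → Set
HasDim {r} P d =
  (Σ[ p ∈ (Fin (suc d) → Pt r) ] ((∀ j → P (p j)) × AffIndep p)) ×
  (∀ (p : Fin (suc (suc d)) → Pt r) → (∀ j → P (p j)) → ¬ AffIndep p)

CentrallySymmetric : ∀ {r} → (Pt r → Set) → Set
CentrallySymmetric P = ∀ x → P x → P (negv x)

segPt : ∀ {r} → ℚ → Pt r → Pt r → Pt r
segPt t y z = Vec.zipWith (λ a b → t ℚ.* a ℚ.+ (1ℚ ℚ.- t) ℚ.* b) y z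

IsVertex : ∀ {r} → (Pt r → Set) → Pt r → Set
IsVertex P x =
  P x × (∀ y z t → P y → P z → 0ℚ ℚ.< t → t ℚ.< 1ℚ → x ≡ segPt t y z → y ≡ z)

IsLatticePolytope : ∀ {r} → (Pt r → Set) → Set
IsLatticePolytope {r} P =
  Σ[ m ∈ ℕ ] Σ[ w ∈ (Fin m → Vec ℤ r) ] (∀ x → P x ⇔ InConv (λ j → ofℤ (w j)) x)

OriginInterior : ∀ {r} → (Pt r → Set) → Set
OriginInterior P =
  Σ[ ε ∈ ℚ ] (0ℚ ℚ.< ε × (∀ y → (∀ i → ℚ.∣ lookup y i ∣ ℚ.≤ ε) → P y))

dot : ∀ {r} → Pt r → Pt r → ℚ
dot {r} u x = sumℚ (λ i → lookup u i ℚ.* lookup x i)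

Polar : ∀ {r} → (Pt r → Set) → Pt r → Set
Polar P u = ∀ x → P x → dot u x ℚ.≤ 1ℚ

Reflexive : ∀ {r} → (Pt r → Set) → Set
Reflexive {r} P =
  IsLatticePolytope P × HasDim P r × OriginInterior P × IsLatticePolytope (Polar P)

Terminal : ∀ {r} → (Pt r → Set) → Set
Terminal {r} P = ∀ (z : Vec ℤ r) → P (ofℤ z) → IsVertex P (ofℤ z) ⊎ ofℤ z ≡ 0v

CountedBy : ∀ {A : Set} → (A → Set) → ℕ → Set
CountedBy {A} Q k =
  Σ[ f ∈ (Fin k → A) ]
    (Injective _≡_ _≡_ f × (∀ i → Q (f i)) × (∀ x → Q x → ∃[ i ] f i ≡ x))

{-# OPTIONS --safe #-}
module Submission where

-- Call a family of r independent columns of M a basis. By Cramer's rule and unimodularity the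
-- dual basis is integral, and every column of M has coordinates in {0, ±1} with respect to every
-- basis. Exchanging one column at a time yields a first basis and puts any nonzero column into one.
--
-- If x is a nonzero lattice point of the polytope, written as a convex combination of the columns
-- ± M e_j, then each coordinate of x in a basis is 0 or ±1, and the value ±1, being extremal, is
-- shared by all columns of positive weight. In a basis containing such a column this forces x to be
-- that column. So nonzero lattice points are vertices and vertices are exactly the nonzero columns.
--
-- A point u of the polar satisfies |u · M e_j| ≤ 1. Sliding u in both directions along a dual basis
-- vector until some column becomes tight, and exchanging this column into the basis, writes u as a
-- convex combination of points of the polar with one more integral basis value; after r steps the
-- points are integral.
--
-- Nonzero columns are linearly dependent in pairs only if they agree up to sign, so atoms of the
-- lattice of flats correspond to antipodal pairs of vertices.

open import Defs
open import Data.Bool using (true)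
open import Data.Nat as ℕ using (ℕ; zero; suc)
import Data.Nat.Properties as ℕP
open import Data.Integer as ℤ using (ℤ; -[1+_])
import Data.Integer.Properties as ℤP
import Data.Rational.Unnormalised as ℚᵘ
import Data.Rational.Unnormalised.Properties as ℚᵘP
open import Data.Fin as Fin using (Fin; zero; suc; toℕ; inject₁; punchIn; punchOut; fromℕ<; _↑ˡ_; _↑ʳ_; splitAt; join; remQuot; combine; finToFun; funToFin)
open import Data.Fin.Properties using (toℕ-inject₁; toℕ-injective; toℕ-fromℕ<; toℕ<n; punchInᵢ≢i; punchIn-injective; punchIn-punchOut; suc-injective; any?; all?; splitAt-↑ˡ; splitAt-↑ʳ; join-splitAt; finToFun-funToFin; combine-remQuot; remQuot-combine)
import Data.Fin.Properties as FinP
open import Data.Fin.Permutation using (Permutation′; _⟨$⟩ʳ_; _⟨$⟩ˡ_; inverseˡ; inverseʳ)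
open import Data.Fin.Subset using (Subset; ⊤)
import Data.Fin.Subset.Properties as SubsetP
open import Data.Vec using (Vec; tabulate; lookup)
open import Data.Vec.Properties using (lookup∘tabulate; tabulate∘lookup; tabulate-cong; lookup-map; lookup-zipWith; ≡-dec; []=⇒lookup; lookup⇒[]=)
open import Data.Vec.Functional using (updateAt; insertAt)
open import Data.Vec.Functional.Properties using (updateAt-updates; updateAt-minimal; updateAt-id-local; insertAt-lookup; insertAt-punchIn)
open import Data.List using ([]; _∷_)
open import Data.Product using (Σ; ∃; ∃-syntax; _×_; _,_; proj₁; proj₂; uncurry)
open import Data.Sum using (_⊎_; inj₁; inj₂; [_,_]′)
open import Function using (_∘_; case_of_)
open import Function.Bundles using (_⇔_; mk⇔; Equivalence)
open import Function.Definitions using (Injective)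
open import Relation.Binary using (tri<; tri≈; tri>)
open import Relation.Binary.PropositionalEquality using (_≡_; _≢_; refl; sym; trans; cong; cong₂; subst; subst₂; module ≡-Reasoning)
open import Relation.Nullary using (¬_; Dec; yes; no; does; contradiction)
open import Relation.Nullary.Decidable using (dec⇒maybe; ¬?; decidable-stable; _⊎-dec_; _×-dec_; _→-dec_; dec-true)
open import Tactic.RingSolver using (solve; solve-∀)
open import Tactic.RingSolver.Core.AlmostCommutativeRing using (AlmostCommutativeRing; fromCommutativeRing)

-- All arguments take place in coordinates. A `Frame` is a basis with its dual basis, so the i-th
-- coordinate of x is the value `dual F i ∙ x` of a functional. Frames are kept apart from the
-- condition `IsBasis` that the basis vectors are columns of M, because the search for a first basis
-- passes through frames that mix columns with unit vectors. Integrality belongs to the frames with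
-- `IsBasis`: Cramer's rule gives a coordinate times the determinant d of the basis, and d * d = 1
-- removes the factor.
--
-- A single frame does not bring a lattice point x down to one generator: it only shows that the
-- generators of positive weight agree with x at the nonzero coordinates of x. Changing the frame,
-- by exchanging one of these generators into it, controls the remaining coordinates.
--
-- Vertices and atoms are not compared with each other directly. Both are enumerated from one list,
-- the least elements of the classes of nonzero columns equal up to sign.

module Rationals where

  open import Data.Rational
  open import Data.Rational.Properties

  -- Ordered-field arithmetic, integers and finite sums in the rationals.

  ℚ-ring : AlmostCommutativeRing _ _
  ℚ-ring = fromCommutativeRing +-*-commutativeRing λ x → dec⇒maybe (0ℚ ≟ x)

  0≤p⇒0≤q⇒0≤p*q : ∀ {p q} → 0ℚ ≤ p → 0ℚ ≤ q → 0ℚ ≤ p * q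
  0≤p⇒0≤q⇒0≤p*q {p} {q} 0≤p 0≤q =
    nonNegative⁻¹ (p * q) {{nonNeg*nonNeg⇒nonNeg p {{nonNegative 0≤p}} q {{nonNegative 0≤q}}}}

  0≤p⇒0≤q⇒0≤p+q : ∀ {p q} → 0ℚ ≤ p → 0ℚ ≤ q → 0ℚ ≤ p + q
  0≤p⇒0≤q⇒0≤p+q = +-mono-≤

  0<p⇒0≤q⇒0<p+q : ∀ {p q} → 0ℚ < p → 0ℚ ≤ q → 0ℚ < p + q
  0<p⇒0≤q⇒0<p+q = +-mono-<-≤

  0<p⇒0<q⇒0<p*q : ∀ {p q} → 0ℚ < p → 0ℚ < q → 0ℚ < p * q
  0<p⇒0<q⇒0<p*q {p} {q} 0<p 0<q =
    positive⁻¹ (p * q) {{pos*pos⇒pos p {{positive 0<p}} q {{positive 0<q}}}}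

  p≤q⇒0≤q-p : ∀ {p q} → p ≤ q → 0ℚ ≤ q - p
  p≤q⇒0≤q-p {p} p≤q = ≤-trans (≤-reflexive (sym (+-inverseʳ p))) (+-monoˡ-≤ (- p) p≤q)

  0≤q-p⇒p≤q : ∀ {p q} → 0ℚ ≤ q - p → p ≤ q
  0≤q-p⇒p≤q {p} {q} h = subst₂ _≤_ (+-identityˡ p) (eq p q) (+-monoˡ-≤ p h)
    where
    eq : ∀ p q → q - p + p ≡ q
    eq = solve-∀ ℚ-ring

  0<q-p⇒p<q : ∀ {p q} → 0ℚ < q - p → p < q
  0<q-p⇒p<q {p} {q} h = subst₂ _<_ (+-identityˡ p) (eq p q) (+-monoˡ-< p h)
    where
    eq : ∀ p q → q - p + p ≡ q
    eq = solve-∀ ℚ-ring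

  p-q≡0⇒p≡q : ∀ {p q} → p - q ≡ 0ℚ → p ≡ q
  p-q≡0⇒p≡q {p} {q} h = trans (eq p q) (trans (cong (_+ q) h) (+-identityˡ q))
    where
    eq : ∀ p q → p ≡ p - q + q
    eq = solve-∀ ℚ-ring

  reciprocal : ∀ {p} → p ≢ 0ℚ → ∃[ q ] p * q ≡ 1ℚ
  reciprocal {p} p≢0 = 1/ p , *-inverseʳ p
    where instance _ = ≢-nonZero p≢0

  positive-reciprocal : ∀ {p} → 0ℚ < p → ∃[ q ] (0ℚ < q × p * q ≡ 1ℚ)
  positive-reciprocal {p} 0<p = 1/ p , positive⁻¹ (1/ p) {{1/pos⇒pos p}} , *-inverseʳ p
    where
    instance
      _ = positive 0<p
      _ = pos⇒nonZero p

  p*q≡0⇒q≡0 : ∀ {p q} → p ≢ 0ℚ → p * q ≡ 0ℚ → q ≡ 0ℚ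
  p*q≡0⇒q≡0 {p} {q} p≢0 pq≡0 with reciprocal p≢0
  ... | s , ps≡1 = begin
    q            ≡⟨ *-identityˡ q ⟨
    1ℚ * q       ≡⟨ cong (_* q) ps≡1 ⟨
    p * s * q    ≡⟨ solve (p ∷ q ∷ s ∷ []) ℚ-ring ⟩
    s * (p * q)  ≡⟨ cong (s *_) pq≡0 ⟩
    s * 0ℚ       ≡⟨ *-zeroʳ s ⟩
    0ℚ           ∎
    where open ≡-Reasoning

  0<p⇒p≢0 : ∀ {p} → 0ℚ < p → p ≢ 0ℚ
  0<p⇒p≢0 0<p refl = <-irrefl refl 0<p

  0≤p⇒p≢0⇒0<p : ∀ {p} → 0ℚ ≤ p → p ≢ 0ℚ → 0ℚ < p
  0≤p⇒p≢0⇒0<p {p} 0≤p p≢0 = ≰⇒> λ p≤0 → p≢0 (≤-antisym p≤0 0≤p)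

  p≡-p⇒p≡0 : ∀ {p} → p ≡ - p → p ≡ 0ℚ
  p≡-p⇒p≡0 {p} h = p*q≡0⇒q≡0 {1ℚ + 1ℚ} (λ ()) (begin
    (1ℚ + 1ℚ) * p  ≡⟨ solve (p ∷ []) ℚ-ring ⟩
    p + p          ≡⟨ cong (_+ p) h ⟩
    - p + p        ≡⟨ +-inverseˡ p ⟩
    0ℚ             ∎)
    where open ≡-Reasoning

  neg-involutive : ∀ p → - - p ≡ p
  neg-involutive = solve-∀ ℚ-ring

  -- Integers inside ℚ

  -- `toℚ` normalises its fraction and so does not compute on a variable. On unnormalised fractions
  -- with denominator 1 the ring laws become identities between numerators.
  toℚᵘ-toℚ : ∀ z → toℚᵘ (toℚ z) ℚᵘ.≃ ℚᵘ.mkℚᵘ z 0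
  toℚᵘ-toℚ z = toℚᵘ-fromℚᵘ (ℚᵘ.mkℚᵘ z 0)

  toℚ-+ : ∀ a b → toℚ (a ℤ.+ b) ≡ toℚ a + toℚ b
  toℚ-+ a b = toℚᵘ-injective (begin
    toℚᵘ (toℚ (a ℤ.+ b))                 ≈⟨ toℚᵘ-toℚ (a ℤ.+ b) ⟩
    ℚᵘ.mkℚᵘ (a ℤ.+ b) 0                  ≈⟨ ℚᵘ.*≡* (cong (ℤ._* (ℤ.+ 1)) (sym (cong₂ ℤ._+_ (ℤP.*-identityʳ a) (ℤP.*-identityʳ b)))) ⟩
    ℚᵘ.mkℚᵘ a 0 ℚᵘ.+ ℚᵘ.mkℚᵘ b 0         ≈⟨ ℚᵘP.+-cong (toℚᵘ-toℚ a) (toℚᵘ-toℚ b) ⟨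
    toℚᵘ (toℚ a) ℚᵘ.+ toℚᵘ (toℚ b)       ≈⟨ toℚᵘ-homo-+ (toℚ a) (toℚ b) ⟨
    toℚᵘ (toℚ a + toℚ b)                 ∎)
    where open import Relation.Binary.Reasoning.Setoid ℚᵘP.≃-setoid

  toℚ-* : ∀ a b → toℚ (a ℤ.* b) ≡ toℚ a * toℚ b
  toℚ-* a b = toℚᵘ-injective (begin
    toℚᵘ (toℚ (a ℤ.* b))                 ≈⟨ toℚᵘ-toℚ (a ℤ.* b) ⟩
    ℚᵘ.mkℚᵘ a 0 ℚᵘ.* ℚᵘ.mkℚᵘ b 0         ≈⟨ ℚᵘP.*-cong (toℚᵘ-toℚ a) (toℚᵘ-toℚ b) ⟨
    toℚᵘ (toℚ a) ℚᵘ.* toℚᵘ (toℚ b)       ≈⟨ toℚᵘ-homo-* (toℚ a) (toℚ b) ⟨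
    toℚᵘ (toℚ a * toℚ b)                 ∎)
    where open import Relation.Binary.Reasoning.Setoid ℚᵘP.≃-setoid

  toℚ-neg : ∀ a → toℚ (ℤ.- a) ≡ - toℚ a
  toℚ-neg a = begin
    toℚ (ℤ.- a)                    ≡⟨ cong toℚ (ℤP.-1*i≡-i a) ⟨
    toℚ (-[1+ 0 ] ℤ.* a)           ≡⟨ toℚ-* -[1+ 0 ] a ⟩
    - 1ℚ * toℚ a                   ≡⟨ neg-distribˡ-* 1ℚ (toℚ a) ⟨
    - (1ℚ * toℚ a)                 ≡⟨ cong -_ (*-identityˡ (toℚ a)) ⟩
    - toℚ a                        ∎
    where open ≡-Reasoning

  toℚ-cancel-≤ : ∀ {a b} → toℚ a ≤ toℚ b → a ℤ.≤ b
  toℚ-cancel-≤ {a} {b} h = subst₂ ℤ._≤_ (ℤP.*-identityʳ a) (ℤP.*-identityʳ b) (ℚᵘP.drop-*≤* le)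
    where
    open ℚᵘP.≤-Reasoning
    le : ℚᵘ.mkℚᵘ a 0 ℚᵘ.≤ ℚᵘ.mkℚᵘ b 0
    le = begin
      ℚᵘ.mkℚᵘ a 0   ≃⟨ toℚᵘ-toℚ a ⟨
      toℚᵘ (toℚ a)  ≤⟨ toℚᵘ-mono-≤ h ⟩
      toℚᵘ (toℚ b)  ≃⟨ toℚᵘ-toℚ b ⟩
      ℚᵘ.mkℚᵘ b 0   ∎

  IsInt : ℚ → Set
  IsInt x = ∃[ z ] toℚ z ≡ x

  IsSign : ℚ → Set
  IsSign x = x ≡ 0ℚ ⊎ x ≡ 1ℚ ⊎ x ≡ - 1ℚ

  int-+ : ∀ {x y} → IsInt x → IsInt y → IsInt (x + y)
  int-+ (a , refl) (b , refl) = a ℤ.+ b , toℚ-+ a b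

  int-* : ∀ {x y} → IsInt x → IsInt y → IsInt (x * y)
  int-* (a , refl) (b , refl) = a ℤ.* b , toℚ-* a b

  int-neg : ∀ {x} → IsInt x → IsInt (- x)
  int-neg (a , refl) = ℤ.- a , toℚ-neg a

  sign⇒int : ∀ {x} → IsSign x → IsInt x
  sign⇒int (inj₁ refl)        = ℤ.+ 0 , refl
  sign⇒int (inj₂ (inj₁ refl)) = ℤ.+ 1 , refl
  sign⇒int (inj₂ (inj₂ refl)) = -[1+ 0 ] , refl

  sign-neg : ∀ {x} → IsSign x → IsSign (- x)
  sign-neg (inj₁ refl)        = inj₁ refl
  sign-neg (inj₂ (inj₁ refl)) = inj₂ (inj₂ refl)
  sign-neg (inj₂ (inj₂ refl)) = inj₂ (inj₁ refl)

  sign-* : ∀ {x y} → IsSign x → IsSign y → IsSign (x * y)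
  sign-* {y = y} (inj₁ refl) _ = inj₁ (*-zeroˡ y)
  sign-* {y = y} (inj₂ (inj₁ refl)) s = subst IsSign (sym (*-identityˡ y)) s
  sign-* {y = y} (inj₂ (inj₂ refl)) s = subst IsSign
    (trans (cong -_ (sym (*-identityˡ y))) (neg-distribˡ-* 1ℚ y)) (sign-neg s)

  sign-≤1 : ∀ {x} → IsSign x → x ≤ 1ℚ
  sign-≤1 (inj₁ refl)        = nonNegative⁻¹ 1ℚ
  sign-≤1 (inj₂ (inj₁ refl)) = ≤-refl
  sign-≤1 (inj₂ (inj₂ refl)) = ≤-trans (nonPositive⁻¹ (- 1ℚ)) (nonNegative⁻¹ 1ℚ)

  -- This is how coordinates become 0 or ±1, both for lattice points of the polytope and for lattice
  -- points of its polar: integrality comes from unimodularity, the two bounds from convexity or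
  -- polarity.
  int-sign : ∀ {x} → IsInt x → x ≤ 1ℚ → - x ≤ 1ℚ → IsSign x
  int-sign (z , refl) x≤1 -x≤1 =
    cases z (toℚ-cancel-≤ {z} {ℤ.+ 1} x≤1)
      (toℚ-cancel-≤ {ℤ.- z} {ℤ.+ 1} (subst (_≤ 1ℚ) (sym (toℚ-neg z)) -x≤1))
    where
    cases : ∀ z → z ℤ.≤ ℤ.+ 1 → ℤ.- z ℤ.≤ ℤ.+ 1 → IsSign (toℚ z)
    cases (ℤ.+ 0)               _ _ = inj₁ refl
    cases (ℤ.+ 1)               _ _ = inj₂ (inj₁ refl)
    cases (ℤ.+ (suc (suc n)))   (ℤ.+≤+ (ℕ.s≤s ())) _
    cases -[1+ 0 ]            _ _ = inj₂ (inj₂ refl)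
    cases -[1+ suc n ]        _ (ℤ.+≤+ (ℕ.s≤s ()))

  -- Finite sums

  sum-cong : ∀ {k} {f g : Fin k → ℚ} → (∀ i → f i ≡ g i) → sumℚ f ≡ sumℚ g
  sum-cong {zero}  h = refl
  sum-cong {suc k} h = cong₂ _+_ (h zero) (sum-cong (h ∘ suc))

  sum-zero : ∀ {k} {f : Fin k → ℚ} → (∀ i → f i ≡ 0ℚ) → sumℚ f ≡ 0ℚ
  sum-zero {zero}  h = refl
  sum-zero {suc k} h = cong₂ _+_ (h zero) (sum-zero (h ∘ suc))

  sum-+ : ∀ {k} (f g : Fin k → ℚ) → sumℚ (λ i → f i + g i) ≡ sumℚ f + sumℚ g
  sum-+ {zero}  f g = refl
  sum-+ {suc k} f g = trans (cong (f zero + g zero +_) (sum-+ (f ∘ suc) (g ∘ suc)))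
    (eq (f zero) (g zero) (sumℚ (f ∘ suc)) (sumℚ (g ∘ suc)))
    where
    eq : ∀ a b c d → a + b + (c + d) ≡ a + c + (b + d)
    eq = solve-∀ ℚ-ring

  sum-*ˡ : ∀ {k} c (f : Fin k → ℚ) → sumℚ (λ i → c * f i) ≡ c * sumℚ f
  sum-*ˡ {zero}  c f = sym (*-zeroʳ c)
  sum-*ˡ {suc k} c f = trans (cong (c * f zero +_) (sum-*ˡ c (f ∘ suc)))
    (sym (*-distribˡ-+ c (f zero) _))

  sum-*ʳ : ∀ {k} c (f : Fin k → ℚ) → sumℚ (λ i → f i * c) ≡ sumℚ f * c
  sum-*ʳ c f = trans (sum-cong λ i → *-comm (f i) c) (trans (sum-*ˡ c f) (*-comm c _))

  sum-neg : ∀ {k} (f : Fin k → ℚ) → sumℚ (λ i → - f i) ≡ - sumℚ f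
  sum-neg {zero}  f = refl
  sum-neg {suc k} f = trans (cong (- f zero +_) (sum-neg (f ∘ suc)))
    (sym (neg-distrib-+ (f zero) _))

  sum-linear : ∀ {k} a b (f g : Fin k → ℚ) →
    sumℚ (λ i → a * f i + b * g i) ≡ a * sumℚ f + b * sumℚ g
  sum-linear a b f g = trans (sum-+ (λ i → a * f i) (λ i → b * g i))
    (cong₂ _+_ (sum-*ˡ a f) (sum-*ˡ b g))

  sum-swap : ∀ {k l} (f : Fin k → Fin l → ℚ) →
    sumℚ (λ i → sumℚ (λ j → f i j)) ≡ sumℚ (λ j → sumℚ (λ i → f i j))
  sum-swap {zero} {l} f = sym (sum-zero {l} λ _ → refl)
  sum-swap {suc k} f = trans (cong (sumℚ (f zero) +_) (sum-swap (f ∘ suc)))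
    (sym (sum-+ (f zero) (λ j → sumℚ (λ i → f (suc i) j))))

  sum-mono : ∀ {k} {f g : Fin k → ℚ} → (∀ i → f i ≤ g i) → sumℚ f ≤ sumℚ g
  sum-mono {zero}  h = ≤-refl
  sum-mono {suc k} h = +-mono-≤ (h zero) (sum-mono (h ∘ suc))

  sum-nonneg : ∀ {k} {f : Fin k → ℚ} → (∀ i → 0ℚ ≤ f i) → 0ℚ ≤ sumℚ f
  sum-nonneg {zero}  h = ≤-refl
  sum-nonneg {suc k} h = 0≤p⇒0≤q⇒0≤p+q (h zero) (sum-nonneg (h ∘ suc))

  sum-remove : ∀ {k} (p : Fin (suc k)) (f : Fin (suc k) → ℚ) →
    sumℚ f ≡ f p + sumℚ (λ i → f (punchIn p i))
  sum-remove         zero    f = refl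
  sum-remove {suc k} (suc p) f = trans (cong (f zero +_) (sum-remove p (f ∘ suc)))
    (eq (f zero) (f (suc p)) _)
    where
    eq : ∀ a b c → a + (b + c) ≡ b + (a + c)
    eq = solve-∀ ℚ-ring

  sum-nonneg-≤ : ∀ {k} {f : Fin k → ℚ} → (∀ i → 0ℚ ≤ f i) → ∀ p → f p ≤ sumℚ f
  sum-nonneg-≤ {suc k} {f} h p = subst (f p ≤_) (sym (sum-remove p f))
    (≤-trans (≤-reflexive (sym (+-identityʳ (f p))))
      (+-monoʳ-≤ (f p) (sum-nonneg λ i → h (punchIn p i))))

  sum-nonneg≡0 : ∀ {k} {f : Fin k → ℚ} → (∀ i → 0ℚ ≤ f i) → sumℚ f ≡ 0ℚ → ∀ p → f p ≡ 0ℚ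
  sum-nonneg≡0 h s p = ≤-antisym (subst (_ ≤_) s (sum-nonneg-≤ h p)) (h p)

  sum-nonzero-term : ∀ {k} (f : Fin k → ℚ) → sumℚ f ≢ 0ℚ → ∃[ i ] f i ≢ 0ℚ
  sum-nonzero-term {zero}  f h = contradiction refl h
  sum-nonzero-term {suc k} f h with f zero ≟ 0ℚ
  ... | no f0≢0 = zero , f0≢0
  ... | yes f0≡0 with sum-nonzero-term (f ∘ suc) (λ s → h (cong₂ _+_ f0≡0 s))
  ...   | i , fi≢0 = suc i , fi≢0

  ∣sum∣≤sum∣∣ : ∀ {k} (f : Fin k → ℚ) → ∣ sumℚ f ∣ ≤ sumℚ (λ i → ∣ f i ∣)
  ∣sum∣≤sum∣∣ {zero}  f = ≤-refl
  ∣sum∣≤sum∣∣ {suc k} f = ≤-trans (∣p+q∣≤∣p∣+∣q∣ (f zero) _)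
    (+-monoʳ-≤ ∣ f zero ∣ (∣sum∣≤sum∣∣ (f ∘ suc)))

  sum-int : ∀ {k} {f : Fin k → ℚ} → (∀ i → IsInt (f i)) → IsInt (sumℚ f)
  sum-int {zero}  h = ℤ.+ 0 , refl
  sum-int {suc k} h = int-+ (h zero) (sum-int (h ∘ suc))

  toℚ-sum : ∀ {k} (f : Fin k → ℤ) → toℚ (sumℤ f) ≡ sumℚ (λ i → toℚ (f i))
  toℚ-sum {zero}  f = refl
  toℚ-sum {suc k} f = trans (toℚ-+ (f zero) _) (cong (toℚ (f zero) +_) (toℚ-sum (f ∘ suc)))

  -- The Kronecker delta serves as identity matrix, as unit vector and as the weights of a single
  -- point in a hull. Recursion on both indices makes sums and the leading minor of the identity
  -- matrix reduce by computation.
  δ : ∀ {k} → Fin k → Fin k → ℚ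
  δ zero    zero    = 1ℚ
  δ zero    (suc j) = 0ℚ
  δ (suc i) zero    = 0ℚ
  δ (suc i) (suc j) = δ i j

  δ-refl : ∀ {k} (i : Fin k) → δ i i ≡ 1ℚ
  δ-refl zero    = refl
  δ-refl (suc i) = δ-refl i

  δ-≢ : ∀ {k} {i j : Fin k} → i ≢ j → δ i j ≡ 0ℚ
  δ-≢ {i = zero}  {zero}  h = contradiction refl h
  δ-≢ {i = zero}  {suc j} h = refl
  δ-≢ {i = suc i} {zero}  h = refl
  δ-≢ {i = suc i} {suc j} h = δ-≢ (h ∘ cong suc)

  δ-sym : ∀ {k} (i j : Fin k) → δ i j ≡ δ j i
  δ-sym zero    zero    = refl
  δ-sym zero    (suc j) = refl
  δ-sym (suc i) zero    = refl
  δ-sym (suc i) (suc j) = δ-sym i j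

  δ-sign : ∀ {k} (i j : Fin k) → IsSign (δ i j)
  δ-sign zero    zero    = inj₂ (inj₁ refl)
  δ-sign zero    (suc j) = inj₁ refl
  δ-sign (suc i) zero    = inj₁ refl
  δ-sign (suc i) (suc j) = δ-sign i j

  δ-nonneg : ∀ {k} (i j : Fin k) → 0ℚ ≤ δ i j
  δ-nonneg zero    zero    = nonNegative⁻¹ 1ℚ
  δ-nonneg zero    (suc j) = ≤-refl
  δ-nonneg (suc i) zero    = ≤-refl
  δ-nonneg (suc i) (suc j) = δ-nonneg i j

  sum-δ-* : ∀ {k} (i : Fin k) (f : Fin k → ℚ) → sumℚ (λ j → δ i j * f j) ≡ f i
  sum-δ-* zero f = trans (cong₂ _+_ (*-identityˡ (f zero)) (sum-zero λ j → *-zeroˡ (f (suc j))))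
    (+-identityʳ (f zero))
  sum-δ-* (suc i) f = trans (cong₂ _+_ (*-zeroˡ (f zero)) (sum-δ-* i (f ∘ suc)))
    (+-identityˡ (f (suc i)))

  sum-*-δ : ∀ {k} (i : Fin k) (f : Fin k → ℚ) → sumℚ (λ j → f j * δ j i) ≡ f i
  sum-*-δ i f = trans (sum-cong λ j → trans (*-comm (f j) (δ j i)) (cong (_* f j) (δ-sym j i)))
    (sum-δ-* i f)

  sum-δ : ∀ {k} (i : Fin k) → sumℚ (δ i) ≡ 1ℚ
  sum-δ i = trans (sum-cong λ j → sym (*-identityʳ (δ i j))) (sum-δ-* i (λ _ → 1ℚ))

  infix 8 _∙_
  _∙_ : ∀ {k} → (Fin k → ℚ) → (Fin k → ℚ) → ℚ
  u ∙ x = sumℚ (λ i → u i * x i)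

  ∙-congˡ : ∀ {k} {u w : Fin k → ℚ} x → (∀ i → u i ≡ w i) → u ∙ x ≡ w ∙ x
  ∙-congˡ x h = sum-cong λ i → cong (_* x i) (h i)

  ∙-congʳ : ∀ {k} u {x y : Fin k → ℚ} → (∀ i → x i ≡ y i) → u ∙ x ≡ u ∙ y
  ∙-congʳ u h = sum-cong λ i → cong (u i *_) (h i)

  ∙-negʳ : ∀ {k} (u x : Fin k → ℚ) → u ∙ (λ i → - x i) ≡ - (u ∙ x)
  ∙-negʳ u x = trans (sum-cong λ i → sym (neg-distribʳ-* (u i) (x i))) (sum-neg (λ i → u i * x i))

  ∙-linearˡ : ∀ {k} a b (u w x : Fin k → ℚ) →
    (λ i → a * u i + b * w i) ∙ x ≡ a * (u ∙ x) + b * (w ∙ x)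
  ∙-linearˡ a b u w x = trans (sum-cong λ i → eq a b (u i) (w i) (x i))
    (sum-linear a b (λ i → u i * x i) (λ i → w i * x i))
    where
    eq : ∀ a b u w x → (a * u + b * w) * x ≡ a * (u * x) + b * (w * x)
    eq = solve-∀ ℚ-ring

  ∙-sumʳ : ∀ {k l} (u : Fin k → ℚ) (w : Fin l → ℚ) (p : Fin l → Fin k → ℚ) →
    u ∙ (λ i → sumℚ (λ j → w j * p j i)) ≡ sumℚ (λ j → w j * (u ∙ p j))
  ∙-sumʳ u w p = begin
    sumℚ (λ i → u i * sumℚ (λ j → w j * p j i))    ≡⟨ sum-cong (λ i → sum-*ˡ (u i) (λ j → w j * p j i)) ⟨
    sumℚ (λ i → sumℚ (λ j → u i * (w j * p j i)))  ≡⟨ sum-swap (λ i j → u i * (w j * p j i)) ⟩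
    sumℚ (λ j → sumℚ (λ i → u i * (w j * p j i)))  ≡⟨ sum-cong (λ j → sum-cong (λ i → eq (u i) (w j) (p j i))) ⟩
    sumℚ (λ j → sumℚ (λ i → w j * (u i * p j i)))  ≡⟨ sum-cong (λ j → sum-*ˡ (w j) (λ i → u i * p j i)) ⟩
    sumℚ (λ j → w j * (u ∙ p j))                   ∎
    where
    open ≡-Reasoning
    eq : ∀ a b c → a * (b * c) ≡ b * (a * c)
    eq = solve-∀ ℚ-ring

-- Determinants as alternating multilinear functions of the columns, up to Cramer's rule.

module Determinants where

  open import Data.Rational
  open import Data.Rational.Properties
  open Rationals

  -- Arguments are listed column first, so that a family of vectors v is read as the
  -- matrix with columns v j; this is the transpose of the convention of det.
  colDet : ∀ k → (Fin k → Fin k → ℚ) → ℚ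
  colDet zero    v = 1ℚ
  colDet (suc k) v =
    sumℚ (λ j → toℚ (sgn j) * (v j zero * colDet k (λ b a → v (punchIn j b) (suc a))))

  toℚ-det : ∀ k (A : Fin k → Fin k → ℤ) → toℚ (det k A) ≡ colDet k (λ b a → toℚ (A a b))
  toℚ-det zero    A = refl
  toℚ-det (suc k) A = trans (toℚ-sum (λ j → sgn j ℤ.* (A zero j ℤ.* det k (A′ j)))) (sum-cong λ j →
    trans (toℚ-* (sgn j) (A zero j ℤ.* det k (A′ j))) (cong (toℚ (sgn j) *_)
      (trans (toℚ-* (A zero j) (det k (A′ j))) (cong (toℚ (A zero j) *_) (toℚ-det k (A′ j))))))
    where
    A′ : Fin (suc k) → Fin k → Fin k → ℤ
    A′ j a b = A (suc a) (punchIn j b)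

  colDet-cong : ∀ k {v w : Fin k → Fin k → ℚ} → (∀ j a → v j a ≡ w j a) → colDet k v ≡ colDet k w
  colDet-cong zero    h = refl
  colDet-cong (suc k) h = sum-cong λ j → cong (toℚ (sgn j) *_)
    (cong₂ _*_ (h j zero) (colDet-cong k λ b a → h (punchIn j b) (suc a)))

  colDet-int : ∀ k {v : Fin k → Fin k → ℚ} → (∀ j a → IsInt (v j a)) → IsInt (colDet k v)
  colDet-int zero    h = ℤ.+ 1 , refl
  colDet-int (suc k) h = sum-int λ j →
    int-* (sgn j , refl) (int-* (h j zero) (colDet-int k λ b a → h (punchIn j b) (suc a)))

  colDet-δ : ∀ k → colDet k δ ≡ 1ℚ
  colDet-δ zero    = refl
  colDet-δ (suc k) = begin
    1ℚ * (1ℚ * colDet k δ) + sumℚ rest  ≡⟨ cong₂ _+_ (cong (λ d → 1ℚ * (1ℚ * d)) (colDet-δ k)) (sum-zero rest≡0) ⟩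
    1ℚ * (1ℚ * 1ℚ) + 0ℚ                 ≡⟨⟩
    1ℚ                                  ∎
    where
    open ≡-Reasoning
    minor′ : Fin k → ℚ
    minor′ j = colDet k (λ b a → δ (punchIn (suc j) b) (suc a))
    rest : Fin k → ℚ
    rest j = toℚ (sgn (suc j)) * (0ℚ * minor′ j)
    rest≡0 : ∀ j → rest j ≡ 0ℚ
    rest≡0 j = trans (cong (toℚ (sgn (suc j)) *_) (*-zeroˡ (minor′ j))) (*-zeroʳ (toℚ (sgn (suc j))))

  -- Parity alternates along `toℕ`. The local `sign` repeats the case split that `sgn` makes on the
  -- remainder, so that the remainder can be rewritten inside it.
  sgn-suc : ∀ {k} (p : Fin k) → toℚ (sgn (suc p)) ≡ - toℚ (sgn (inject₁ p))
  sgn-suc p = begin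
    toℚ (sgn (suc p))                           ≡⟨ cong toℚ (sgn≡sign (suc p)) ⟩
    toℚ (sign (suc (toℕ p) ℕ.% 2))              ≡⟨ alternates (toℕ p) ⟩
    - toℚ (sign (toℕ p ℕ.% 2))                  ≡⟨ cong (λ m → - toℚ (sign (m ℕ.% 2))) (toℕ-inject₁ p) ⟨
    - toℚ (sign (toℕ (inject₁ p) ℕ.% 2))        ≡⟨ cong (-_ ∘ toℚ) (sgn≡sign (inject₁ p)) ⟨
    - toℚ (sgn (inject₁ p))                     ∎
    where
    open ≡-Reasoning
    sign : ℕ → ℤ
    sign zero    = ℤ.+ 1
    sign (suc _) = ℤ.- (ℤ.+ 1)
    sgn≡sign : ∀ {k} (j : Fin k) → sgn j ≡ sign (toℕ j ℕ.% 2)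
    sgn≡sign j with toℕ j ℕ.% 2
    ... | zero  = refl
    ... | suc _ = refl
    alternates : ∀ m → toℚ (sign (suc m ℕ.% 2)) ≡ - toℚ (sign (m ℕ.% 2))
    alternates 0             = refl
    alternates 1             = refl
    alternates (suc (suc m)) = alternates m

  -- This is the pattern of the first-row expansion when two neighbouring columns are exchanged:
  -- their two terms trade places and change sign, all other terms change sign in place.
  sum-adjacent-swap : ∀ {k} (p : Fin k) (f g : Fin (suc k) → ℚ) →
    f (inject₁ p) ≡ - g (suc p) → f (suc p) ≡ - g (inject₁ p) →
    (∀ j → j ≢ inject₁ p → j ≢ suc p → f j ≡ - g j) → sumℚ f ≡ - sumℚ g
  sum-adjacent-swap zero f g h₀ h₁ h = begin
    f zero + (f (suc zero) + sumℚ f′)          ≡⟨ cong₂ _+_ h₀ (cong₂ _+_ h₁ rest) ⟩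
    - g (suc zero) + (- g zero + - sumℚ g′)    ≡⟨ eq (g zero) (g (suc zero)) (sumℚ g′) ⟩
    - (g zero + (g (suc zero) + sumℚ g′))      ∎
    where
    open ≡-Reasoning
    f′ g′ : Fin _ → ℚ
    f′ i = f (suc (suc i))
    g′ i = g (suc (suc i))
    rest : sumℚ f′ ≡ - sumℚ g′
    rest = trans (sum-cong λ i → h (suc (suc i)) (λ ()) (λ ())) (sum-neg g′)
    eq : ∀ a b c → - b + (- a + - c) ≡ - (a + (b + c))
    eq = solve-∀ ℚ-ring
  sum-adjacent-swap (suc p) f g h₀ h₁ h = trans
    (cong₂ _+_ (h zero (λ ()) (λ ()))
      (sum-adjacent-swap p (f ∘ suc) (g ∘ suc) h₀ h₁
        λ j j≢ j≢′ → h (suc j) (j≢ ∘ suc-injective) (j≢′ ∘ suc-injective)))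
    (sym (neg-distrib-+ (g zero) _))

  -- Deleting either of two neighbours leaves the same list, except at the one place b where the
  -- surviving neighbour sits.
  punchIn-adjacent : ∀ {k} (p : Fin k) (b : Fin k) →
    (punchIn (inject₁ p) b ≡ suc p × punchIn (suc p) b ≡ inject₁ p) ⊎
    punchIn (inject₁ p) b ≡ punchIn (suc p) b
  punchIn-adjacent zero    zero    = inj₁ (refl , refl)
  punchIn-adjacent zero    (suc b) = inj₂ refl
  punchIn-adjacent (suc p) zero    = inj₂ refl
  punchIn-adjacent (suc p) (suc b) with punchIn-adjacent p b
  ... | inj₁ (e , e′) = inj₁ (cong suc e , cong suc e′)
  ... | inj₂ e        = inj₂ (cong suc e)

  -- Neighbours that both survive a deletion are still neighbours, so a minor that keeps both
  -- columns again undergoes an adjacent swap.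
  adjacent-preimage : ∀ {k} (j : Fin (suc (suc k))) (p : Fin (suc k)) →
    j ≢ inject₁ p → j ≢ suc p →
    ∃[ q ] (punchIn j (inject₁ q) ≡ inject₁ p × punchIn j (suc q) ≡ suc p)
  adjacent-preimage zero          zero    h h′ = contradiction refl h
  adjacent-preimage zero          (suc p) h h′ = p , refl , refl
  adjacent-preimage (suc zero)    zero    h h′ = contradiction refl h′
  adjacent-preimage {suc k} (suc (suc j)) zero h h′ = zero , refl , refl
  adjacent-preimage {suc k} (suc j) (suc p) h h′
    with adjacent-preimage j p (h ∘ cong suc) (h′ ∘ cong suc)
  ... | q , e , e′ = suc q , cong suc e , cong suc e′

  -- Induction along the first-row expansion. Deleting one swapped column here and the other there
  -- leaves equal minors, while the cofactor signs of neighbours are opposite; for every other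
  -- deleted column the sign comes from the induction hypothesis.
  colDet-adjacent-swap : ∀ {k} (p : Fin k) (v w : Fin (suc k) → Fin (suc k) → ℚ) →
    (∀ a → w (inject₁ p) a ≡ v (suc p) a) → (∀ a → w (suc p) a ≡ v (inject₁ p) a) →
    (∀ j → j ≢ inject₁ p → j ≢ suc p → ∀ a → w j a ≡ v j a) →
    colDet (suc k) w ≡ - colDet (suc k) v
  colDet-adjacent-swap {suc k} p v w h₀ h₁ h = sum-adjacent-swap p _ _ at-p at-suc-p elsewhere
    where
    open ≡-Reasoning
    D : (Fin (suc (suc k)) → Fin (suc (suc k)) → ℚ) → Fin (suc (suc k)) → ℚ
    D u j = colDet (suc k) (λ b a → u (punchIn j b) (suc a))

    minors : ∀ b a → w (punchIn (inject₁ p) b) a ≡ v (punchIn (suc p) b) a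
    minors b a with punchIn-adjacent p b
    ... | inj₁ (e , e′) = trans (cong (λ i → w i a) e) (trans (h₁ a) (cong (λ i → v i a) (sym e′)))
    ... | inj₂ e = trans
      (h _ (punchInᵢ≢i (inject₁ p) b) (λ e′ → punchInᵢ≢i (suc p) b (trans (sym e) e′)) a)
      (cong (λ i → v i a) e)

    minors′ : ∀ b a → w (punchIn (suc p) b) a ≡ v (punchIn (inject₁ p) b) a
    minors′ b a with punchIn-adjacent p b
    ... | inj₁ (e , e′) = trans (cong (λ i → w i a) e′) (trans (h₀ a) (cong (λ i → v i a) (sym e)))
    ... | inj₂ e = trans
      (h _ (λ e′ → punchInᵢ≢i (inject₁ p) b (trans e e′)) (punchInᵢ≢i (suc p) b) a)
      (cong (λ i → v i a) (sym e))

    flip-sign : ∀ s x → s * x ≡ - (- s * x)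
    flip-sign = solve-∀ ℚ-ring

    at-p : toℚ (sgn (inject₁ p)) * (w (inject₁ p) zero * D w (inject₁ p)) ≡
           - (toℚ (sgn (suc p)) * (v (suc p) zero * D v (suc p)))
    at-p = begin
      toℚ (sgn (inject₁ p)) * (w (inject₁ p) zero * D w (inject₁ p))
        ≡⟨ cong (toℚ (sgn (inject₁ p)) *_) (cong₂ _*_ (h₀ zero) (colDet-cong (suc k) λ b a → minors b (suc a))) ⟩
      toℚ (sgn (inject₁ p)) * (v (suc p) zero * D v (suc p))
        ≡⟨ flip-sign (toℚ (sgn (inject₁ p))) (v (suc p) zero * D v (suc p)) ⟩
      - (- toℚ (sgn (inject₁ p)) * (v (suc p) zero * D v (suc p)))
        ≡⟨ cong (λ s → - (s * (v (suc p) zero * D v (suc p)))) (sgn-suc p) ⟨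
      - (toℚ (sgn (suc p)) * (v (suc p) zero * D v (suc p)))
        ∎

    at-suc-p : toℚ (sgn (suc p)) * (w (suc p) zero * D w (suc p)) ≡
               - (toℚ (sgn (inject₁ p)) * (v (inject₁ p) zero * D v (inject₁ p)))
    at-suc-p = begin
      toℚ (sgn (suc p)) * (w (suc p) zero * D w (suc p))
        ≡⟨ cong₂ _*_ (sgn-suc p) (cong₂ _*_ (h₁ zero) (colDet-cong (suc k) λ b a → minors′ b (suc a))) ⟩
      - toℚ (sgn (inject₁ p)) * (v (inject₁ p) zero * D v (inject₁ p))
        ≡⟨ neg-distribˡ-* (toℚ (sgn (inject₁ p))) _ ⟨
      - (toℚ (sgn (inject₁ p)) * (v (inject₁ p) zero * D v (inject₁ p)))
        ∎

    elsewhere : ∀ j → j ≢ inject₁ p → j ≢ suc p →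
      toℚ (sgn j) * (w j zero * D w j) ≡ - (toℚ (sgn j) * (v j zero * D v j))
    elsewhere j j≢ j≢′ with adjacent-preimage j p j≢ j≢′
    ... | q , e , e′ = begin
      toℚ (sgn j) * (w j zero * D w j)      ≡⟨ cong (toℚ (sgn j) *_) (cong₂ _*_ (h j j≢ j≢′ zero) minor-swap) ⟩
      toℚ (sgn j) * (v j zero * - D v j)    ≡⟨ pull-neg (toℚ (sgn j)) (v j zero) (D v j) ⟩
      - (toℚ (sgn j) * (v j zero * D v j))  ∎
      where
      pull-neg : ∀ a b c → a * (b * - c) ≡ - (a * (b * c))
      pull-neg = solve-∀ ℚ-ring
      minor-swap : D w j ≡ - D v j
      minor-swap = colDet-adjacent-swap q _ _
        (λ a → trans (cong (λ i → w i (suc a)) e) (trans (h₀ (suc a)) (cong (λ i → v i (suc a)) (sym e′))))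
        (λ a → trans (cong (λ i → w i (suc a)) e′) (trans (h₁ (suc a)) (cong (λ i → v i (suc a)) (sym e))))
        (λ b b≢ b≢′ a → h (punchIn j b)
          (λ x → b≢ (punchIn-injective j _ _ (trans x (sym e))))
          (λ x → b≢′ (punchIn-injective j _ _ (trans x (sym e′)))) (suc a))

  -- Moving the second of the two equal columns towards the first by adjacent swaps.
  colDet-equal-columns-at-distance : ∀ d {k} (p q : Fin k) (v : Fin k → Fin k → ℚ) →
    toℕ q ≡ suc d ℕ.+ toℕ p → (∀ a → v p a ≡ v q a) → colDet k v ≡ 0ℚ
  -- The equal columns are neighbours: swapping them changes nothing, so the determinant is its own
  -- negative.
  colDet-equal-columns-at-distance zero p (suc q) v d h = p≡-p⇒p≡0
    (colDet-adjacent-swap q v v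
      (λ a → trans (cong (λ i → v i a) (sym p≡q)) (h a))
      (λ a → trans (sym (h a)) (cong (λ i → v i a) p≡q))
      (λ _ _ _ _ → refl))
    where
    p≡q : p ≡ inject₁ q
    p≡q = toℕ-injective (trans (sym (ℕP.suc-injective d)) (sym (toℕ-inject₁ q)))
  colDet-equal-columns-at-distance (suc d) {suc k} p (suc q) v dist h = begin
    colDet (suc k) v      ≡⟨ neg-involutive (colDet (suc k) v) ⟨
    - - colDet (suc k) v  ≡⟨ cong -_ (colDet-adjacent-swap q v w at-q at-suc-q elsewhere) ⟨
    - colDet (suc k) w    ≡⟨ cong -_ (colDet-equal-columns-at-distance d p (inject₁ q) w dist′ equal) ⟩
    - 0ℚ                  ≡⟨⟩
    0ℚ                    ∎
    where
    open ≡-Reasoning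
    τ : Fin (suc k) → Fin (suc k)
    τ j with j Fin.≟ inject₁ q
    ... | yes _ = suc q
    ... | no _ with j Fin.≟ suc q
    ...   | yes _ = inject₁ q
    ...   | no _  = j
    τ-q : τ (inject₁ q) ≡ suc q
    τ-q with inject₁ q Fin.≟ inject₁ q
    ... | yes _ = refl
    ... | no h  = contradiction refl h
    τ-suc-q : τ (suc q) ≡ inject₁ q
    τ-suc-q with suc q Fin.≟ inject₁ q
    ... | yes e = e
    ... | no _ with suc q Fin.≟ suc q
    ...   | yes _ = refl
    ...   | no h  = contradiction refl h
    τ-else : ∀ j → j ≢ inject₁ q → j ≢ suc q → τ j ≡ j
    τ-else j j≢ j≢′ with j Fin.≟ inject₁ q
    ... | yes e = contradiction e j≢
    ... | no _ with j Fin.≟ suc q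
    ...   | yes e = contradiction e j≢′
    ...   | no _  = refl
    w : Fin (suc k) → Fin (suc k) → ℚ
    w j = v (τ j)
    at-q : ∀ a → w (inject₁ q) a ≡ v (suc q) a
    at-q a = cong (λ i → v i a) τ-q
    at-suc-q : ∀ a → w (suc q) a ≡ v (inject₁ q) a
    at-suc-q a = cong (λ i → v i a) τ-suc-q
    elsewhere : ∀ j → j ≢ inject₁ q → j ≢ suc q → ∀ a → w j a ≡ v j a
    elsewhere j j≢ j≢′ a = cong (λ i → v i a) (τ-else j j≢ j≢′)
    dist′ : toℕ (inject₁ q) ≡ suc d ℕ.+ toℕ p
    dist′ = trans (toℕ-inject₁ q) (ℕP.suc-injective dist)
    p≢q : p ≢ inject₁ q
    p≢q e = ℕP.m≢1+n+m (toℕ p) (trans (cong toℕ e) dist′)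
    p≢suc-q : p ≢ suc q
    p≢suc-q e = ℕP.m≢1+n+m (toℕ p) (trans (cong toℕ e) dist)
    equal : ∀ a → w p a ≡ w (inject₁ q) a
    equal a = trans (elsewhere p p≢q p≢suc-q a) (trans (h a) (sym (at-q a)))

  colDet-equal-columns : ∀ {k} (p q : Fin k) (v : Fin k → Fin k → ℚ) →
    p ≢ q → (∀ a → v p a ≡ v q a) → colDet k v ≡ 0ℚ
  colDet-equal-columns p q v p≢q h with FinP.<-cmp p q
  ... | tri< p<q _ _ = colDet-equal-columns-at-distance _ p q v
    (sym (trans (cong suc (ℕP.+-comm _ (toℕ p))) (ℕP.m+[n∸m]≡n p<q))) h
  ... | tri≈ _ p≡q _ = contradiction p≡q p≢q
  ... | tri> _ _ q<p = colDet-equal-columns-at-distance _ q p v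
    (sym (trans (cong suc (ℕP.+-comm _ (toℕ q))) (ℕP.m+[n∸m]≡n q<p))) (sym ∘ h)

  -- The three families are related entry by entry and not through `replace`, because the induction
  -- applies the statement to minors, where the distinguished column has moved to `punchOut j≢p`.
  colDet-linear : ∀ {k} (p : Fin k) α β (u v w : Fin k → Fin k → ℚ) →
    (∀ a → w p a ≡ α * u p a + β * v p a) →
    (∀ j → j ≢ p → ∀ a → w j a ≡ u j a) → (∀ j → j ≢ p → ∀ a → w j a ≡ v j a) →
    colDet k w ≡ α * colDet k u + β * colDet k v
  colDet-linear {suc k} p α β u v w hp hu hv =
    trans (sum-cong term) (sum-linear α β (λ j → toℚ (sgn j) * (u j zero * D u j))
                                          (λ j → toℚ (sgn j) * (v j zero * D v j)))
    where
    open ≡-Reasoning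
    D : (Fin (suc k) → Fin (suc k) → ℚ) → Fin (suc k) → ℚ
    D x j = colDet k (λ b a → x (punchIn j b) (suc a))
    in-entry : ∀ α β s x y d → s * ((α * x + β * y) * d) ≡ α * (s * (x * d)) + β * (s * (y * d))
    in-entry = solve-∀ ℚ-ring
    in-minor : ∀ α β s x d e → s * (x * (α * d + β * e)) ≡ α * (s * (x * d)) + β * (s * (x * e))
    in-minor = solve-∀ ℚ-ring
    term : ∀ j → toℚ (sgn j) * (w j zero * D w j) ≡
                 α * (toℚ (sgn j) * (u j zero * D u j)) + β * (toℚ (sgn j) * (v j zero * D v j))
    term j with j Fin.≟ p
    ... | yes refl = begin
      toℚ (sgn j) * (w j zero * D w j)
        ≡⟨ cong (λ x → toℚ (sgn j) * (x * D w j)) (hp zero) ⟩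
      toℚ (sgn j) * ((α * u j zero + β * v j zero) * D w j)
        ≡⟨ in-entry α β (toℚ (sgn j)) (u j zero) (v j zero) (D w j) ⟩
      α * (toℚ (sgn j) * (u j zero * D w j)) + β * (toℚ (sgn j) * (v j zero * D w j))
        ≡⟨ cong₂ (λ x y → α * (toℚ (sgn j) * (u j zero * x)) + β * (toℚ (sgn j) * (v j zero * y)))
             (colDet-cong k λ b a → hu (punchIn j b) (punchInᵢ≢i j b) (suc a))
             (colDet-cong k λ b a → hv (punchIn j b) (punchInᵢ≢i j b) (suc a)) ⟩
      α * (toℚ (sgn j) * (u j zero * D u j)) + β * (toℚ (sgn j) * (v j zero * D v j))
        ∎
    ... | no j≢p = begin
      toℚ (sgn j) * (w j zero * D w j)
        ≡⟨ cong (λ x → toℚ (sgn j) * (w j zero * x)) minor-linear ⟩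
      toℚ (sgn j) * (w j zero * (α * D u j + β * D v j))
        ≡⟨ in-minor α β (toℚ (sgn j)) (w j zero) (D u j) (D v j) ⟩
      α * (toℚ (sgn j) * (w j zero * D u j)) + β * (toℚ (sgn j) * (w j zero * D v j))
        ≡⟨ cong₂ (λ x y → α * (toℚ (sgn j) * (x * D u j)) + β * (toℚ (sgn j) * (y * D v j)))
             (hu j j≢p zero) (hv j j≢p zero) ⟩
      α * (toℚ (sgn j) * (u j zero * D u j)) + β * (toℚ (sgn j) * (v j zero * D v j))
        ∎
      where
      p′ : Fin k
      p′ = punchOut j≢p
      p′-spec : punchIn j p′ ≡ p
      p′-spec = punchIn-punchOut j≢p
      away : ∀ b → b ≢ p′ → punchIn j b ≢ p
      away b b≢p′ e = b≢p′ (punchIn-injective j b p′ (trans e (sym p′-spec)))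
      minor-linear : D w j ≡ α * D u j + β * D v j
      minor-linear = colDet-linear p′ α β _ _ _
        (λ a → subst (λ i → w i (suc a) ≡ α * u i (suc a) + β * v i (suc a)) (sym p′-spec) (hp (suc a)))
        (λ b b≢ a → hu (punchIn j b) (away b b≢) (suc a))
        (λ b b≢ a → hv (punchIn j b) (away b b≢) (suc a))

  replace : ∀ {k l} → (Fin k → Fin l → ℚ) → Fin k → (Fin l → ℚ) → Fin k → Fin l → ℚ
  replace v i w = updateAt v i (λ _ → w)

  replace-at : ∀ {k l} (v : Fin k → Fin l → ℚ) i w a → replace v i w i a ≡ w a
  replace-at v i w a = cong (λ f → f a) (updateAt-updates i v)

  replace-away : ∀ {k l} (v : Fin k → Fin l → ℚ) i w j → j ≢ i → ∀ a → replace v i w j a ≡ v j a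
  replace-away v i w j j≢i a = cong (λ f → f a) (updateAt-minimal j i v j≢i)

  colDet-replace-sum : ∀ {k l} (v : Fin k → Fin k → ℚ) i (c : Fin l → ℚ) (x : Fin l → Fin k → ℚ) →
    colDet k (replace v i (λ a → sumℚ (λ j → c j * x j a))) ≡
    sumℚ (λ j → c j * colDet k (replace v i (x j)))
  -- The empty combination is a zero column, which linearity handles with both coefficients 0.
  colDet-replace-sum {k} {zero} v i c x = trans
    (colDet-linear i 0ℚ 0ℚ v v _
      (λ a → trans (replace-at v i _ a) (sym (zero-combination (v i a))))
      (replace-away v i _) (replace-away v i _))
    (zero-combination (colDet k v))
    where
    zero-combination : ∀ y → 0ℚ * y + 0ℚ * y ≡ 0ℚ
    zero-combination = solve-∀ ℚ-ring
  colDet-replace-sum {k} {suc l} v i c x = trans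
    (colDet-linear i (c zero) 1ℚ (replace v i (x zero)) (replace v i tail′) _
      (λ a → trans (replace-at v i _ a)
        (cong₂ _+_ (cong (c zero *_) (sym (replace-at v i (x zero) a)))
          (trans (sym (*-identityˡ (tail′ a))) (cong (1ℚ *_) (sym (replace-at v i tail′ a))))))
      (λ j j≢i a → trans (replace-away v i _ j j≢i a) (sym (replace-away v i _ j j≢i a)))
      (λ j j≢i a → trans (replace-away v i _ j j≢i a) (sym (replace-away v i _ j j≢i a))))
    (cong (c zero * colDet k (replace v i (x zero)) +_)
      (trans (*-identityˡ _) (colDet-replace-sum v i (c ∘ suc) (x ∘ suc))))
    where
    tail′ : Fin k → ℚ
    tail′ a = sumℚ (λ j → c (suc j) * x (suc j) a)

  -- Expanding the new column by linearity, each term with j ≠ i contains the column v j twice and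
  -- vanishes; the term j = i is the original determinant times c i.
  colDet-replace-combination : ∀ {k} (v : Fin k → Fin k → ℚ) i (w : Fin k → ℚ) (c : Fin k → ℚ) →
    (∀ a → w a ≡ sumℚ (λ j → c j * v j a)) → colDet k (replace v i w) ≡ c i * colDet k v
  colDet-replace-combination {k} v i w c h = begin
    colDet k (replace v i w)
      ≡⟨ colDet-cong k replace-cong ⟩
    colDet k (replace v i (λ a → sumℚ (λ j → c j * v j a)))
      ≡⟨ colDet-replace-sum v i c v ⟩
    sumℚ (λ j → c j * colDet k (replace v i (v j)))
      ≡⟨ sum-cong term ⟩
    sumℚ (λ j → (c j * colDet k v) * δ j i)
      ≡⟨ sum-*-δ i (λ j → c j * colDet k v) ⟩
    c i * colDet k v
      ∎
    where
    open ≡-Reasoning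
    replace-cong : ∀ j a → replace v i w j a ≡ replace v i (λ a → sumℚ (λ j → c j * v j a)) j a
    replace-cong j a with j Fin.≟ i
    ... | yes refl = trans (replace-at v i w a) (trans (h a) (sym (replace-at v i _ a)))
    ... | no j≢i   = trans (replace-away v i w j j≢i a) (sym (replace-away v i _ j j≢i a))
    term : ∀ j → c j * colDet k (replace v i (v j)) ≡ (c j * colDet k v) * δ j i
    term j with j Fin.≟ i
    ... | yes refl = trans
      (cong (c j *_) (colDet-cong k λ b a → cong (λ f → f a) (updateAt-id-local j v refl b)))
      (trans (sym (*-identityʳ _)) (cong ((c j * colDet k v) *_) (sym (δ-refl j))))
    ... | no j≢i = trans
      (cong (c j *_) (colDet-equal-columns j i _ j≢i λ a →
        trans (replace-away v i (v j) j j≢i a) (sym (replace-at v i (v j) a))))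
      (trans (*-zeroʳ (c j)) (trans (sym (*-zeroʳ (c j * colDet k v)))
        (cong ((c j * colDet k v) *_) (sym (δ-≢ j≢i)))))

-- Bases with dual bases, exchange of a basis vector, and integrality from unimodularity.

module Frames where

  open import Data.Rational
  open import Data.Rational.Properties
  open Rationals
  open Determinants

  -- The vectors `dual` are the rows of the inverse of the matrix with columns `basis`:
  -- `biorthogonal` and `expand` are the two orders in which the matrices multiply to the identity.
  -- `colDet≢0` is what lets weak unimodularity conclude that the determinant is ±1.
  record Frame (r : ℕ) : Set where
    field
      basis dual   : Fin r → Fin r → ℚ
      biorthogonal : ∀ i j → dual i ∙ basis j ≡ δ i j
      expand       : ∀ x a → x a ≡ sumℚ (λ i → (dual i ∙ x) * basis i a)
      colDet≢0     : colDet r basis ≢ 0ℚ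

  open Frame public

  standardFrame : ∀ r → Frame r
  standardFrame r = record
    { basis        = δ
    ; dual         = δ
    ; biorthogonal = λ i j → trans (sum-δ-* i (δ j)) (δ-sym j i)
    ; expand       = λ x a → sym (trans (sum-cong λ i → cong (_* δ i a) (sum-δ-* i x)) (sum-*-δ a x))
    ; colDet≢0     = λ d≡0 → contradiction (trans (sym (colDet-δ r)) d≡0) λ ()
    }

  -- The transpose of `expand`, found by applying u to the expansion of the a-th unit vector. It
  -- recovers a functional from its values on the basis, which is what the polar needs.
  expand-dual : ∀ {r} (F : Frame r) u a → u a ≡ sumℚ (λ i → (u ∙ basis F i) * dual F i a)
  expand-dual F u a = begin
    u a                                                    ≡⟨ sum-*-δ a u ⟨
    u ∙ (λ b → δ b a)                                      ≡⟨ ∙-congʳ u (λ b → trans (δ-sym b a) (expand F (δ a) b)) ⟩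
    u ∙ (λ b → sumℚ (λ i → (dual F i ∙ δ a) * basis F i b))  ≡⟨ ∙-sumʳ u (λ i → dual F i ∙ δ a) (basis F) ⟩
    sumℚ (λ i → (dual F i ∙ δ a) * (u ∙ basis F i))        ≡⟨ sum-cong (λ i → trans (cong (_* (u ∙ basis F i)) (dual-δ i)) (*-comm _ (u ∙ basis F i))) ⟩
    sumℚ (λ i → (u ∙ basis F i) * dual F i a)              ∎
    where
    open ≡-Reasoning
    dual-δ : ∀ i → dual F i ∙ δ a ≡ dual F i a
    dual-δ i = trans (∙-congʳ (dual F i) (δ-sym a)) (sum-*-δ a (dual F i))

  cramer : ∀ {r} (F : Frame r) i w →
    colDet r (replace (basis F) i w) ≡ (dual F i ∙ w) * colDet r (basis F)
  cramer F i w = colDet-replace-combination (basis F) i w (λ j → dual F j ∙ w) (expand F w)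

  -- Writing the replacement as a δ-correction avoids a case split on k, so sums over the new basis
  -- are open to ring identities and `sum-*-δ`.
  replace-δ : ∀ {r} (v : Fin r → Fin r → ℚ) i w k a →
    replace v i w k a ≡ v k a + δ k i * (w a - v i a)
  replace-δ v i w k a with k Fin.≟ i
  ... | yes refl = begin
    replace v k w k a              ≡⟨ replace-at v k w a ⟩
    w a                            ≡⟨ eq (v k a) (w a) ⟩
    v k a + 1ℚ * (w a - v k a)     ≡⟨ cong (λ d → v k a + d * (w a - v k a)) (δ-refl k) ⟨
    v k a + δ k k * (w a - v k a)  ∎
    where
    open ≡-Reasoning
    eq : ∀ x y → y ≡ x + 1ℚ * (y - x)
    eq = solve-∀ ℚ-ring
  ... | no k≢i = begin
    replace v i w k a              ≡⟨ replace-away v i w k k≢i a ⟩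
    v k a                          ≡⟨ eq (v k a) (w a - v i a) ⟩
    v k a + 0ℚ * (w a - v i a)     ≡⟨ cong (λ d → v k a + d * (w a - v i a)) (δ-≢ k≢i) ⟨
    v k a + δ k i * (w a - v i a)  ∎
    where
    open ≡-Reasoning
    eq : ∀ x y → x ≡ x + 0ℚ * y
    eq = solve-∀ ℚ-ring

  module Pivot {r} (F : Frame r) (i : Fin r) (w : Fin r → ℚ) (pivot≢0 : dual F i ∙ w ≢ 0ℚ) where
    open ≡-Reasoning

    private
      v D : Fin r → Fin r → ℚ
      v = basis F
      D = dual F

      p s : ℚ
      p = D i ∙ w
      s = proj₁ (reciprocal pivot≢0)

      ps≡1 : p * s ≡ 1ℚ
      ps≡1 = proj₂ (reciprocal pivot≢0)

      -- One formula for both cases of the Gauss-Jordan update: since s is the inverse of p, the new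
      -- dual vector is D i divided by p for k = i, and D k minus (D k ∙ w) / p times D i for k ≠ i.
      c : Fin r → ℚ
      c k = - ((D k ∙ w - δ k i) * s)

      D′ : Fin r → Fin r → ℚ
      D′ k a = 1ℚ * D k a + c k * D i a

      D′-∙ : ∀ k x → D′ k ∙ x ≡ D k ∙ x + c k * (D i ∙ x)
      D′-∙ k x = trans (∙-linearˡ 1ℚ (c k) (D k) (D i) x)
        (cong (_+ c k * (D i ∙ x)) (*-identityˡ (D k ∙ x)))

      biorthogonal′ : ∀ k j → D′ k ∙ replace v i w j ≡ δ k j
      biorthogonal′ k j with j Fin.≟ i
      ... | yes refl = begin
        D′ k ∙ replace v j w j                         ≡⟨ ∙-congʳ (D′ k) (replace-at v j w) ⟩
        D′ k ∙ w                                       ≡⟨ D′-∙ k w ⟩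
        D k ∙ w + - ((D k ∙ w - δ k j) * s) * p        ≡⟨ eq (D k ∙ w) (δ k j) s p ⟩
        D k ∙ w - (D k ∙ w - δ k j) * (p * s)          ≡⟨ cong (λ t → D k ∙ w - (D k ∙ w - δ k j) * t) ps≡1 ⟩
        D k ∙ w - (D k ∙ w - δ k j) * 1ℚ               ≡⟨ eq′ (D k ∙ w) (δ k j) ⟩
        δ k j                                          ∎
        where
        eq : ∀ x d s p → x + - ((x - d) * s) * p ≡ x - (x - d) * (p * s)
        eq = solve-∀ ℚ-ring
        eq′ : ∀ x d → x - (x - d) * 1ℚ ≡ d
        eq′ = solve-∀ ℚ-ring
      ... | no j≢i = begin
        D′ k ∙ replace v i w j           ≡⟨ ∙-congʳ (D′ k) (replace-away v i w j j≢i) ⟩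
        D′ k ∙ v j                       ≡⟨ D′-∙ k (v j) ⟩
        D k ∙ v j + c k * (D i ∙ v j)    ≡⟨ cong₂ (λ x y → x + c k * y) (biorthogonal F k j)
                                              (trans (biorthogonal F i j) (δ-≢ (j≢i ∘ sym))) ⟩
        δ k j + c k * 0ℚ                 ≡⟨ eq (δ k j) (c k) ⟩
        δ k j                            ∎
        where
        eq : ∀ x c → x + c * 0ℚ ≡ x
        eq = solve-∀ ℚ-ring

      -- Reassembling w from its old coordinates collapses the sum. In `expand′` this cancels the
      -- change made to the i-th basis vector.
      Σcv : ∀ a → sumℚ (λ k → c k * v k a) ≡ - (s * (w a - v i a))
      Σcv a = begin
        sumℚ (λ k → c k * v k a)
          ≡⟨ sum-cong (λ k → eq (D k ∙ w) (δ k i) s (v k a)) ⟩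
        sumℚ (λ k → - s * ((D k ∙ w) * v k a) + s * (v k a * δ k i))
          ≡⟨ sum-linear (- s) s (λ k → (D k ∙ w) * v k a) (λ k → v k a * δ k i) ⟩
        - s * sumℚ (λ k → (D k ∙ w) * v k a) + s * sumℚ (λ k → v k a * δ k i)
          ≡⟨ cong₂ (λ x y → - s * x + s * y) (sym (expand F w a)) (sum-*-δ i (λ k → v k a)) ⟩
        - s * w a + s * v i a
          ≡⟨ eq′ s (w a) (v i a) ⟩
        - (s * (w a - v i a))
          ∎
        where
        eq : ∀ x d s y → - ((x - d) * s) * y ≡ - s * (x * y) + s * (y * d)
        eq = solve-∀ ℚ-ring
        eq′ : ∀ s x y → - s * x + s * y ≡ - (s * (x - y))
        eq′ = solve-∀ ℚ-ring

      expand′ : ∀ x a → x a ≡ sumℚ (λ k → (D′ k ∙ x) * replace v i w k a)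
      expand′ x a = sym (begin
        sumℚ (λ k → (D′ k ∙ x) * replace v i w k a)
          ≡⟨ sum-cong (λ k → trans (cong₂ _*_ (D′-∙ k x) (replace-δ v i w k a))
               (eq (D k ∙ x) (c k) (D i ∙ x) (v k a) (δ k i) (w a - v i a))) ⟩
        sumℚ (λ k → ((D k ∙ x) * v k a + (D i ∙ x) * (c k * v k a)) +
                    ((D k ∙ x + c k * (D i ∙ x)) * (w a - v i a)) * δ k i)
          ≡⟨ sum-+ (λ k → (D k ∙ x) * v k a + (D i ∙ x) * (c k * v k a)) _ ⟩
        sumℚ (λ k → (D k ∙ x) * v k a + (D i ∙ x) * (c k * v k a)) +
        sumℚ (λ k → ((D k ∙ x + c k * (D i ∙ x)) * (w a - v i a)) * δ k i)
          ≡⟨ cong₂ _+_ (sum-+ (λ k → (D k ∙ x) * v k a) _)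
               (sum-*-δ i (λ k → (D k ∙ x + c k * (D i ∙ x)) * (w a - v i a))) ⟩
        (sumℚ (λ k → (D k ∙ x) * v k a) + sumℚ (λ k → (D i ∙ x) * (c k * v k a))) +
        (D i ∙ x + c i * (D i ∙ x)) * (w a - v i a)
          ≡⟨ cong₂ (λ y z → (y + z) + (D i ∙ x + c i * (D i ∙ x)) * (w a - v i a))
               (sym (expand F x a))
               (trans (sum-*ˡ (D i ∙ x) (λ k → c k * v k a)) (cong ((D i ∙ x) *_) (Σcv a))) ⟩
        (x a + (D i ∙ x) * - (s * (w a - v i a))) +
        (D i ∙ x + - ((p - δ i i) * s) * (D i ∙ x)) * (w a - v i a)
          ≡⟨ cong (λ d → (x a + (D i ∙ x) * - (s * (w a - v i a))) +
                         (D i ∙ x + - ((p - d) * s) * (D i ∙ x)) * (w a - v i a)) (δ-refl i) ⟩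
        (x a + (D i ∙ x) * - (s * (w a - v i a))) +
        (D i ∙ x + - ((p - 1ℚ) * s) * (D i ∙ x)) * (w a - v i a)
          ≡⟨ eq′ (x a) (D i ∙ x) s (w a - v i a) p ⟩
        x a + (D i ∙ x) * (w a - v i a) * (1ℚ - p * s)
          ≡⟨ cong (λ t → x a + (D i ∙ x) * (w a - v i a) * (1ℚ - t)) ps≡1 ⟩
        x a + (D i ∙ x) * (w a - v i a) * (1ℚ - 1ℚ)
          ≡⟨ eq″ (x a) ((D i ∙ x) * (w a - v i a)) ⟩
        x a
          ∎)
        where
        eq : ∀ X c Y v d z → (X + c * Y) * (v + d * z) ≡ (X * v + Y * (c * v)) + ((X + c * Y) * z) * d
        eq = solve-∀ ℚ-ring
        eq′ : ∀ x Y s z p → (x + Y * - (s * z)) + (Y + - ((p - 1ℚ) * s) * Y) * z ≡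
                            x + Y * z * (1ℚ - p * s)
        eq′ = solve-∀ ℚ-ring
        eq″ : ∀ x y → x + y * (1ℚ - 1ℚ) ≡ x
        eq″ = solve-∀ ℚ-ring

    -- The updated dual vectors stay opaque: later arguments rest on the laws of a `Frame` and on
    -- knowing which basis vector changed.
    abstract
      pivoted : Frame r
      pivoted = record
        { basis        = replace v i w
        ; dual         = D′
        ; biorthogonal = biorthogonal′
        ; expand       = expand′
        ; colDet≢0     = λ d≡0 → colDet≢0 F (p*q≡0⇒q≡0 pivot≢0 (trans (sym (cramer F i w)) d≡0))
        }

      pivoted-at : ∀ a → basis pivoted i a ≡ w a
      pivoted-at = replace-at v i w

      pivoted-away : ∀ j → j ≢ i → ∀ a → basis pivoted j a ≡ basis F j a
      pivoted-away = replace-away v i w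

  open Pivot using (pivoted; pivoted-at; pivoted-away) public

  dual-separates : ∀ {r} (F : Frame r) {x y : Fin r → ℚ} →
    (∀ i → dual F i ∙ x ≡ dual F i ∙ y) → ∀ a → x a ≡ y a
  dual-separates F {x} {y} h a = trans (expand F x a)
    (trans (sum-cong λ i → cong (_* basis F i a) (h i)) (sym (expand F y a)))

  nonzero-coordinate : ∀ {r} (F : Frame r) {x : Fin r → ℚ} →
    ¬ (∀ a → x a ≡ 0ℚ) → ∃[ i ] dual F i ∙ x ≢ 0ℚ
  nonzero-coordinate F {x} x≢0 with any? (λ i → ¬? (dual F i ∙ x ≟ 0ℚ))
  ... | yes found = found
  ... | no none = contradiction vanish x≢0
    where
    vanish : ∀ a → x a ≡ 0ℚ
    vanish a = trans (expand F x a) (sum-zero λ i → trans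
      (cong (_* basis F i a) (decidable-stable (dual F i ∙ x ≟ 0ℚ) λ ne → none (i , ne)))
      (*-zeroˡ (basis F i a)))

  column : ∀ {r n} → Mat r n → Fin n → Fin r → ℚ
  column M j a = toℚ (M a j)

  -- Stated for arbitrary families and not only for frames, since the family with one column
  -- replaced in Cramer's rule may be degenerate.
  FromColumns : ∀ {r n} → Mat r n → (Fin r → Fin r → ℚ) → Set
  FromColumns M v = ∀ i → ∃[ j ] (∀ a → v i a ≡ column M j a)

  IsBasis : ∀ {r n} → Mat r n → Frame r → Set
  IsBasis M F = FromColumns M (basis F)

  replace-fromColumns : ∀ {r n} (M : Mat r n) {v} → FromColumns M v →
    ∀ i j → FromColumns M (replace v i (column M j))
  replace-fromColumns M {v} v-columns i j k with k Fin.≟ i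
  ... | yes refl = j , replace-at v k (column M j)
  ... | no k≢i with v-columns k
  ...   | l , e = l , λ a → trans (replace-away v i (column M j) k k≢i a) (e a)

  pivoted-isBasis : ∀ {r n} (M : Mat r n) {F} → IsBasis M F →
    ∀ i j (h : dual F i ∙ column M j ≢ 0ℚ) → IsBasis M (pivoted F i (column M j) h)
  pivoted-isBasis M {F} F-basis i j h k with k Fin.≟ i
  ... | yes refl = j , pivoted-at F i (column M j) h
  ... | no k≢i with F-basis k
  ...   | l , e = l , λ a → trans (pivoted-away F i (column M j) h k k≢i a) (e a)

  -- Positions below t hold columns of M, the others still unit vectors. If every column had
  -- coordinate 0 at position t, the dual vector there would annihilate all columns and vanish by
  -- full rank, although it takes the value 1 on its own basis vector. So some column can be
  -- exchanged in.
  partial-basis : ∀ {r n} (M : Mat r n) → FullRank M → ∀ t → t ℕ.≤ r →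
    Σ (Frame r) λ F → ∀ i → toℕ i ℕ.< t → ∃[ j ] (∀ a → basis F i a ≡ column M j a)
  partial-basis {r} M fullRank zero    _   = standardFrame r , λ _ ()
  partial-basis {r} M fullRank (suc t) t<r with partial-basis M fullRank t (ℕP.<⇒≤ t<r)
  ... | F , done with any? (λ j → ¬? (dual F (fromℕ< t<r) ∙ column M j ≟ 0ℚ))
  ...   | no none = contradiction 1≡0 λ ()
    where
    i : Fin r
    i = fromℕ< t<r
    dual≡0 : ∀ a → dual F i a ≡ 0ℚ
    dual≡0 = fullRank (dual F i) λ j →
      decidable-stable (dual F i ∙ column M j ≟ 0ℚ) λ ne → none (j , ne)
    1≡0 : 1ℚ ≡ 0ℚ
    1≡0 = trans (sym (trans (biorthogonal F i i) (δ-refl i)))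
      (sum-zero λ a → trans (cong (_* basis F i a) (dual≡0 a)) (*-zeroˡ (basis F i a)))
  ...   | yes (j , ne) = F′ , done′
    where
    i : Fin r
    i = fromℕ< t<r
    F′ : Frame r
    F′ = pivoted F i (column M j) ne
    done′ : ∀ k → toℕ k ℕ.< suc t → ∃[ l ] (∀ a → basis F′ k a ≡ column M l a)
    done′ k k<1+t with k Fin.≟ i
    ... | yes refl = j , pivoted-at F i (column M j) ne
    ... | no k≢i with done k (ℕP.≤∧≢⇒< (ℕP.≤-pred k<1+t)
                        λ e → k≢i (toℕ-injective (trans e (sym (toℕ-fromℕ< t<r)))))
    ...   | l , e = l , λ a → trans (pivoted-away F i (column M j) ne k k≢i a) (e a)

  abstract
    basis-exists : ∀ {r n} (M : Mat r n) → FullRank M → ∃[ F ] IsBasis M F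
    basis-exists {r} M fullRank with partial-basis M fullRank r ℕP.≤-refl
    ... | F , all-columns = F , λ i → all-columns i (toℕ<n i)

  module Unimodular {r n} (M : Mat r n) (unimodular : WeaklyUnimodular M) where

    column-int : ∀ j a → IsInt (column M j a)
    column-int j a = M a j , refl

    -- The choice c may repeat a column: `WeaklyUnimodular` ranges over all choices, so this also
    -- covers families in which a replacement has doubled a column.
    columns-sign : ∀ (v : Fin r → Fin r → ℚ) → FromColumns M v →
      IsSign (colDet r v)
    columns-sign v v-columns = subst IsSign
      (trans (toℚ-det r (λ a b → M a (c b))) (colDet-cong r λ b a → sym (proj₂ (v-columns b) a)))
      minor-sign
      where
      c : Fin r → Fin n
      c i = proj₁ (v-columns i)
      minor-sign : IsSign (toℚ (minor M c))
      minor-sign with unimodular c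
      ... | inj₁ e        = inj₁ (cong toℚ e)
      ... | inj₂ (inj₁ e) = inj₂ (inj₁ (cong toℚ e))
      ... | inj₂ (inj₂ e) = inj₂ (inj₂ (cong toℚ e))

    module _ (F : Frame r) (F-basis : IsBasis M F) where

      private
        d : ℚ
        d = colDet r (basis F)

        d-sign : IsSign d
        d-sign = columns-sign (basis F) F-basis

        d*d≡1 : d * d ≡ 1ℚ
        d*d≡1 with d-sign
        ... | inj₁ e        = contradiction e (colDet≢0 F)
        ... | inj₂ (inj₁ e) = cong₂ _*_ e e
        ... | inj₂ (inj₂ e) = cong₂ _*_ e e

        -- As d is its own inverse, Cramer's rule is solved for the coordinate by multiplying with
        -- d.
        coordinate : ∀ i w → colDet r (replace (basis F) i w) * d ≡ dual F i ∙ w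
        coordinate i w = begin
          colDet r (replace (basis F) i w) * d  ≡⟨ cong (_* d) (cramer F i w) ⟩
          (dual F i ∙ w) * d * d                ≡⟨ *-assoc (dual F i ∙ w) d d ⟩
          (dual F i ∙ w) * (d * d)              ≡⟨ cong ((dual F i ∙ w) *_) d*d≡1 ⟩
          (dual F i ∙ w) * 1ℚ                   ≡⟨ *-identityʳ _ ⟩
          dual F i ∙ w                          ∎
          where open ≡-Reasoning

      -- The coordinate is a product of two maximal minors, each 0 or ±1.
      coordinate-sign : ∀ i j → IsSign (dual F i ∙ column M j)
      coordinate-sign i j = subst IsSign (coordinate i (column M j))
        (sign-* (columns-sign _ (replace-fromColumns M F-basis i j)) d-sign)

      coordinate-int : ∀ i {w} → (∀ a → IsInt (w a)) → IsInt (dual F i ∙ w)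
      coordinate-int i {w} w-int = subst IsInt (coordinate i w)
        (int-* (colDet-int r replaced) (sign⇒int d-sign))
        where
        replaced : ∀ k a → IsInt (replace (basis F) i w k a)
        replaced k a with k Fin.≟ i
        ... | yes refl = subst IsInt (sym (replace-at (basis F) k w a)) (w-int a)
        ... | no k≢i with F-basis k
        ...   | l , e = subst IsInt (sym (trans (replace-away (basis F) i w k k≢i a) (e a))) (column-int l a)

      -- The entries of a dual vector are the i-th coordinates of the unit vectors, which are
      -- integral points.
      dual-int : ∀ i a → IsInt (dual F i a)
      dual-int i a = subst IsInt (sum-*-δ a (dual F i))
        (coordinate-int i λ b → sign⇒int (δ-sign b a))

-- Convex hulls, and linear and affine dependence.

module Convexity where

  open import Data.Rational
  open import Data.Rational.Properties
  open Rationals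

  pt-ext : ∀ {A : Set} {r} {x y : Vec A r} → (∀ a → lookup x a ≡ lookup y a) → x ≡ y
  pt-ext {x = x} {y} h =
    trans (sym (tabulate∘lookup x)) (trans (tabulate-cong h) (tabulate∘lookup y))

  lookup-0v : ∀ {r} (a : Fin r) → lookup 0v a ≡ 0ℚ
  lookup-0v = lookup∘tabulate (λ _ → 0ℚ)

  lookup-negv : ∀ {r} (x : Pt r) a → lookup (negv x) a ≡ - lookup x a
  lookup-negv x a = lookup-map a -_ x

  lookup-lincomb : ∀ {r m} (w : Fin m → ℚ) (p : Fin m → Pt r) a →
    lookup (lincomb w p) a ≡ sumℚ (λ j → w j * lookup (p j) a)
  lookup-lincomb w p = lookup∘tabulate (λ i → sumℚ (λ j → w j * lookup (p j) i))

  lookup-segPt : ∀ {r} t (y z : Pt r) a → lookup (segPt t y z) a ≡ t * lookup y a + (1ℚ - t) * lookup z a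
  lookup-segPt t y z a = lookup-zipWith (λ b c → t * b + (1ℚ - t) * c) a y z

  ≢0v⇒nonzero : ∀ {r} {x : Pt r} → x ≢ 0v → ¬ (∀ a → lookup x a ≡ 0ℚ)
  ≢0v⇒nonzero x≢0 h = x≢0 (pt-ext λ a → trans (h a) (sym (lookup-0v a)))

  -- Convex hulls

  convex-≤ : ∀ {m} {w f : Fin m → ℚ} {c} → (∀ k → 0ℚ ≤ w k) → sumℚ w ≡ 1ℚ → (∀ k → f k ≤ c) →
    sumℚ (λ k → w k * f k) ≤ c
  convex-≤ {w = w} {f} {c} w≥0 Σw≡1 f≤c = begin
    sumℚ (λ k → w k * f k)  ≤⟨ sum-mono (λ k → *-monoˡ-≤-nonNeg (w k) {{nonNegative (w≥0 k)}} (f≤c k)) ⟩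
    sumℚ (λ k → w k * c)    ≡⟨ sum-*ʳ c w ⟩
    sumℚ w * c              ≡⟨ cong (_* c) Σw≡1 ⟩
    1ℚ * c                  ≡⟨ *-identityˡ c ⟩
    c                       ∎
    where open ≤-Reasoning

  -- The weighted slacks w k * (c - f k) are nonnegative and add up to c - c, so each of them is
  -- zero.
  convex-tight : ∀ {m} {w f : Fin m → ℚ} {c} → (∀ k → 0ℚ ≤ w k) → sumℚ w ≡ 1ℚ → (∀ k → f k ≤ c) →
    sumℚ (λ k → w k * f k) ≡ c → ∀ k → 0ℚ < w k → f k ≡ c
  convex-tight {w = w} {f} {c} w≥0 Σw≡1 f≤c tight k wk>0 =
    sym (p-q≡0⇒p≡q (p*q≡0⇒q≡0 (0<p⇒p≢0 wk>0) (sum-nonneg≡0 slack≥0 Σslack≡0 k)))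
    where
    open ≡-Reasoning
    slack≥0 : ∀ k → 0ℚ ≤ w k * (c - f k)
    slack≥0 k = 0≤p⇒0≤q⇒0≤p*q (w≥0 k) (p≤q⇒0≤q-p (f≤c k))
    eq : ∀ w c f → w * (c - f) ≡ c * w + - 1ℚ * (w * f)
    eq w c f = trans (eq′ w c f) (cong (c * w +_) (neg-distribˡ-* 1ℚ (w * f)))
      where
      eq′ : ∀ w c f → w * (c - f) ≡ c * w + - (1ℚ * (w * f))
      eq′ = solve-∀ ℚ-ring
    Σslack≡0 : sumℚ (λ k → w k * (c - f k)) ≡ 0ℚ
    Σslack≡0 = begin
      sumℚ (λ k → w k * (c - f k))              ≡⟨ sum-cong (λ k → eq (w k) c (f k)) ⟩
      sumℚ (λ k → c * w k + - 1ℚ * (w k * f k))  ≡⟨ sum-linear c (- 1ℚ) w (λ k → w k * f k) ⟩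
      c * sumℚ w + - 1ℚ * sumℚ (λ k → w k * f k) ≡⟨ cong₂ (λ x y → c * x + - 1ℚ * y) Σw≡1 tight ⟩
      c * 1ℚ + - 1ℚ * c                         ≡⟨ cong₂ _+_ (*-identityʳ c) (sym (neg-distribˡ-* 1ℚ c)) ⟩
      c + - (1ℚ * c)                            ≡⟨ cong (λ x → c + - x) (*-identityˡ c) ⟩
      c - c                                     ≡⟨ +-inverseʳ c ⟩
      0ℚ                                        ∎

  conv-member : ∀ {r m} (p : Fin m → Pt r) k → InConv p (p k)
  conv-member p k = δ k , δ-nonneg k , sum-δ k ,
    pt-ext λ a → sym (trans (lookup-lincomb (δ k) p a) (sum-δ-* k (λ j → lookup (p j) a)))

  conv-combination : ∀ {r m l} (p : Fin m → Pt r) (q : Fin l → Pt r) → (∀ i → InConv p (q i)) →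
    (w : Fin l → ℚ) → (∀ i → 0ℚ ≤ w i) → sumℚ w ≡ 1ℚ →
    ∀ x → (∀ a → lookup x a ≡ sumℚ (λ i → w i * lookup (q i) a)) → InConv p x
  conv-combination {m = m} {l} p q q∈ w w≥0 Σw≡1 x x≡ = W , W≥0 , ΣW≡1 , pt-ext W-point
    where
    open ≡-Reasoning
    u : Fin l → Fin m → ℚ
    u i = proj₁ (q∈ i)
    W : Fin m → ℚ
    W k = sumℚ (λ i → w i * u i k)
    W≥0 : ∀ k → 0ℚ ≤ W k
    W≥0 k = sum-nonneg λ i → 0≤p⇒0≤q⇒0≤p*q (w≥0 i) (proj₁ (proj₂ (q∈ i)) k)
    ΣW≡1 : sumℚ W ≡ 1ℚ
    ΣW≡1 = begin
      sumℚ (λ k → sumℚ (λ i → w i * u i k))  ≡⟨ sum-swap (λ k i → w i * u i k) ⟩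
      sumℚ (λ i → sumℚ (λ k → w i * u i k))  ≡⟨ sum-cong (λ i → sum-*ˡ (w i) (u i)) ⟩
      sumℚ (λ i → w i * sumℚ (u i))          ≡⟨ sum-cong (λ i → cong (w i *_) (proj₁ (proj₂ (proj₂ (q∈ i))))) ⟩
      sumℚ (λ i → w i * 1ℚ)                  ≡⟨ sum-cong (λ i → *-identityʳ (w i)) ⟩
      sumℚ w                                 ≡⟨ Σw≡1 ⟩
      1ℚ                                     ∎
    W-point : ∀ a → lookup x a ≡ lookup (lincomb W p) a
    W-point a = begin
      lookup x a
        ≡⟨ x≡ a ⟩
      sumℚ (λ i → w i * lookup (q i) a)
        ≡⟨ sum-cong (λ i → cong (w i *_) (trans (cong (λ y → lookup y a) (proj₂ (proj₂ (proj₂ (q∈ i)))))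
             (lookup-lincomb (u i) p a))) ⟩
      sumℚ (λ i → w i * (u i ∙ (λ k → lookup (p k) a)))
        ≡⟨ sum-cong (λ i → cong (w i *_) (sum-cong λ k → *-comm (u i k) (lookup (p k) a))) ⟩
      sumℚ (λ i → w i * ((λ k → lookup (p k) a) ∙ u i))
        ≡⟨ ∙-sumʳ (λ k → lookup (p k) a) w u ⟨
      (λ k → lookup (p k) a) ∙ W
        ≡⟨ sum-cong (λ k → *-comm (lookup (p k) a) (W k)) ⟩
      sumℚ (λ k → W k * lookup (p k) a)
        ≡⟨ lookup-lincomb W p a ⟨
      lookup (lincomb W p) a
        ∎

  conv-segment : ∀ {r m} (p : Fin m → Pt r) {y z} → InConv p y → InConv p z →
    ∀ t → 0ℚ ≤ t → t ≤ 1ℚ → InConv p (segPt t y z)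
  conv-segment p {y} {z} y∈ z∈ t 0≤t t≤1 =
    conv-combination p q q∈ w w≥0 (sum-to-1 t) (segPt t y z) λ a →
      trans (lookup-segPt t y z a) (cong (t * lookup y a +_) (sym (+-identityʳ ((1ℚ - t) * lookup z a))))
    where
    q : Fin 2 → Pt _
    q zero       = y
    q (suc zero) = z
    q∈ : ∀ i → InConv p (q i)
    q∈ zero       = y∈
    q∈ (suc zero) = z∈
    w : Fin 2 → ℚ
    w zero       = t
    w (suc zero) = 1ℚ - t
    w≥0 : ∀ i → 0ℚ ≤ w i
    w≥0 zero       = 0≤t
    w≥0 (suc zero) = p≤q⇒0≤q-p t≤1
    sum-to-1 : ∀ t → t + (1ℚ - t + 0ℚ) ≡ 1ℚ
    sum-to-1 = solve-∀ ℚ-ring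

  conv-functional : ∀ {r m} (p : Fin m → Pt r) (u : Fin r → ℚ) (w : Fin m → ℚ) {x} → x ≡ lincomb w p →
    u ∙ lookup x ≡ sumℚ (λ k → w k * (u ∙ lookup (p k)))
  conv-functional p u w refl = trans (∙-congʳ u (lookup-lincomb w p)) (∙-sumʳ u w (λ k → lookup (p k)))

  conv-functional-≤ : ∀ {r m} (p : Fin m → Pt r) (u : Fin r → ℚ) {c} → (∀ k → u ∙ lookup (p k) ≤ c) →
    ∀ {x} → InConv p x → u ∙ lookup x ≤ c
  conv-functional-≤ p u u≤ (w , w≥0 , Σw≡1 , x≡) =
    subst (_≤ _) (sym (conv-functional p u w x≡)) (convex-≤ w≥0 Σw≡1 u≤)

  -- Linear dependence

  -- Gaussian elimination on the first coordinate. If all vectors vanish there, one of them gets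
  -- coefficient 0 and the rest form a smaller instance. Otherwise some x p clears the first
  -- coordinate of the others, and a relation among the cleared vectors is lifted.
  dependent : ∀ k (x : Fin (suc k) → Fin k → ℚ) →
    Σ (Fin (suc k) → ℚ) λ c → (∃[ j ] c j ≢ 0ℚ) × (∀ a → sumℚ (λ j → c j * x j a) ≡ 0ℚ)
  dependent zero    x = (λ _ → 1ℚ) , (zero , λ ()) , λ ()
  dependent (suc k) x with any? (λ j → ¬? (x j zero ≟ 0ℚ))
  ... | no none with dependent k (λ j a → x (suc j) (suc a))
  ...   | c , (j , cj≢0) , rel = c′ , (suc j , cj≢0) , rel′
    where
    x₀≡0 : ∀ j → x j zero ≡ 0ℚ
    x₀≡0 j = decidable-stable (x j zero ≟ 0ℚ) λ ne → none (j , ne)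
    c′ : Fin (suc (suc k)) → ℚ
    c′ zero    = 0ℚ
    c′ (suc j) = c j
    rel′ : ∀ a → sumℚ (λ j → c′ j * x j a) ≡ 0ℚ
    rel′ zero    = sum-zero λ j → trans (cong (c′ j *_) (x₀≡0 j)) (*-zeroʳ (c′ j))
    rel′ (suc a) = cong₂ _+_ (*-zeroˡ (x zero (suc a))) (rel a)
  dependent (suc k) x | yes (p , xp≢0) = eliminated
    where
    open ≡-Reasoning
    s : ℚ
    s = proj₁ (reciprocal xp≢0)
    y : Fin (suc k) → Fin k → ℚ
    y j a = x (punchIn p j) (suc a) - x (punchIn p j) zero * s * x p (suc a)
    eliminated : Σ (Fin (suc (suc k)) → ℚ) λ c → (∃[ j ] c j ≢ 0ℚ) × (∀ a → sumℚ (λ j → c j * x j a) ≡ 0ℚ)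
    eliminated with dependent k y
    ... | c , (j , cj≢0) , rel =
      c′ , (punchIn p j , λ e → cj≢0 (trans (sym (insertAt-punchIn c p cp j)) e)) , rel′
      where
      S : ℚ
      S = sumℚ (λ j → c j * x (punchIn p j) zero)
      -- The coefficient at p is forced by the first coordinate: it must cancel the sum S of the
      -- other terms there.
      cp : ℚ
      cp = - (S * s)
      c′ : Fin (suc (suc k)) → ℚ
      c′ = insertAt c p cp
      split : ∀ a → sumℚ (λ j → c′ j * x j a) ≡ cp * x p a + sumℚ (λ j → c j * x (punchIn p j) a)
      split a = trans (sum-remove p (λ j → c′ j * x j a))
        (cong₂ _+_ (cong (_* x p a) (insertAt-lookup c p cp))
          (sum-cong λ j → cong (_* x (punchIn p j) a) (insertAt-punchIn c p cp j)))
      rel′ : ∀ a → sumℚ (λ j → c′ j * x j a) ≡ 0ℚ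
      rel′ zero = begin
        sumℚ (λ j → c′ j * x j zero)      ≡⟨ split zero ⟩
        - (S * s) * x p zero + S          ≡⟨ eq S s (x p zero) ⟩
        S * (1ℚ - x p zero * s)           ≡⟨ cong (λ t → S * (1ℚ - t)) (proj₂ (reciprocal xp≢0)) ⟩
        S * (1ℚ - 1ℚ)                     ≡⟨ *-zeroʳ S ⟩
        0ℚ                                ∎
        where
        eq : ∀ S s x → - (S * s) * x + S ≡ S * (1ℚ - x * s)
        eq = solve-∀ ℚ-ring
      rel′ (suc a) = begin
        sumℚ (λ j → c′ j * x j (suc a))
          ≡⟨ split (suc a) ⟩
        - (S * s) * x p (suc a) + sumℚ (λ j → c j * x (punchIn p j) (suc a))
          ≡⟨ eq S s (x p (suc a)) _ ⟩
        1ℚ * sumℚ (λ j → c j * x (punchIn p j) (suc a)) + - (s * x p (suc a)) * S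
          ≡⟨ sum-linear 1ℚ (- (s * x p (suc a))) (λ j → c j * x (punchIn p j) (suc a))
               (λ j → c j * x (punchIn p j) zero) ⟨
        sumℚ (λ j → 1ℚ * (c j * x (punchIn p j) (suc a)) + - (s * x p (suc a)) * (c j * x (punchIn p j) zero))
          ≡⟨ sum-cong (λ j → eq′ (c j) (x (punchIn p j) (suc a)) s (x p (suc a)) (x (punchIn p j) zero)) ⟩
        sumℚ (λ j → c j * y j a)
          ≡⟨ rel a ⟩
        0ℚ
          ∎
        where
        eq : ∀ S s x T → - (S * s) * x + T ≡ 1ℚ * T + - (s * x) * S
        eq = solve-∀ ℚ-ring
        eq′ : ∀ c y s x z → 1ℚ * (c * y) + - (s * x) * (c * z) ≡ c * (y - z * s * x)
        eq′ = solve-∀ ℚ-ring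

  -- An extra coordinate equal to 1 turns affine dependence into linear dependence: r + 2 vectors in
  -- dimension r + 1, where the new coordinate says that the coefficients sum to zero.
  ¬affIndep : ∀ {r} (p : Fin (suc (suc r)) → Pt r) → ¬ AffIndep p
  ¬affIndep {r} p indep with dependent (suc r) x
    where
    x : Fin (suc (suc r)) → Fin (suc r) → ℚ
    x j zero    = 1ℚ
    x j (suc a) = lookup (p j) a
  ... | c , (j , cj≢0) , rel = cj≢0 (indep c
    (trans (sum-cong λ j → sym (*-identityʳ (c j))) (rel zero))
    (pt-ext λ a → trans (lookup-lincomb c p a) (trans (rel (suc a)) (sym (lookup-0v a)))) j)

  argmin : ∀ {m} {P : Fin m → Set} → (∀ k → Dec (P k)) → (f : Fin m → ℚ) → ∃ P →
    ∃[ k ] (P k × (∀ l → P l → f k ≤ f l))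
  argmin {zero}  P? f (() , _)
  argmin {suc m} P? f ex with any? (P? ∘ suc)
  argmin {suc m} P? f (zero , P₀)  | no none =
    zero , P₀ , λ { zero _ → ≤-refl ; (suc l) Pl → contradiction (l , Pl) none }
  argmin {suc m} P? f (suc k , Pk) | no none = contradiction (k , Pk) none
  argmin {suc m} P? f _ | yes ex′ with argmin (P? ∘ suc) (f ∘ suc) ex′ | P? zero
  ... | k , Pk , min | no ¬P₀ =
    suc k , Pk , λ { zero P₀ → contradiction P₀ ¬P₀ ; (suc l) → min l }
  ... | k , Pk , min | yes P₀ with ≤-total (f zero) (f (suc k))
  ...   | inj₁ f₀≤ = zero , P₀ , λ { zero _ → ≤-refl ; (suc l) Pl → ≤-trans f₀≤ (min l Pl) }
  ...   | inj₂ ≤f₀ = suc k , Pk , λ { zero _ → ≤f₀ ; (suc l) → min l }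

-- The symmetric polytope: symmetry, dimension, interior, lattice points and vertices.

module SymmetricPolytope where

  open import Data.Rational
  open import Data.Rational.Properties
  open Rationals
  open Frames
  open Convexity

  module Polytope {r n} (M : Mat r n) (fullRank : FullRank M) (unimodular : WeaklyUnimodular M)
                  (0<r : 0 ℕ.< r) where

    open Unimodular M unimodular

    F₀ : Frame r
    F₀ = proj₁ (basis-exists M fullRank)

    F₀-basis : IsBasis M F₀
    F₀-basis = proj₂ (basis-exists M fullRank)

    g : Fin (n ℕ.+ n) → Fin r → ℚ
    g k = lookup (genPM M k)

    genPM-↑ˡ : ∀ j → genPM M (j ↑ˡ n) ≡ col M j
    genPM-↑ˡ j rewrite splitAt-↑ˡ n j n = refl

    genPM-↑ʳ : ∀ j → genPM M (n ↑ʳ j) ≡ negv (col M j)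
    genPM-↑ʳ j rewrite splitAt-↑ʳ n n j = refl

    lookup-col : ∀ j a → lookup (col M j) a ≡ column M j a
    lookup-col j = lookup∘tabulate (column M j)

    g-↑ˡ : ∀ j a → g (j ↑ˡ n) a ≡ column M j a
    g-↑ˡ j a = trans (cong (λ y → lookup y a) (genPM-↑ˡ j)) (lookup-col j a)

    g-↑ʳ : ∀ j a → g (n ↑ʳ j) a ≡ - column M j a
    g-↑ʳ j a = trans (cong (λ y → lookup y a) (genPM-↑ʳ j))
      (trans (lookup-negv (col M j) a) (cong -_ (lookup-col j a)))

    genPM-cases : ∀ k → ∃[ j ] (genPM M k ≡ col M j ⊎ genPM M k ≡ negv (col M j))
    genPM-cases k with splitAt n k
    ... | inj₁ j = j , inj₁ refl
    ... | inj₂ j = j , inj₂ refl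

    g-cases : ∀ k → ∃[ j ] ((∀ a → g k a ≡ column M j a) ⊎ (∀ a → g k a ≡ - column M j a))
    g-cases k with genPM-cases k
    ... | j , inj₁ e = j , inj₁ λ a → trans (cong (λ y → lookup y a) e) (lookup-col j a)
    ... | j , inj₂ e = j , inj₂ λ a → trans (cong (λ y → lookup y a) e)
      (trans (lookup-negv (col M j) a) (cong -_ (lookup-col j a)))

    ∙-g-cases : ∀ k → ∃[ j ] ((∀ u → u ∙ g k ≡ u ∙ column M j) ⊎ (∀ u → u ∙ g k ≡ - (u ∙ column M j)))
    ∙-g-cases k with g-cases k
    ... | j , inj₁ e = j , inj₁ λ u → ∙-congʳ u e
    ... | j , inj₂ e = j , inj₂ λ u → trans (∙-congʳ u e) (∙-negʳ u (column M j))

    g-int : ∀ k a → IsInt (g k a)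
    g-int k a with g-cases k
    ... | j , inj₁ e = subst IsInt (sym (e a)) (column-int j a)
    ... | j , inj₂ e = subst IsInt (sym (e a)) (int-neg (column-int j a))

    ∙-g-sign : ∀ F → IsBasis M F → ∀ i k → IsSign (dual F i ∙ g k)
    ∙-g-sign F F-basis i k with ∙-g-cases k
    ... | j , inj₁ e = subst IsSign (sym (e (dual F i))) (coordinate-sign F F-basis i j)
    ... | j , inj₂ e = subst IsSign (sym (e (dual F i))) (sign-neg (coordinate-sign F F-basis i j))

    -- Collects what does not depend on the sign of a generator. Exchange arguments put the
    -- underlying column into a basis and need no split between the two signs.
    g-column : ∀ k → ∃[ j ] ((∀ u → u ∙ column M j ≡ 0ℚ → u ∙ g k ≡ 0ℚ) ×
                            (∀ u → IsInt (u ∙ g k) → IsInt (u ∙ column M j)))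
    g-column k with ∙-g-cases k
    ... | j , inj₁ h = j , (λ u e → trans (h u) e) , λ u → subst IsInt (h u)
    ... | j , inj₂ h = j , (λ u e → trans (h u) (cong -_ e)) , λ u z →
      subst IsInt (trans (cong -_ (h u)) (neg-involutive (u ∙ column M j))) (int-neg z)

    gen-opposite : ∀ k → ∃[ l ] genPM M l ≡ negv (genPM M k)
    gen-opposite k with genPM-cases k
    ... | j , inj₁ e = n ↑ʳ j , trans (genPM-↑ʳ j) (cong negv (sym e))
    ... | j , inj₂ e = j ↑ˡ n , trans (genPM-↑ˡ j) (pt-ext λ a → sym (begin
      lookup (negv (genPM M k)) a           ≡⟨ lookup-negv (genPM M k) a ⟩
      - lookup (genPM M k) a                ≡⟨ cong (λ y → - lookup y a) e ⟩
      - lookup (negv (col M j)) a           ≡⟨ cong -_ (lookup-negv (col M j) a) ⟩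
      - - lookup (col M j) a                ≡⟨ neg-involutive _ ⟩
      lookup (col M j) a                    ∎))
      where open ≡-Reasoning

    gen∈PM : ∀ k → PM M (genPM M k)
    gen∈PM = conv-member (genPM M)

    col∈PM : ∀ j → PM M (col M j)
    col∈PM j = subst (PM M) (genPM-↑ˡ j) (gen∈PM (j ↑ˡ n))

    negcol∈PM : ∀ j → PM M (negv (col M j))
    negcol∈PM j = subst (PM M) (genPM-↑ʳ j) (gen∈PM (n ↑ʳ j))

    -- The weights of x are kept; the negated generators are generators again.
    centrallySymmetric : CentrallySymmetric (PM M)
    centrallySymmetric x (w , w≥0 , Σw≡1 , x≡) =
      conv-combination (genPM M) (λ k → negv (genPM M k)) negv∈ w w≥0 Σw≡1 (negv x) λ a → begin
        lookup (negv x) a                           ≡⟨ lookup-negv x a ⟩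
        - lookup x a                                ≡⟨ cong (λ y → - lookup y a) x≡ ⟩
        - lookup (lincomb w (genPM M)) a            ≡⟨ cong -_ (lookup-lincomb w (genPM M) a) ⟩
        - (w ∙ (λ k → g k a))                       ≡⟨ ∙-negʳ w (λ k → g k a) ⟨
        w ∙ (λ k → - g k a)                         ≡⟨ ∙-congʳ w (λ k → lookup-negv (genPM M k) a) ⟨
        w ∙ (λ k → lookup (negv (genPM M k)) a)     ∎
      where
      open ≡-Reasoning
      negv∈ : ∀ k → PM M (negv (genPM M k))
      negv∈ k with gen-opposite k
      ... | l , e = subst (PM M) e (gen∈PM l)

    -- Positive rank provides a basis position and with it a nonzero column. The segment from this
    -- column to its negative puts the origin into the polytope and shows that the origin is not a
    -- vertex.
    i₀ : Fin r
    i₀ = fromℕ< 0<r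

    j₀ : Fin n
    j₀ = proj₁ (F₀-basis i₀)

    col-j₀≢0 : col M j₀ ≢ 0v
    col-j₀≢0 e = contradiction (trans (sym (trans (biorthogonal F₀ i₀ i₀) (δ-refl i₀)))
      (sum-zero λ a → trans (cong (dual F₀ i₀ a *_) (vanish a)) (*-zeroʳ (dual F₀ i₀ a)))) λ ()
      where
      vanish : ∀ a → basis F₀ i₀ a ≡ 0ℚ
      vanish a = trans (proj₂ (F₀-basis i₀) a)
        (trans (sym (lookup-col j₀ a)) (trans (cong (λ y → lookup y a) e) (lookup-0v a)))

    midpoint : ∀ {k} (x : Pt k) → 0v ≡ segPt ½ x (negv x)
    midpoint x = pt-ext λ a → sym (trans (lookup-segPt ½ x (negv x) a)
      (trans (cong (λ y → ½ * lookup x a + ½ * y) (lookup-negv x a))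
        (trans (eq ½ (lookup x a)) (sym (lookup-0v a)))))
      where
      eq : ∀ h x → h * x + h * - x ≡ 0ℚ
      eq = solve-∀ ℚ-ring

    0<½ : 0ℚ < ½
    0<½ = positive⁻¹ ½

    ½<1 : ½ < 1ℚ
    ½<1 = 0<q-p⇒p<q {½} {1ℚ} 0<½

    0∈PM : PM M 0v
    0∈PM = subst (PM M) (sym (midpoint (col M j₀)))
      (conv-segment (genPM M) (col∈PM j₀) (negcol∈PM j₀) ½ (<⇒≤ 0<½) (<⇒≤ ½<1))

    -- The origin and the r basis columns are affinely independent, because the dual vectors read
    -- off the weights of the columns. Larger families are excluded by the dimension of the ambient
    -- space.
    hasDim : HasDim (PM M) r
    hasDim = (p , p∈ , indep) , λ q _ → ¬affIndep q
      where
      c : Fin r → Fin n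
      c i = proj₁ (F₀-basis i)
      p : Fin (suc r) → Pt r
      p zero    = 0v
      p (suc i) = col M (c i)
      p∈ : ∀ j → PM M (p j)
      p∈ zero    = 0∈PM
      p∈ (suc i) = col∈PM (c i)
      indep : AffIndep p
      indep w Σw≡0 wp≡0 = λ { zero → w₀≡0 ; (suc i) → w-suc≡0 i }
        where
        open ≡-Reasoning
        w-suc≡0 : ∀ i → w (suc i) ≡ 0ℚ
        w-suc≡0 i = begin
          w (suc i)
            ≡⟨ sum-*-δ i (w ∘ suc) ⟨
          sumℚ (λ k → w (suc k) * δ k i)
            ≡⟨ sum-cong (λ k → cong (w (suc k) *_) (trans (δ-sym k i) (trans (sym (biorthogonal F₀ i k))
                 (∙-congʳ (dual F₀ i) λ a → trans (proj₂ (F₀-basis k) a) (sym (lookup-col (c k) a)))))) ⟩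
          sumℚ (λ k → w (suc k) * (dual F₀ i ∙ lookup (p (suc k))))
            ≡⟨ +-identityˡ _ ⟨
          0ℚ + sumℚ (λ k → w (suc k) * (dual F₀ i ∙ lookup (p (suc k))))
            ≡⟨ cong (_+ sumℚ (λ k → w (suc k) * (dual F₀ i ∙ lookup (p (suc k))))) (sym w₀-term) ⟩
          sumℚ (λ k → w k * (dual F₀ i ∙ lookup (p k)))
            ≡⟨ conv-functional p (dual F₀ i) w refl ⟨
          dual F₀ i ∙ lookup (lincomb w p)
            ≡⟨ cong (λ y → dual F₀ i ∙ lookup y) wp≡0 ⟩
          dual F₀ i ∙ lookup 0v
            ≡⟨ dual-0v ⟩
          0ℚ
            ∎
          where
          dual-0v : dual F₀ i ∙ lookup 0v ≡ 0ℚ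
          dual-0v = sum-zero λ a → trans (cong (dual F₀ i a *_) (lookup-0v a)) (*-zeroʳ (dual F₀ i a))
          w₀-term : w zero * (dual F₀ i ∙ lookup (p zero)) ≡ 0ℚ
          w₀-term = trans (cong (w zero *_) dual-0v) (*-zeroʳ (w zero))
        w₀≡0 : w zero ≡ 0ℚ
        w₀≡0 = trans (sym (+-identityʳ (w zero))) (trans (cong (w zero +_) (sym (sum-zero w-suc≡0))) Σw≡0)

    -- If all entries of y are at most ε in absolute value, its i-th coordinate is at most K i * ε.
    -- With ε = 1 / (1 + Σ K), where the summand 1 keeps the denominator positive, the absolute
    -- coordinates add up to at most 1. They are the weights of the signed basis columns, and the
    -- remaining weight goes to the origin.
    originInterior : OriginInterior (PM M)
    originInterior = ε , ε>0 , inside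
      where
      K : Fin r → ℚ
      K i = sumℚ (λ b → ∣ dual F₀ i b ∣)
      K≥0 : 0ℚ ≤ sumℚ K
      K≥0 = sum-nonneg λ i → sum-nonneg λ b → 0≤∣p∣ (dual F₀ i b)
      1+K>0 : 0ℚ < 1ℚ + sumℚ K
      1+K>0 = 0<p⇒0≤q⇒0<p+q (positive⁻¹ 1ℚ) K≥0
      ε : ℚ
      ε = proj₁ (positive-reciprocal 1+K>0)
      ε>0 : 0ℚ < ε
      ε>0 = proj₁ (proj₂ (positive-reciprocal 1+K>0))
      Kε≤1 : sumℚ K * ε ≤ 1ℚ
      Kε≤1 = begin
        sumℚ K * ε         ≡⟨ +-identityˡ _ ⟨
        0ℚ + sumℚ K * ε    ≤⟨ +-monoˡ-≤ (sumℚ K * ε) (<⇒≤ ε>0) ⟩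
        ε + sumℚ K * ε     ≡⟨ eq (sumℚ K) ε ⟩
        (1ℚ + sumℚ K) * ε  ≡⟨ proj₂ (proj₂ (positive-reciprocal 1+K>0)) ⟩
        1ℚ                 ∎
        where
        open ≤-Reasoning
        eq : ∀ k e → e + k * e ≡ (1ℚ + k) * e
        eq = solve-∀ ℚ-ring
      inside : ∀ y → (∀ i → ∣ lookup y i ∣ ≤ ε) → PM M y
      inside y y≤ε = conv-combination (genPM M) q q∈ w w≥0 Σw≡1 y y≡
        where
        c : Fin r → ℚ
        c i = dual F₀ i ∙ lookup y
        ∣c∣≤ : ∀ i → ∣ c i ∣ ≤ K i * ε
        ∣c∣≤ i = begin
          ∣ c i ∣
            ≤⟨ ∣sum∣≤sum∣∣ (λ b → dual F₀ i b * lookup y b) ⟩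
          sumℚ (λ b → ∣ dual F₀ i b * lookup y b ∣)
            ≡⟨ sum-cong (λ b → ∣p*q∣≡∣p∣*∣q∣ (dual F₀ i b) (lookup y b)) ⟩
          sumℚ (λ b → ∣ dual F₀ i b ∣ * ∣ lookup y b ∣)
            ≤⟨ sum-mono (λ b → *-monoˡ-≤-nonNeg ∣ dual F₀ i b ∣ {{∣-∣-nonNeg (dual F₀ i b)}} (y≤ε b)) ⟩
          sumℚ (λ b → ∣ dual F₀ i b ∣ * ε)
            ≡⟨ sum-*ʳ ε (λ b → ∣ dual F₀ i b ∣) ⟩
          K i * ε
            ∎
          where open ≤-Reasoning
        Σ∣c∣≤1 : sumℚ (λ i → ∣ c i ∣) ≤ 1ℚ
        Σ∣c∣≤1 = ≤-trans (sum-mono ∣c∣≤) (≤-trans (≤-reflexive (sum-*ʳ ε K)) Kε≤1)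
        signed : ∀ i → Σ (Pt r) λ x → PM M x × (∀ a → ∣ c i ∣ * lookup x a ≡ c i * basis F₀ i a)
        signed i with F₀-basis i | ∣p∣≡p∨∣p∣≡-p (c i)
        ... | j , e | inj₁ ∣c∣≡c = col M j , col∈PM j , λ a →
          cong₂ _*_ ∣c∣≡c (trans (lookup-col j a) (sym (e a)))
        ... | j , e | inj₂ ∣c∣≡-c = negv (col M j) , negcol∈PM j , λ a →
          trans (cong₂ _*_ ∣c∣≡-c (trans (lookup-negv (col M j) a)
                  (cong -_ (trans (lookup-col j a) (sym (e a))))))
            (eq (c i) (basis F₀ i a))
          where
          eq : ∀ x y → - x * - y ≡ x * y
          eq = solve-∀ ℚ-ring
        q : Fin (suc r) → Pt r
        q zero    = 0v
        q (suc i) = proj₁ (signed i)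
        q∈ : ∀ i → PM M (q i)
        q∈ zero    = 0∈PM
        q∈ (suc i) = proj₁ (proj₂ (signed i))
        w : Fin (suc r) → ℚ
        w zero    = 1ℚ - sumℚ (λ i → ∣ c i ∣)
        w (suc i) = ∣ c i ∣
        w≥0 : ∀ i → 0ℚ ≤ w i
        w≥0 zero    = p≤q⇒0≤q-p Σ∣c∣≤1
        w≥0 (suc i) = 0≤∣p∣ (c i)
        Σw≡1 : sumℚ w ≡ 1ℚ
        Σw≡1 = eq (sumℚ (λ i → ∣ c i ∣))
          where
          eq : ∀ s → 1ℚ - s + s ≡ 1ℚ
          eq = solve-∀ ℚ-ring
        y≡ : ∀ a → lookup y a ≡ sumℚ (λ i → w i * lookup (q i) a)
        y≡ a = sym (trans
          (cong₂ _+_ (trans (cong (w zero *_) (lookup-0v a)) (*-zeroʳ (w zero)))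
            (trans (sum-cong λ i → proj₂ (proj₂ (signed i)) a) (sym (expand F₀ (lookup y) a))))
          (+-identityˡ (lookup y a)))

    -- Lattice points and vertices

    -- An integral coordinate of a point of the polytope is 0 or ±1, and the value ±1 is extremal
    -- among the coordinates of the generators.
    coordinate-rigid : ∀ F → IsBasis M F → ∀ {x} → (∀ a → IsInt (lookup x a)) →
      ∀ {w} → (∀ k → 0ℚ ≤ w k) → sumℚ w ≡ 1ℚ → x ≡ lincomb w (genPM M) →
      ∀ i → dual F i ∙ lookup x ≢ 0ℚ → ∀ k → 0ℚ < w k → dual F i ∙ g k ≡ dual F i ∙ lookup x
    coordinate-rigid F F-basis {x} x-int {w} w≥0 Σw≡1 x≡ i Xi≢0 = extremal X-sign
      where
      f : Fin (n ℕ.+ n) → ℚ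
      f k = dual F i ∙ g k
      X : ℚ
      X = dual F i ∙ lookup x
      X≡ : X ≡ sumℚ (λ k → w k * f k)
      X≡ = conv-functional (genPM M) (dual F i) w x≡
      -X≡ : - X ≡ sumℚ (λ k → w k * - f k)
      -X≡ = trans (cong -_ X≡) (sym (∙-negʳ w f))
      f≤1 : ∀ k → f k ≤ 1ℚ
      f≤1 k = sign-≤1 (∙-g-sign F F-basis i k)
      -f≤1 : ∀ k → - f k ≤ 1ℚ
      -f≤1 k = sign-≤1 (sign-neg (∙-g-sign F F-basis i k))
      X-sign : IsSign X
      X-sign = int-sign (coordinate-int F F-basis i x-int)
        (subst (_≤ 1ℚ) (sym X≡) (convex-≤ w≥0 Σw≡1 f≤1))
        (subst (_≤ 1ℚ) (sym -X≡) (convex-≤ w≥0 Σw≡1 -f≤1))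
      extremal : IsSign X → ∀ k → 0ℚ < w k → f k ≡ X
      extremal (inj₁ X≡0) k wk>0 = contradiction X≡0 Xi≢0
      extremal (inj₂ (inj₁ X≡1)) k wk>0 =
        trans (convex-tight w≥0 Σw≡1 f≤1 (trans (sym X≡) X≡1) k wk>0) (sym X≡1)
      extremal (inj₂ (inj₂ X≡-1)) k wk>0 = neg-injective
        (trans (convex-tight w≥0 Σw≡1 -f≤1 (trans (sym -X≡) (cong -_ X≡-1)) k wk>0)
          (sym (cong -_ X≡-1)))

    -- In a basis containing ±g k, a coordinate of x other than that of g k would by rigidity
    -- also be a nonzero coordinate of g k.
    lattice-point-support : ∀ {x} → (∀ a → IsInt (lookup x a)) → x ≢ 0v →
      ∀ {w} → (∀ k → 0ℚ ≤ w k) → sumℚ w ≡ 1ℚ → x ≡ lincomb w (genPM M) →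
      ∀ k → 0ℚ < w k → genPM M k ≡ x
    lattice-point-support {x} x-int x≢0 {w} w≥0 Σw≡1 x≡ k wk>0
      with nonzero-coordinate F₀ (≢0v⇒nonzero x≢0) | g-column k
    ... | i , Xi≢0 | j , g≡0 , _ = pt-ext (dual-separates F same)
      where
      rigid : ∀ F → IsBasis M F → ∀ i → dual F i ∙ lookup x ≢ 0ℚ → dual F i ∙ g k ≡ dual F i ∙ lookup x
      rigid F F-basis i h = coordinate-rigid F F-basis x-int w≥0 Σw≡1 x≡ i h k wk>0
      pivot≢0 : dual F₀ i ∙ column M j ≢ 0ℚ
      pivot≢0 e = Xi≢0 (trans (sym (rigid F₀ F₀-basis i Xi≢0)) (g≡0 (dual F₀ i) e))
      F : Frame r
      F = pivoted F₀ i (column M j) pivot≢0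
      F-basis : IsBasis M F
      F-basis = pivoted-isBasis M F₀-basis i j pivot≢0
      off : ∀ l → l ≢ i → dual F l ∙ g k ≡ 0ℚ
      off l l≢i = g≡0 (dual F l) (trans
        (sym (∙-congʳ (dual F l) (pivoted-at F₀ i (column M j) pivot≢0)))
        (trans (biorthogonal F l i) (δ-≢ l≢i)))
      -- Some coordinate of x in F is nonzero; rigidity together with `off` leaves only the i-th.
      at : dual F i ∙ lookup x ≢ 0ℚ
      at e = let (m , Xm≢0) = nonzero-coordinate F (≢0v⇒nonzero x≢0) in
        Xm≢0 (case m Fin.≟ i of λ
          { (yes m≡i) → trans (cong (λ h → dual F h ∙ lookup x) m≡i) e
          ; (no m≢i)  → trans (sym (rigid F F-basis m Xm≢0)) (off m m≢i) })
      same : ∀ l → dual F l ∙ g k ≡ dual F l ∙ lookup x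
      same l = case l Fin.≟ i of λ
        { (yes l≡i) → subst (λ h → dual F h ∙ g k ≡ dual F h ∙ lookup x) (sym l≡i) (rigid F F-basis i at)
        ; (no l≢i)  → trans (off l l≢i) (sym (decidable-stable (dual F l ∙ lookup x ≟ 0ℚ) λ ne →
            ne (trans (sym (rigid F F-basis l ne)) (off l l≢i)))) }

    -- Merging the weights of y and z gives weights for x. A generator used by y or by z has
    -- positive weight there, hence equals x, so y and z are both combinations of x alone.
    lattice-point-vertex : ∀ {x} → (∀ a → IsInt (lookup x a)) → x ≢ 0v → PM M x → IsVertex (PM M) x
    lattice-point-vertex {x} x-int x≢0 x∈ = x∈ , extreme
      where
      collapse : ∀ {y w} → sumℚ w ≡ 1ℚ → y ≡ lincomb w (genPM M) →
        (∀ k → w k ≢ 0ℚ → genPM M k ≡ x) → y ≡ x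
      collapse {y} {w} Σw≡1 y≡ support = pt-ext λ a → begin
        lookup y a                      ≡⟨ cong (λ z → lookup z a) y≡ ⟩
        lookup (lincomb w (genPM M)) a  ≡⟨ lookup-lincomb w (genPM M) a ⟩
        sumℚ (λ k → w k * g k a)        ≡⟨ sum-cong (λ k → term a k) ⟩
        sumℚ (λ k → w k * lookup x a)   ≡⟨ sum-*ʳ (lookup x a) w ⟩
        sumℚ w * lookup x a             ≡⟨ cong (_* lookup x a) Σw≡1 ⟩
        1ℚ * lookup x a                 ≡⟨ *-identityˡ (lookup x a) ⟩
        lookup x a                      ∎
        where
        open ≡-Reasoning
        term : ∀ a k → w k * g k a ≡ w k * lookup x a
        term a k with w k ≟ 0ℚ
        ... | yes e = trans (cong (_* g k a) e) (trans (*-zeroˡ (g k a))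
          (sym (trans (cong (_* lookup x a) e) (*-zeroˡ (lookup x a)))))
        ... | no ne = cong (λ z → w k * lookup z a) (support k ne)
      extreme : ∀ y z t → PM M y → PM M z → 0ℚ < t → t < 1ℚ → x ≡ segPt t y z → y ≡ z
      extreme y z t (u , u≥0 , Σu≡1 , y≡) (v , v≥0 , Σv≡1 , z≡) 0<t t<1 x≡ =
        trans (collapse Σu≡1 y≡ λ k uk≢0 → support k
                 (0<p⇒0≤q⇒0<p+q (0<p⇒0<q⇒0<p*q 0<t (0≤p⇒p≢0⇒0<p (u≥0 k) uk≢0))
                                (0≤p⇒0≤q⇒0≤p*q (<⇒≤ 0<1-t) (v≥0 k))))
          (sym (collapse Σv≡1 z≡ λ k vk≢0 → support k
                 (subst (0ℚ <_) (+-comm ((1ℚ - t) * v k) (t * u k))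
                   (0<p⇒0≤q⇒0<p+q (0<p⇒0<q⇒0<p*q 0<1-t (0≤p⇒p≢0⇒0<p (v≥0 k) vk≢0))
                                  (0≤p⇒0≤q⇒0≤p*q (<⇒≤ 0<t) (u≥0 k))))))
        where
        open ≡-Reasoning
        0<1-t : 0ℚ < 1ℚ - t
        0<1-t = subst (_< 1ℚ - t) (+-inverseʳ t) (+-monoˡ-< (- t) t<1)
        w : Fin (n ℕ.+ n) → ℚ
        w k = t * u k + (1ℚ - t) * v k
        Σw≡1 : sumℚ w ≡ 1ℚ
        Σw≡1 = begin
          sumℚ w                             ≡⟨ sum-linear t (1ℚ - t) u v ⟩
          t * sumℚ u + (1ℚ - t) * sumℚ v     ≡⟨ cong₂ (λ a b → t * a + (1ℚ - t) * b) Σu≡1 Σv≡1 ⟩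
          t * 1ℚ + (1ℚ - t) * 1ℚ             ≡⟨ eq t ⟩
          1ℚ                                 ∎
          where
          eq : ∀ t → t * 1ℚ + (1ℚ - t) * 1ℚ ≡ 1ℚ
          eq = solve-∀ ℚ-ring
        x≡w : x ≡ lincomb w (genPM M)
        x≡w = pt-ext λ a → begin
          lookup x a
            ≡⟨ cong (λ p → lookup p a) x≡ ⟩
          lookup (segPt t y z) a
            ≡⟨ lookup-segPt t y z a ⟩
          t * lookup y a + (1ℚ - t) * lookup z a
            ≡⟨ cong₂ (λ p q → t * lookup p a + (1ℚ - t) * lookup q a) y≡ z≡ ⟩
          t * lookup (lincomb u (genPM M)) a + (1ℚ - t) * lookup (lincomb v (genPM M)) a
            ≡⟨ cong₂ (λ p q → t * p + (1ℚ - t) * q) (lookup-lincomb u (genPM M) a) (lookup-lincomb v (genPM M) a) ⟩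
          t * (u ∙ (λ k → g k a)) + (1ℚ - t) * (v ∙ (λ k → g k a))
            ≡⟨ ∙-linearˡ t (1ℚ - t) u v (λ k → g k a) ⟨
          w ∙ (λ k → g k a)
            ≡⟨ lookup-lincomb w (genPM M) a ⟨
          lookup (lincomb w (genPM M)) a
            ∎
        support : ∀ k → 0ℚ < w k → genPM M k ≡ x
        support = lattice-point-support x-int x≢0 w≥0 Σw≡1 x≡w
          where
          w≥0 : ∀ k → 0ℚ ≤ w k
          w≥0 k = 0≤p⇒0≤q⇒0≤p+q (0≤p⇒0≤q⇒0≤p*q (<⇒≤ 0<t) (u≥0 k))
                                (0≤p⇒0≤q⇒0≤p*q (<⇒≤ 0<1-t) (v≥0 k))

    terminal : Terminal (PM M)
    terminal z z∈ with ≡-dec _≟_ (ofℤ z) 0v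
    ... | yes z≡0 = inj₂ z≡0
    ... | no z≢0  = inj₁ (lattice-point-vertex (λ a → lookup z a , sym (lookup-map a toℚ z)) z≢0 z∈)

    0-not-vertex : ¬ IsVertex (PM M) 0v
    0-not-vertex (_ , extreme) = col-j₀≢0 (pt-ext λ a → trans
      (p≡-p⇒p≡0 (trans (cong (λ y → lookup y a) col≡-col) (lookup-negv (col M j₀) a)))
      (sym (lookup-0v a)))
      where
      col≡-col : col M j₀ ≡ negv (col M j₀)
      col≡-col = extreme (col M j₀) (negv (col M j₀)) ½ (col∈PM j₀) (negcol∈PM j₀) 0<½ ½<1
        (midpoint (col M j₀))

    -- If g k has weight w > 0 in x, then x + w (x − g k) still lies in the polytope, and x is
    -- interior to the segment from g k to it.
    vertex-generator : ∀ {x} → IsVertex (PM M) x → ∃[ k ] genPM M k ≡ x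
    vertex-generator {x} ((u , u≥0 , Σu≡1 , x≡) , extreme)
      with sum-nonzero-term u (λ e → contradiction (trans (sym Σu≡1) e) λ ())
    ... | k , uk≢0 = k , sym (trans x≡seg (trans (cong (segPt t (genPM M k)) (sym g≡y)) (seg-const t (genPM M k))))
      where
      open ≡-Reasoning
      ω : ℚ
      ω = u k
      ω>0 : 0ℚ < ω
      ω>0 = 0≤p⇒p≢0⇒0<p (u≥0 k) uk≢0
      1+ω>0 : 0ℚ < 1ℚ + ω
      1+ω>0 = 0<p⇒0≤q⇒0<p+q (positive⁻¹ 1ℚ) (u≥0 k)
      s : ℚ
      s = proj₁ (positive-reciprocal 1+ω>0)
      s>0 : 0ℚ < s
      s>0 = proj₁ (proj₂ (positive-reciprocal 1+ω>0))
      [1+ω]s≡1 : (1ℚ + ω) * s ≡ 1ℚ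
      [1+ω]s≡1 = proj₂ (proj₂ (positive-reciprocal 1+ω>0))
      t : ℚ
      t = ω * s
      1-t≡s : 1ℚ - t ≡ s
      1-t≡s = trans (cong (_- t) (sym [1+ω]s≡1)) (eq ω s)
        where
        eq : ∀ w s → (1ℚ + w) * s - w * s ≡ s
        eq = solve-∀ ℚ-ring
      t<1 : t < 1ℚ
      t<1 = 0<q-p⇒p<q (subst (0ℚ <_) (sym 1-t≡s) s>0)
      -- At k the new weight is (1 + ω) * ω - ω = ω * ω, so a step of length ω keeps all weights
      -- nonnegative.
      w : Fin (n ℕ.+ n) → ℚ
      w l = (1ℚ + ω) * u l + - ω * δ k l
      w≥0 : ∀ l → 0ℚ ≤ w l
      w≥0 l with k Fin.≟ l
      ... | yes refl = subst (0ℚ ≤_)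
        (trans (eq ω) (cong (λ d → (1ℚ + ω) * ω + - ω * d) (sym (δ-refl k))))
        (0≤p⇒0≤q⇒0≤p*q (u≥0 k) (u≥0 k))
        where
        eq : ∀ w → w * w ≡ (1ℚ + w) * w + - w * 1ℚ
        eq = solve-∀ ℚ-ring
      ... | no k≢l = subst (0ℚ ≤_)
        (trans (eq ω (u l)) (cong (λ d → (1ℚ + ω) * u l + - ω * d) (sym (δ-≢ k≢l))))
        (0≤p⇒0≤q⇒0≤p*q (<⇒≤ 1+ω>0) (u≥0 l))
        where
        eq : ∀ w x → (1ℚ + w) * x ≡ (1ℚ + w) * x + - w * 0ℚ
        eq = solve-∀ ℚ-ring
      Σw≡1 : sumℚ w ≡ 1ℚ
      Σw≡1 = begin
        sumℚ w                                    ≡⟨ sum-linear (1ℚ + ω) (- ω) u (δ k) ⟩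
        (1ℚ + ω) * sumℚ u + - ω * sumℚ (δ k)      ≡⟨ cong₂ (λ a b → (1ℚ + ω) * a + - ω * b) Σu≡1 (sum-δ k) ⟩
        (1ℚ + ω) * 1ℚ + - ω * 1ℚ                  ≡⟨ eq ω ⟩
        1ℚ                                        ∎
        where
        eq : ∀ w → (1ℚ + w) * 1ℚ + - w * 1ℚ ≡ 1ℚ
        eq = solve-∀ ℚ-ring
      y : Pt r
      y = lincomb w (genPM M)
      lookup-y : ∀ a → lookup y a ≡ (1ℚ + ω) * lookup x a + - ω * g k a
      lookup-y a = begin
        lookup y a
          ≡⟨ lookup-lincomb w (genPM M) a ⟩
        w ∙ (λ l → g l a)
          ≡⟨ ∙-linearˡ (1ℚ + ω) (- ω) u (δ k) (λ l → g l a) ⟩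
        (1ℚ + ω) * (u ∙ (λ l → g l a)) + - ω * (δ k ∙ (λ l → g l a))
          ≡⟨ cong₂ (λ p q → (1ℚ + ω) * p + - ω * q)
               (trans (sym (lookup-lincomb u (genPM M) a)) (cong (λ p → lookup p a) (sym x≡)))
               (sum-δ-* k (λ l → g l a)) ⟩
        (1ℚ + ω) * lookup x a + - ω * g k a
          ∎
      x≡seg : x ≡ segPt t (genPM M k) y
      x≡seg = pt-ext λ a → sym (begin
        lookup (segPt t (genPM M k) y) a
          ≡⟨ lookup-segPt t (genPM M k) y a ⟩
        t * g k a + (1ℚ - t) * lookup y a
          ≡⟨ cong₂ (λ p q → t * g k a + p * q) 1-t≡s (lookup-y a) ⟩
        ω * s * g k a + s * ((1ℚ + ω) * lookup x a + - ω * g k a)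
          ≡⟨ eq ω s (g k a) (lookup x a) ⟩
        (1ℚ + ω) * s * lookup x a
          ≡⟨ cong (_* lookup x a) [1+ω]s≡1 ⟩
        1ℚ * lookup x a
          ≡⟨ *-identityˡ (lookup x a) ⟩
        lookup x a
          ∎)
        where
        eq : ∀ w s g x → w * s * g + s * ((1ℚ + w) * x + - w * g) ≡ (1ℚ + w) * s * x
        eq = solve-∀ ℚ-ring
      g≡y : genPM M k ≡ y
      g≡y = extreme (genPM M k) y t (gen∈PM k) (w , w≥0 , Σw≡1 , refl)
        (0<p⇒0<q⇒0<p*q ω>0 s>0) t<1 x≡seg
      seg-const : ∀ t (z : Pt r) → segPt t z z ≡ z
      seg-const t z = pt-ext λ a → trans (lookup-segPt t z z a) (eq t (lookup z a))
        where
        eq : ∀ t z → t * z + (1ℚ - t) * z ≡ z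
        eq = solve-∀ ℚ-ring

    vertex⇔ : ∀ x → IsVertex (PM M) x ⇔ (x ≢ 0v × ∃[ k ] genPM M k ≡ x)
    vertex⇔ x = mk⇔
      (λ v → (λ { refl → 0-not-vertex v }) , vertex-generator v)
      (λ { (x≢0 , k , refl) → lattice-point-vertex (g-int k) x≢0 (gen∈PM k) })

  -- The polar is the hull of finitely many lattice points.

  module PolarDual {r n} (M : Mat r n) (fullRank : FullRank M) (unimodular : WeaklyUnimodular M)
                   (0<r : 0 ℕ.< r) where

    open Unimodular M unimodular
    open Polytope M fullRank unimodular 0<r

    -- By convexity the inequalities at the generators suffice. They are finitely many, which makes
    -- membership decidable.
    InPolar : (Fin r → ℚ) → Set
    InPolar u = ∀ k → u ∙ g k ≤ 1ℚ

    inPolar? : ∀ u → Dec (InPolar u)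
    inPolar? u = all? λ k → u ∙ g k ≤? 1ℚ

    polar⇔ : ∀ u → Polar (PM M) u ⇔ InPolar (lookup u)
    polar⇔ u = mk⇔ (λ h k → h (genPM M k) (gen∈PM k))
                   (λ h x → conv-functional-≤ (genPM M) (lookup u) h)

    inPolar-cong : ∀ {u w} → (∀ a → u a ≡ w a) → InPolar u → InPolar w
    inPolar-cong h u∈ k = subst (_≤ 1ℚ) (∙-congˡ (g k) h) (u∈ k)

    inPolar-column : ∀ {u} → InPolar u → ∀ j → u ∙ column M j ≤ 1ℚ × - (u ∙ column M j) ≤ 1ℚ
    inPolar-column {u} u∈ j =
      subst (_≤ 1ℚ) (∙-congʳ u (g-↑ˡ j)) (u∈ (j ↑ˡ n)) ,
      subst (_≤ 1ℚ) (trans (∙-congʳ u (g-↑ʳ j)) (∙-negʳ u (column M j))) (u∈ (n ↑ʳ j))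

    -- The lattice points of the polar have coordinates 0, ±1 with respect to F₀; the remaining
    -- coordinate vectors are sent to the origin.

    digit : Fin 3 → ℚ
    digit zero             = 0ℚ
    digit (suc zero)       = 1ℚ
    digit (suc (suc zero)) = - 1ℚ

    digit-sign : ∀ d → IsSign (digit d)
    digit-sign zero             = inj₁ refl
    digit-sign (suc zero)       = inj₂ (inj₁ refl)
    digit-sign (suc (suc zero)) = inj₂ (inj₂ refl)

    sign-digit : ∀ {x} → IsSign x → ∃[ d ] digit d ≡ x
    sign-digit (inj₁ refl)        = zero , refl
    sign-digit (inj₂ (inj₁ refl)) = suc zero , refl
    sign-digit (inj₂ (inj₂ refl)) = suc (suc zero) , refl

    candidate : (Fin r → Fin 3) → Fin r → ℚ
    candidate f a = sumℚ (λ i → digit (f i) * dual F₀ i a)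

    candidate-int : ∀ f a → IsInt (candidate f a)
    candidate-int f a = sum-int λ i → int-* (sign⇒int (digit-sign (f i))) (dual-int F₀ F₀-basis i a)

    candidateℤ : (Fin r → Fin 3) → Vec ℤ r
    candidateℤ f = tabulate λ a → proj₁ (candidate-int f a)

    lookup-candidateℤ : ∀ f a → lookup (ofℤ (candidateℤ f)) a ≡ candidate f a
    lookup-candidateℤ f a = trans (lookup-map a toℚ (candidateℤ f))
      (trans (cong toℚ (lookup∘tabulate (λ a → proj₁ (candidate-int f a)) a)) (proj₂ (candidate-int f a)))

    0ℤv : Vec ℤ r
    0ℤv = tabulate λ _ → ℤ.+ 0

    lookup-0ℤv : ∀ a → lookup (ofℤ 0ℤv) a ≡ 0ℚ
    lookup-0ℤv a = trans (lookup-map a toℚ 0ℤv) (cong toℚ (lookup∘tabulate (λ _ → ℤ.+ 0) a))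

    polarPoint : Fin (3 ℕ.^ r) → Vec ℤ r
    polarPoint k with inPolar? (candidate (finToFun k))
    ... | yes _ = candidateℤ (finToFun k)
    ... | no _  = 0ℤv

    polarPoint-inPolar : ∀ k → InPolar (lookup (ofℤ (polarPoint k)))
    polarPoint-inPolar k with inPolar? (candidate (finToFun k))
    ... | yes u∈ = inPolar-cong (λ a → sym (lookup-candidateℤ (finToFun k) a)) u∈
    ... | no _ = λ l → subst (_≤ 1ℚ)
      (sym (sum-zero λ a → trans (cong (_* g l a) (lookup-0ℤv a)) (*-zeroˡ (g l a))))
      (nonNegative⁻¹ 1ℚ)

    -- On a basis column u takes an integral value between -1 and 1. These signs determine u through
    -- `expand-dual`, so u is one of the candidates.
    polarPoint-complete : ∀ u → (∀ a → IsInt (u a)) → InPolar u →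
      ∃[ k ] (∀ a → lookup (ofℤ (polarPoint k)) a ≡ u a)
    polarPoint-complete u u-int u∈ = k , point≡
      where
      coordinate-sign′ : ∀ i → IsSign (u ∙ basis F₀ i)
      coordinate-sign′ i with F₀-basis i
      ... | j , e = subst IsSign (sym (∙-congʳ u e))
        (int-sign (sum-int λ a → int-* (u-int a) (column-int j a))
          (proj₁ (inPolar-column {u} u∈ j)) (proj₂ (inPolar-column {u} u∈ j)))
      f : Fin r → Fin 3
      f i = proj₁ (sign-digit (coordinate-sign′ i))
      k : Fin (3 ℕ.^ r)
      k = funToFin f
      candidate≡u : ∀ a → candidate (finToFun k) a ≡ u a
      candidate≡u a = trans
        (sum-cong λ i → cong (_* dual F₀ i a)
          (trans (cong digit (finToFun-funToFin f i)) (proj₂ (sign-digit (coordinate-sign′ i)))))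
        (sym (expand-dual F₀ u a))
      point≡ : ∀ a → lookup (ofℤ (polarPoint k)) a ≡ u a
      point≡ a with inPolar? (candidate (finToFun k))
      ... | yes _ = trans (lookup-candidateℤ (finToFun k) a) (candidate≡u a)
      ... | no ∉  = contradiction (inPolar-cong {u} (sym ∘ candidate≡u) u∈) ∉

    polarPt : Fin (3 ℕ.^ r) → Pt r
    polarPt k = ofℤ (polarPoint k)

    Hull : (Fin r → ℚ) → Set
    Hull u = InConv polarPt (tabulate u)

    hull-cong : ∀ {u w} → (∀ a → u a ≡ w a) → Hull u → Hull w
    hull-cong h = subst (InConv polarPt) (tabulate-cong h)

    hull-lattice : ∀ u → (∀ a → IsInt (u a)) → InPolar u → Hull u
    hull-lattice u u-int u∈ = let (k , e) = polarPoint-complete u u-int u∈ in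
      subst (InConv polarPt) (pt-ext λ a → trans (e a) (sym (lookup∘tabulate u a))) (conv-member polarPt k)

    infixl 6 _+[_]_
    _+[_]_ : (Fin r → ℚ) → ℚ → (Fin r → ℚ) → Fin r → ℚ
    (u +[ s ] e) a = 1ℚ * u a + s * e a

    +[]-∙ : ∀ u s e x → (u +[ s ] e) ∙ x ≡ u ∙ x + s * (e ∙ x)
    +[]-∙ u s e x = trans (∙-linearˡ 1ℚ s u e x) (cong (_+ s * (e ∙ x)) (*-identityˡ (u ∙ x)))

    -- The weights t / (s + t) and s / (s + t) cancel the two displacements. The case s = 0 is
    -- treated apart: there u is an endpoint, and s + t could be zero.
    hull-between : ∀ u e {s t} → 0ℚ ≤ s → 0ℚ ≤ t → Hull (u +[ s ] e) → Hull (u +[ t ] (λ a → - e a)) →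
      Hull u
    hull-between u e {s} {t} 0≤s 0≤t u₊∈ u₋∈ with s ≟ 0ℚ
    ... | yes refl = hull-cong (λ a → eq (u a) (e a)) u₊∈
      where
      eq : ∀ x y → 1ℚ * x + 0ℚ * y ≡ x
      eq = solve-∀ ℚ-ring
    ... | no s≢0 = subst (InConv polarPt) (pt-ext point≡)
      (conv-segment polarPt u₊∈ u₋∈ τ (0≤p⇒0≤q⇒0≤p*q 0≤t (<⇒≤ q>0)) τ≤1)
      where
      open ≡-Reasoning
      s+t>0 : 0ℚ < s + t
      s+t>0 = 0<p⇒0≤q⇒0<p+q (0≤p⇒p≢0⇒0<p 0≤s s≢0) 0≤t
      q : ℚ
      q = proj₁ (positive-reciprocal s+t>0)
      q>0 : 0ℚ < q
      q>0 = proj₁ (proj₂ (positive-reciprocal s+t>0))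
      [s+t]q≡1 : (s + t) * q ≡ 1ℚ
      [s+t]q≡1 = proj₂ (proj₂ (positive-reciprocal s+t>0))
      τ : ℚ
      τ = t * q
      1-τ≡sq : 1ℚ - τ ≡ s * q
      1-τ≡sq = trans (cong (_- τ) (sym [s+t]q≡1)) (eq s t q)
        where
        eq : ∀ s t q → (s + t) * q - t * q ≡ s * q
        eq = solve-∀ ℚ-ring
      τ≤1 : τ ≤ 1ℚ
      τ≤1 = 0≤q-p⇒p≤q (subst (0ℚ ≤_) (sym 1-τ≡sq) (0≤p⇒0≤q⇒0≤p*q 0≤s (<⇒≤ q>0)))
      point≡ : ∀ a → lookup (segPt τ (tabulate (u +[ s ] e)) (tabulate (u +[ t ] (λ a → - e a)))) a ≡
                     lookup (tabulate u) a
      point≡ a = begin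
        lookup (segPt τ (tabulate (u +[ s ] e)) (tabulate (u +[ t ] (λ a → - e a)))) a
          ≡⟨ lookup-segPt τ (tabulate (u +[ s ] e)) (tabulate (u +[ t ] (λ a → - e a))) a ⟩
        τ * lookup (tabulate (u +[ s ] e)) a + (1ℚ - τ) * lookup (tabulate (u +[ t ] (λ a → - e a))) a
          ≡⟨ cong₂ (λ x y → τ * x + (1ℚ - τ) * y)
               (lookup∘tabulate (u +[ s ] e) a) (lookup∘tabulate (u +[ t ] (λ a → - e a)) a) ⟩
        τ * (1ℚ * u a + s * e a) + (1ℚ - τ) * (1ℚ * u a + t * - e a)
          ≡⟨ cong (λ x → τ * (1ℚ * u a + s * e a) + x * (1ℚ * u a + t * - e a)) 1-τ≡sq ⟩
        t * q * (1ℚ * u a + s * e a) + s * q * (1ℚ * u a + t * - e a)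
          ≡⟨ eq s t q (u a) (e a) ⟩
        (s + t) * q * u a
          ≡⟨ cong (_* u a) [s+t]q≡1 ⟩
        1ℚ * u a
          ≡⟨ *-identityˡ (u a) ⟩
        u a
          ≡⟨ lookup∘tabulate u a ⟨
        lookup (tabulate u) a
          ∎
        where
        eq : ∀ s t q u e → t * q * (1ℚ * u + s * e) + s * q * (1ℚ * u + t * - e) ≡ (s + t) * q * u
        eq = solve-∀ ℚ-ring

    -- Since e is 0 or ±1 on every generator, the only inequalities that tighten along e are those
    -- with e ∙ g k = 1, all at the same speed. The least slack among them is therefore the largest
    -- admissible step.
    slide : ∀ u → InPolar u → ∀ e → (∀ k → IsSign (e ∙ g k)) → (∃[ k ] e ∙ g k ≡ 1ℚ) →
      Σ ℚ λ s → 0ℚ ≤ s × InPolar (u +[ s ] e) ×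
        ∃[ k ] (e ∙ g k ≡ 1ℚ × (u +[ s ] e) ∙ g k ≡ 1ℚ)
    slide u u∈ e e-sign ex with argmin (λ k → e ∙ g k ≟ 1ℚ) (λ k → 1ℚ - u ∙ g k) ex
    ... | k , ek≡1 , min = s , s≥0 , stays , k , ek≡1 , tight
      where
      s : ℚ
      s = 1ℚ - u ∙ g k
      s≥0 : 0ℚ ≤ s
      s≥0 = p≤q⇒0≤q-p (u∈ k)
      tight : (u +[ s ] e) ∙ g k ≡ 1ℚ
      tight = trans (+[]-∙ u s e (g k)) (trans (cong (λ x → u ∙ g k + s * x) ek≡1) (eq (u ∙ g k)))
        where
        eq : ∀ x → x + (1ℚ - x) * 1ℚ ≡ 1ℚ
        eq = solve-∀ ℚ-ring
      bound : ∀ {x} l → IsSign x → x ≡ e ∙ g l → u ∙ g l + s * x ≤ 1ℚ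
      bound l (inj₁ refl) _ = subst (_≤ 1ℚ) (eq (u ∙ g l) s) (u∈ l)
        where
        eq : ∀ x s → x ≡ x + s * 0ℚ
        eq = solve-∀ ℚ-ring
      bound l (inj₂ (inj₁ refl)) el≡1 = begin
        u ∙ g l + s * 1ℚ            ≡⟨ cong (u ∙ g l +_) (*-identityʳ s) ⟩
        u ∙ g l + s                 ≤⟨ +-monoʳ-≤ (u ∙ g l) (min l (sym el≡1)) ⟩
        u ∙ g l + (1ℚ - u ∙ g l)    ≡⟨ eq (u ∙ g l) ⟩
        1ℚ                          ∎
        where
        open ≤-Reasoning
        eq : ∀ x → x + (1ℚ - x) ≡ 1ℚ
        eq = solve-∀ ℚ-ring
      bound l (inj₂ (inj₂ refl)) _ = begin
        u ∙ g l + s * - 1ℚ          ≡⟨ cong (u ∙ g l +_) (trans (sym (neg-distribʳ-* s 1ℚ)) (cong -_ (*-identityʳ s))) ⟩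
        u ∙ g l + - s               ≤⟨ +-monoʳ-≤ (u ∙ g l) (neg-antimono-≤ s≥0) ⟩
        u ∙ g l + 0ℚ                ≡⟨ +-identityʳ (u ∙ g l) ⟩
        u ∙ g l                     ≤⟨ u∈ l ⟩
        1ℚ                          ∎
        where open ≤-Reasoning
      stays : InPolar (u +[ s ] e)
      stays l = subst (_≤ 1ℚ) (sym (+[]-∙ u s e (g l))) (bound l (e-sign l) refl)

    record Tightened (F : Frame r) (i : Fin r) (u e : Fin r → ℚ) : Set where
      field
        s         : ℚ
        s≥0       : 0ℚ ≤ s
        inPolar   : InPolar (u +[ s ] e)
        frame     : Frame r
        isBasis   : IsBasis M frame
        integral  : IsInt ((u +[ s ] e) ∙ basis frame i)
        unchanged : ∀ m → m ≢ i → (u +[ s ] e) ∙ basis frame m ≡ u ∙ basis F m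

    -- The last hypothesis makes e a multiple of `dual F i`, which covers both signs of the
    -- direction; hence e vanishes on the basis vectors at the other positions.
    pivot-tight : ∀ F → IsBasis M F → ∀ i u e s → 0ℚ ≤ s → InPolar (u +[ s ] e) →
      ∀ l → dual F i ∙ column M l ≢ 0ℚ → IsInt ((u +[ s ] e) ∙ column M l) →
      (∀ x → dual F i ∙ x ≡ 0ℚ → e ∙ x ≡ 0ℚ) → Tightened F i u e
    pivot-tight F F-basis i u e s s≥0 u′∈ l pivot≢0 tight-int e≡0 = record
      { s         = s
      ; s≥0       = s≥0
      ; inPolar   = u′∈
      ; frame     = F′
      ; isBasis   = pivoted-isBasis M F-basis i l pivot≢0
      ; integral  = subst IsInt (sym (∙-congʳ u′ (pivoted-at F i (column M l) pivot≢0))) tight-int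
      ; unchanged = unchanged
      }
      where
      open ≡-Reasoning
      u′ : Fin r → ℚ
      u′ = u +[ s ] e
      F′ : Frame r
      F′ = pivoted F i (column M l) pivot≢0
      unchanged : ∀ m → m ≢ i → u′ ∙ basis F′ m ≡ u ∙ basis F m
      unchanged m m≢i = begin
        u′ ∙ basis F′ m
          ≡⟨ ∙-congʳ u′ (pivoted-away F i (column M l) pivot≢0 m m≢i) ⟩
        u′ ∙ basis F m
          ≡⟨ +[]-∙ u s e (basis F m) ⟩
        u ∙ basis F m + s * (e ∙ basis F m)
          ≡⟨ cong (λ x → u ∙ basis F m + s * x)
               (e≡0 (basis F m) (trans (biorthogonal F i m) (δ-≢ (m≢i ∘ sym)))) ⟩
        u ∙ basis F m + s * 0ℚ
          ≡⟨ cong (u ∙ basis F m +_) (*-zeroʳ s) ⟩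
        u ∙ basis F m + 0ℚ
          ≡⟨ +-identityʳ (u ∙ basis F m) ⟩
        u ∙ basis F m
          ∎

    -- The blocking generator satisfies e ∙ g k = 1, so `dual F i` does not vanish on its column and
    -- the exchange is possible. The moved functional has the value 1 on this generator, hence an
    -- integral value on the column.
    tighten : ∀ F → IsBasis M F → ∀ i u → InPolar u → ∀ e → (∀ k → IsSign (e ∙ g k)) →
      (∃[ k ] e ∙ g k ≡ 1ℚ) → (∀ x → dual F i ∙ x ≡ 0ℚ → e ∙ x ≡ 0ℚ) → Tightened F i u e
    tighten F F-basis i u u∈ e e-sign ex e≡0 =
      let (s , s≥0 , u′∈ , k , ek≡1 , tight) = slide u u∈ e e-sign ex
          (l , g≡0 , g-int⇒) = g-column k
      in pivot-tight F F-basis i u e s s≥0 u′∈ l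
           (λ z → 1≢0 (trans (sym ek≡1) (g≡0 e (e≡0 (column M l) z))))
           (g-int⇒ (u +[ s ] e) (ℤ.+ 1 , sym tight)) e≡0

    -- The slide is blocked at the latest by the i-th basis column, on which the direction has the
    -- value 1; in the opposite direction the negative of that column plays this role.
    tighten-up : ∀ F → IsBasis M F → ∀ i u → InPolar u → Tightened F i u (dual F i)
    tighten-up F F-basis i u u∈ with F-basis i
    ... | j , e = tighten F F-basis i u u∈ (dual F i) (∙-g-sign F F-basis i)
      (j ↑ˡ n , trans (∙-congʳ (dual F i) (λ a → trans (g-↑ˡ j a) (sym (e a))))
                  (trans (biorthogonal F i i) (δ-refl i)))
      (λ _ z → z)

    tighten-down : ∀ F → IsBasis M F → ∀ i u → InPolar u → Tightened F i u (λ a → - dual F i a)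
    tighten-down F F-basis i u u∈ with F-basis i
    ... | j , e = tighten F F-basis i u u∈ (λ a → - dual F i a)
      (λ k → subst IsSign (sym (-d∙ (g k))) (sign-neg (∙-g-sign F F-basis i k)))
      (n ↑ʳ j , trans (-d∙ (g (n ↑ʳ j))) (trans
        (cong -_ (trans (∙-congʳ d (λ a → trans (g-↑ʳ j a) (cong -_ (sym (e a))))) (∙-negʳ d (basis F i))))
        (trans (neg-involutive (d ∙ basis F i)) (trans (biorthogonal F i i) (δ-refl i)))))
      (λ x z → trans (-d∙ x) (cong -_ z))
      where
      d : Fin r → ℚ
      d = dual F i
      -d∙ : ∀ x → (λ a → - d a) ∙ x ≡ - (d ∙ x)
      -d∙ x = trans (sum-cong λ a → sym (neg-distribˡ-* (d a) (x a))) (sum-neg (λ a → d a * x a))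

    -- Sliding u along ± the i-th dual vector leaves the other basis values u ∙ v alone and makes
    -- a generator tight, which then takes the i-th place in the basis. Once all basis values are
    -- integral, so is u.
    hull-complete : ∀ t → t ℕ.≤ r → ∀ F → IsBasis M F → ∀ u → InPolar u →
      (∀ i → t ℕ.≤ toℕ i → IsInt (u ∙ basis F i)) → Hull u
    hull-complete zero t≤r F F-basis u u∈ integral = hull-lattice u u-int u∈
      where
      u-int : ∀ a → IsInt (u a)
      u-int a = subst IsInt (sym (expand-dual F u a))
        (sum-int λ i → int-* (integral i ℕ.z≤n) (dual-int F F-basis i a))
    hull-complete (suc t) t<r F F-basis u u∈ integral =
      hull-between u (dual F i) (Tightened.s≥0 up) (Tightened.s≥0 down) (recurse up) (recurse down)
      where
      -- t counts the positions not yet known to be integral; they are treated from the last one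
      -- downwards, and the current one has index t.
      i : Fin r
      i = fromℕ< t<r
      recurse : ∀ {e} (T : Tightened F i u e) → Hull (u +[ Tightened.s T ] e)
      recurse {e} T = hull-complete t (ℕP.<⇒≤ t<r) frame isBasis (u +[ s ] e) inPolar λ m t≤m →
        case m Fin.≟ i of λ
          { (yes m≡i) → subst (λ h → IsInt ((u +[ s ] e) ∙ basis frame h)) (sym m≡i) integral₁
          ; (no m≢i)  → subst IsInt (sym (unchanged m m≢i)) (integral m
              (ℕP.≤∧≢⇒< t≤m λ t≡m → m≢i (toℕ-injective (trans (sym t≡m) (sym (toℕ-fromℕ< t<r)))))) }
        where open Tightened T renaming (integral to integral₁)
      up : Tightened F i u (dual F i)
      up = tighten-up F F-basis i u u∈
      down : Tightened F i u (λ a → - dual F i a)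
      down = tighten-down F F-basis i u u∈

    -- For one inclusion the descent starts at t = r, where the integrality condition is vacuous.
    -- For the other, each generator is a functional bounded by 1 on the listed points and hence on
    -- their hull.
    polar-lattice : IsLatticePolytope (Polar (PM M))
    polar-lattice = 3 ℕ.^ r , polarPoint , λ u → mk⇔
      (λ u∈ → subst (InConv polarPt) (tabulate∘lookup u)
        (hull-complete r ℕP.≤-refl F₀ F₀-basis (lookup u) (Equivalence.to (polar⇔ u) u∈)
          λ i r≤i → contradiction (toℕ<n i) (ℕP.≤⇒≯ r≤i)))
      (λ u∈ → Equivalence.from (polar⇔ u) λ k →
        subst (_≤ 1ℚ) (∙-comm (g k) (lookup u))
          (conv-functional-≤ polarPt (g k)
            (λ l → subst (_≤ 1ℚ) (∙-comm (lookup (ofℤ (polarPoint l))) (g k)) (polarPoint-inPolar l k)) u∈))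
      where
      ∙-comm : ∀ (u x : Fin r → ℚ) → u ∙ x ≡ x ∙ u
      ∙-comm u x = sum-cong λ a → *-comm (u a) (x a)

    PM-lattice : IsLatticePolytope (PM M)
    PM-lattice = n ℕ.+ n , z , λ x → mk⇔ (conv-cong (sym ∘ ofℤ-z)) (conv-cong ofℤ-z)
      where
      z : Fin (n ℕ.+ n) → Vec ℤ r
      z k = tabulate λ a → proj₁ (g-int k a)
      ofℤ-z : ∀ k → ofℤ (z k) ≡ genPM M k
      ofℤ-z k = pt-ext λ a → trans (lookup-map a toℚ (z k))
        (trans (cong toℚ (lookup∘tabulate (λ a → proj₁ (g-int k a)) a)) (proj₂ (g-int k a)))
      conv-cong : ∀ {p q : Fin (n ℕ.+ n) → Pt r} → (∀ k → p k ≡ q k) → ∀ {x} → InConv p x → InConv q x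
      conv-cong h (w , w≥0 , Σw≡1 , x≡) = w , w≥0 , Σw≡1 ,
        trans x≡ (tabulate-cong λ a → sum-cong λ k → cong (λ y → w k * lookup y a) (h k))

    reflexive : Reflexive (PM M)
    reflexive = PM-lattice , hasDim , originInterior , polar-lattice

-- Parallel columns, atoms of the lattice of flats, and their count.

module MatroidOfColumns where

  open import Data.Rational hiding (∣_∣)
  open import Data.Rational.Properties
  open import Data.Fin.Subset using (⁅_⁆; _∪_; _∈_; _∉_; _⊆_; ∣_∣)
  open Rationals
  open Frames
  open Convexity
  open SymmetricPolytope

  -- Parallel vectors

  -- For nonzero columns of M this is proportionality: by unimodularity the factor can only be ±1,
  -- see `separating-frame`.
  Parallel : ∀ {r} → Pt r → Pt r → Set
  Parallel x y = x ≡ y ⊎ negv x ≡ y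

  parallel? : ∀ {r} (x y : Pt r) → Dec (Parallel x y)
  parallel? x y = ≡-dec _≟_ x y ⊎-dec ≡-dec _≟_ (negv x) y

  negv-involutive : ∀ {r} (x : Pt r) → negv (negv x) ≡ x
  negv-involutive x = pt-ext λ a → trans (lookup-negv (negv x) a)
    (trans (cong -_ (lookup-negv x a)) (neg-involutive (lookup x a)))

  negv-0v : ∀ {r} → negv {r} 0v ≡ 0v
  negv-0v = pt-ext λ a → trans (lookup-negv 0v a) (trans (cong -_ (lookup-0v a)) (sym (lookup-0v a)))

  negv≡⇒≡0v : ∀ {r} {x : Pt r} → negv x ≡ x → x ≡ 0v
  negv≡⇒≡0v {x = x} h = pt-ext λ a → trans
    (p≡-p⇒p≡0 (trans (cong (λ y → lookup y a) (sym h)) (lookup-negv x a))) (sym (lookup-0v a))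

  parallel-sym : ∀ {r} {x y : Pt r} → Parallel x y → Parallel y x
  parallel-sym (inj₁ refl) = inj₁ refl
  parallel-sym (inj₂ refl) = inj₂ (negv-involutive _)

  parallel-trans : ∀ {r} {x y z : Pt r} → Parallel x y → Parallel y z → Parallel x z
  parallel-trans (inj₁ refl) p           = p
  parallel-trans (inj₂ refl) (inj₁ refl) = inj₂ refl
  parallel-trans (inj₂ refl) (inj₂ refl) = inj₁ (sym (negv-involutive _))

  parallel-≢0v : ∀ {r} {x y : Pt r} → Parallel x y → y ≢ 0v → x ≢ 0v
  parallel-≢0v (inj₁ refl) y≢0 = y≢0
  parallel-≢0v (inj₂ refl) y≢0 refl = y≢0 negv-0v

  -- Finite counting

  enumerate : ∀ {n} {P : Fin n → Set} → (∀ i → Dec (P i)) → ∃[ a ] CountedBy P a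
  enumerate {zero}  P? = 0 , (λ ()) , (λ { {()} }) , (λ ()) , λ ()
  enumerate {suc n} P? with enumerate (P? ∘ suc) | P? zero
  ... | a , f , f-inj , f-P , f-all | no ¬P₀ =
    a , suc ∘ f , f-inj ∘ suc-injective , f-P , all
    where
    all : ∀ x → _ → ∃[ i ] suc (f i) ≡ x
    all zero    P₀ = contradiction P₀ ¬P₀
    all (suc x) Px with f-all x Px
    ... | i , e = i , cong suc e
  ... | a , f , f-inj , f-P , f-all | yes P₀ = suc a , f′ , f′-inj , f′-P , all
    where
    f′ : Fin (suc a) → Fin (suc n)
    f′ zero    = zero
    f′ (suc i) = suc (f i)
    f′-inj : Injective _≡_ _≡_ f′
    f′-inj {zero}  {zero}  _ = refl
    f′-inj {suc i} {suc j} e = cong suc (f-inj (suc-injective e))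
    f′-P : ∀ i → _
    f′-P zero    = P₀
    f′-P (suc i) = f-P i
    all : ∀ x → _ → ∃[ i ] f′ i ≡ x
    all zero    _  = zero , refl
    all (suc x) Px with f-all x Px
    ... | i , e = suc i , cong suc e

  least : ∀ {n} {P : Fin n → Set} → (∀ i → Dec (P i)) → ∃ P → ∃[ i ] (P i × (∀ j → j Fin.< i → ¬ P j))
  least P? ex with argmin P? (λ i → toℚ (ℤ.+ toℕ i)) ex
  ... | i , Pi , min = i , Pi , λ j j<i Pj →
    ℕP.<⇒≱ j<i (ℤ.drop‿+≤+ (toℚ-cancel-≤ {ℤ.+ toℕ i} {ℤ.+ toℕ j} (min j Pj)))

  1<∣⁅x⁆∪⁅y⁆∣ : ∀ {n} {x y : Fin n} → x ≢ y → 1 ℕ.< ∣ ⁅ x ⁆ ∪ ⁅ y ⁆ ∣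
  1<∣⁅x⁆∪⁅y⁆∣ {x = x} {y} x≢y = subst (ℕ._< ∣ ⁅ x ⁆ ∪ ⁅ y ⁆ ∣) (SubsetP.∣⁅x⁆∣≡1 x)
    (SubsetP.p⊂q⇒∣p∣<∣q∣ (SubsetP.p⊆p∪q ⁅ y ⁆ ,
      y , SubsetP.q⊆p∪q ⁅ x ⁆ ⁅ y ⁆ (SubsetP.x∈⁅x⁆ y) , λ y∈ → x≢y (sym (SubsetP.x∈⁅y⁆⇒x≡y x y∈))))

  ⁅x⁆∪⁅y⁆⊆ : ∀ {n} {x y : Fin n} {S} → x ∈ S → y ∈ S → ⁅ x ⁆ ∪ ⁅ y ⁆ ⊆ S
  ⁅x⁆∪⁅y⁆⊆ {x = x} {y} {S} x∈ y∈ z∈ with SubsetP.x∈p∪q⁻ ⁅ x ⁆ ⁅ y ⁆ z∈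
  ... | inj₁ h = subst (_∈ S) (sym (SubsetP.x∈⁅y⁆⇒x≡y x h)) x∈
  ... | inj₂ h = subst (_∈ S) (sym (SubsetP.x∈⁅y⁆⇒x≡y y h)) y∈

  hasRank-unique : ∀ {n} (𝓜 : Matroid n) {S k l} → HasRank 𝓜 S k → HasRank 𝓜 S l → k ≡ l
  hasRank-unique 𝓜 ((T , T⊆ , T-ind , ∣T∣≡k) , k-max) ((U , U⊆ , U-ind , ∣U∣≡l) , l-max) =
    ℕP.≤-antisym (subst (ℕ._≤ _) ∣T∣≡k (l-max T T⊆ T-ind)) (subst (ℕ._≤ _) ∣U∣≡l (k-max U U⊆ U-ind))

  module Atoms {r n} (𝓜 : Matroid n) (M : Mat r n) (fullRank : FullRank M)
               (unimodular : WeaklyUnimodular M) (0<r : 0 ℕ.< r) (represents : Represents M 𝓜) where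

    open Unimodular M unimodular
    open Polytope M fullRank unimodular 0<r

    column≢0 : ∀ {j} → col M j ≢ 0v → ¬ (∀ a → column M j a ≡ 0ℚ)
    column≢0 {j} h z = h (pt-ext λ a → trans (lookup-col j a) (trans (z a) (sym (lookup-0v a))))

    col-ext : ∀ {j} {x : Pt r} → (∀ a → column M j a ≡ lookup x a) → col M j ≡ x
    col-ext {j} h = pt-ext λ a → trans (lookup-col j a) (h a)

    column-col : ∀ {j} {x : Pt r} → x ≡ col M j → ∀ a → lookup x a ≡ column M j a
    column-col {j} refl = lookup-col j

    colIndep-single : ∀ {S j} → (∀ x → x ∈ S → x ≡ j) → col M j ≢ 0v → ColIndep M S
    colIndep-single {S} {j} S⊆ col≢0 w w-support rel x with x Fin.≟ j
    ... | no x≢j = w-support x (x≢j ∘ S⊆ x)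
    ... | yes refl = p*q≡0⇒q≡0 (proj₂ entry)
      (trans (*-comm (M′ x) (w x)) (trans (sym (sum-δ-* x (λ y → w y * M′ y)))
        (trans (sum-cong only-x) (rel (proj₁ entry)))))
      where
      entry : ∃[ a ] column M x a ≢ 0ℚ
      entry with any? (λ a → ¬? (column M x a ≟ 0ℚ))
      ... | yes found = found
      ... | no none = contradiction
        (λ a → decidable-stable (column M x a ≟ 0ℚ) λ ne → none (a , ne)) (column≢0 col≢0)
      M′ : Fin n → ℚ
      M′ y = column M y (proj₁ entry)
      only-x : ∀ y → δ x y * (w y * M′ y) ≡ w y * M′ y
      only-x y with y Fin.≟ x
      ... | yes refl = trans (cong (_* (w y * M′ y)) (δ-refl y)) (*-identityˡ _)
      ... | no y≢x = trans (cong (λ c → δ x y * (c * M′ y)) wy≡0) (trans (cong (δ x y *_) (*-zeroˡ (M′ y)))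
        (trans (*-zeroʳ (δ x y)) (sym (trans (cong (_* M′ y) wy≡0) (*-zeroˡ (M′ y))))))
        where
        wy≡0 : w y ≡ 0ℚ
        wy≡0 = w-support y (y≢x ∘ S⊆ y)

    sum-two : ∀ {j k : Fin n} → j ≢ k → (f : Fin n → ℚ) → (∀ x → x ≢ j → x ≢ k → f x ≡ 0ℚ) →
      sumℚ f ≡ f j + f k
    sum-two {j} {k} j≢k f f≡0 = begin
      sumℚ f                                            ≡⟨ sum-cong term ⟩
      sumℚ (λ x → δ j x * f x + δ k x * f x)            ≡⟨ sum-+ (λ x → δ j x * f x) (λ x → δ k x * f x) ⟩
      sumℚ (λ x → δ j x * f x) + sumℚ (λ x → δ k x * f x)  ≡⟨ cong₂ _+_ (sum-δ-* j f) (sum-δ-* k f) ⟩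
      f j + f k                                         ∎
      where
      open ≡-Reasoning
      term : ∀ x → f x ≡ δ j x * f x + δ k x * f x
      term x with x Fin.≟ j
      ... | yes refl = trans (eq (f x)) (cong₂ (λ c d → c * f x + d * f x) (sym (δ-refl x)) (sym (δ-≢ (j≢k ∘ sym))))
        where
        eq : ∀ y → y ≡ 1ℚ * y + 0ℚ * y
        eq = solve-∀ ℚ-ring
      ... | no x≢j with x Fin.≟ k
      ...   | yes refl = trans (eq (f x)) (cong₂ (λ c d → c * f x + d * f x) (sym (δ-≢ j≢k)) (sym (δ-refl x)))
        where
        eq : ∀ y → y ≡ 0ℚ * y + 1ℚ * y
        eq = solve-∀ ℚ-ring
      ...   | no x≢k = trans fx≡0 (sym (trans (cong (λ y → δ j x * y + δ k x * y) fx≡0) (eq (δ j x) (δ k x))))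
        where
        fx≡0 : f x ≡ 0ℚ
        fx≡0 = f≡0 x x≢j x≢k
        eq : ∀ c d → c * 0ℚ + d * 0ℚ ≡ 0ℚ
        eq = solve-∀ ℚ-ring

    -- In a basis containing column j, column k has a nonzero coordinate off column j: otherwise it
    -- would be 0 or ± column j.
    separating-frame : ∀ {j k} → col M j ≢ 0v → col M k ≢ 0v → ¬ Parallel (col M j) (col M k) →
      Σ (Frame r) λ F → ∃[ i ] ∃[ l ] (l ≢ i × (∀ a → basis F i a ≡ column M j a) ×
        dual F l ∙ column M k ≢ 0ℚ)
    separating-frame {j} {k} j≢0 k≢0 j∦k =
      let (i , h) = nonzero-coordinate F₀ (column≢0 j≢0) in
      search (pivoted F₀ i (column M j) h) (pivoted-isBasis M F₀-basis i j h) i (pivoted-at F₀ i (column M j) h)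
      where
      search : ∀ F → IsBasis M F → ∀ i → (∀ a → basis F i a ≡ column M j a) →
        Σ (Frame r) λ F → ∃[ i ] ∃[ l ] (l ≢ i × (∀ a → basis F i a ≡ column M j a) ×
          dual F l ∙ column M k ≢ 0ℚ)
      search F F-basis i at with any? (λ l → ¬? (l Fin.≟ i) ×-dec ¬? (dual F l ∙ column M k ≟ 0ℚ))
      ... | yes (l , l≢i , ne) = F , i , l , l≢i , at , ne
      ... | no none = contradiction (coordinate-sign F F-basis i k) not-sign
        where
        open ≡-Reasoning
        c : ℚ
        c = dual F i ∙ column M k
        off : ∀ l → l ≢ i → dual F l ∙ column M k ≡ 0ℚ
        off l l≢i = decidable-stable (dual F l ∙ column M k ≟ 0ℚ) λ ne → none (l , l≢i , ne)
        scalar : ∀ a → column M k a ≡ c * column M j a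
        scalar a = begin
          column M k a                                          ≡⟨ expand F (column M k) a ⟩
          sumℚ (λ l → (dual F l ∙ column M k) * basis F l a)    ≡⟨ sum-cong term ⟩
          sumℚ (λ l → δ i l * (c * column M j a))               ≡⟨ sum-δ-* i (λ _ → c * column M j a) ⟩
          c * column M j a                                      ∎
          where
          term : ∀ l → (dual F l ∙ column M k) * basis F l a ≡ δ i l * (c * column M j a)
          term l with l Fin.≟ i
          ... | yes refl = trans (cong (c *_) (at a))
            (trans (sym (*-identityˡ _)) (cong (_* (c * column M j a)) (sym (δ-refl l))))
          ... | no l≢i = trans (cong (_* basis F l a) (off l l≢i)) (trans (*-zeroˡ (basis F l a))
            (sym (trans (cong (_* (c * column M j a)) (δ-≢ (l≢i ∘ sym))) (*-zeroˡ (c * column M j a)))))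
        not-sign : ¬ IsSign c
        not-sign (inj₁ c≡0) = k≢0 (col-ext λ a → trans (scalar a)
          (trans (cong (_* column M j a) c≡0) (trans (*-zeroˡ (column M j a)) (sym (lookup-0v a)))))
        not-sign (inj₂ (inj₁ c≡1)) = j∦k (inj₁ (sym (col-ext λ a → trans (scalar a)
          (trans (cong (_* column M j a) c≡1) (trans (*-identityˡ (column M j a)) (sym (lookup-col j a)))))))
        not-sign (inj₂ (inj₂ c≡-1)) = j∦k (inj₂ (sym (col-ext λ a → trans (scalar a)
          (trans (cong (_* column M j a) c≡-1) (trans (sym (neg-distribˡ-* 1ℚ (column M j a)))
            (trans (cong -_ (*-identityˡ (column M j a)))
              (sym (trans (lookup-negv (col M j) a) (cong -_ (lookup-col j a))))))))))

    -- Two dual vectors of a separating frame are applied to the relation. The l-th annihilates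
    -- column j and isolates w k; after that the i-th isolates w j.
    colIndep-pair : ∀ {S j k} → (∀ x → x ∈ S → x ≡ j ⊎ x ≡ k) → j ≢ k →
      col M j ≢ 0v → col M k ≢ 0v → ¬ Parallel (col M j) (col M k) → ColIndep M S
    colIndep-pair {S} {j} {k} S⊆ j≢k j≢0 k≢0 j∦k w w-support rel =
      let (F , i , l , l≢i , at , ne) = separating-frame j≢0 k≢0 j∦k
          wk≡0 = p*q≡0⇒q≡0 ne (begin
            (dual F l ∙ column M k) * w k
              ≡⟨ eq (dual F l ∙ column M k) (w k) (w j) ⟩
            w j * 0ℚ + w k * (dual F l ∙ column M k)
              ≡⟨ cong (λ c → w j * c + w k * (dual F l ∙ column M k))
                   (trans (sym (δ-≢ l≢i)) (trans (sym (biorthogonal F l i)) (∙-congʳ (dual F l) at))) ⟩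
            w j * (dual F l ∙ column M j) + w k * (dual F l ∙ column M k)
              ≡⟨ functional (dual F l) ⟩
            0ℚ ∎)
          wj≡0 = begin
            w j                                          ≡⟨ eq′ (w j) (dual F i ∙ column M k) ⟩
            w j * 1ℚ + 0ℚ * (dual F i ∙ column M k)
              ≡⟨ cong₂ (λ c d → w j * c + d * (dual F i ∙ column M k))
                   (trans (sym (δ-refl i)) (trans (sym (biorthogonal F i i)) (∙-congʳ (dual F i) at)))
                   (sym wk≡0) ⟩
            w j * (dual F i ∙ column M j) + w k * (dual F i ∙ column M k)
              ≡⟨ functional (dual F i) ⟩
            0ℚ ∎
      in conclude wj≡0 wk≡0
      where
      open ≡-Reasoning
      eq : ∀ c x y → c * x ≡ y * 0ℚ + x * c
      eq = solve-∀ ℚ-ring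
      eq′ : ∀ x c → x ≡ x * 1ℚ + 0ℚ * c
      eq′ = solve-∀ ℚ-ring
      outside : ∀ x → x ≢ j → x ≢ k → w x ≡ 0ℚ
      outside x x≢j x≢k = w-support x λ x∈ → [ x≢j , x≢k ]′ (S⊆ x x∈)
      functional : ∀ u → w j * (u ∙ column M j) + w k * (u ∙ column M k) ≡ 0ℚ
      functional u = begin
        w j * (u ∙ column M j) + w k * (u ∙ column M k)
          ≡⟨ sum-two j≢k (λ x → w x * (u ∙ column M x))
               (λ x x≢j x≢k → trans (cong (_* (u ∙ column M x)) (outside x x≢j x≢k)) (*-zeroˡ (u ∙ column M x))) ⟨
        sumℚ (λ x → w x * (u ∙ column M x))
          ≡⟨ ∙-sumʳ u w (column M) ⟨
        u ∙ (λ a → sumℚ (λ x → w x * column M x a))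
          ≡⟨ sum-zero (λ a → trans (cong (u a *_) (rel a)) (*-zeroʳ (u a))) ⟩
        0ℚ
          ∎
      conclude : w j ≡ 0ℚ → w k ≡ 0ℚ → ∀ x → w x ≡ 0ℚ
      conclude wj≡0 wk≡0 x with x Fin.≟ j | x Fin.≟ k
      ... | yes refl | _        = wj≡0
      ... | no _     | yes refl = wk≡0
      ... | no x≢j   | no x≢k   = outside x x≢j x≢k

    δ-support : ∀ {S : Subset n} {j} → j ∈ S → ∀ x → x ∉ S → δ j x ≡ 0ℚ
    δ-support {S} {j} j∈ x x∉ = δ-≢ {i = j} {x} λ { refl → x∉ j∈ }

    colIndep-nonzero : ∀ {S j} → ColIndep M S → j ∈ S → col M j ≢ 0v
    colIndep-nonzero {S} {j} indep j∈ col≡0 = 1≢0 (trans (sym (δ-refl j))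
      (indep (δ j) (δ-support j∈)
        (λ a → trans (sum-δ-* j (λ x → column M x a))
          (trans (sym (column-col (sym col≡0) a)) (lookup-0v a))) j))

    -- Equal columns satisfy a relation with coefficients -1 and 1, opposite columns one with 1 and
    -- 1. In both cases the coefficient at k is 1, which independence forbids.
    colIndep-nonparallel : ∀ {S j k} → ColIndep M S → j ∈ S → k ∈ S → j ≢ k →
      ¬ Parallel (col M j) (col M k)
    colIndep-nonparallel {S} {j} {k} indep j∈ k∈ j≢k j∥k = contradiction 1≡0 λ ()
      where
      open ≡-Reasoning
      sign : ∃[ c ] (∀ a → c * column M j a + 1ℚ * column M k a ≡ 0ℚ)
      sign = [ (λ e → - 1ℚ , λ a → trans
                 (cong₂ (λ x y → x + 1ℚ * y) (sym (neg-distribˡ-* 1ℚ (column M j a)))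
                   (trans (sym (column-col e a)) (lookup-col j a)))
                 (+-inverseˡ (1ℚ * column M j a)))
             , (λ e → 1ℚ , λ a → trans
                 (cong (λ y → 1ℚ * column M j a + 1ℚ * y)
                   (trans (sym (column-col e a)) (trans (lookup-negv (col M j) a) (cong -_ (lookup-col j a)))))
                 (eq (column M j a))) ]′ j∥k
        where
        eq : ∀ x → 1ℚ * x + 1ℚ * - x ≡ 0ℚ
        eq = solve-∀ ℚ-ring
      c : ℚ
      c = proj₁ sign
      w : Fin n → ℚ
      w x = c * δ j x + 1ℚ * δ k x
      0-combination : ∀ c → c * 0ℚ + 1ℚ * 0ℚ ≡ 0ℚ
      0-combination = solve-∀ ℚ-ring
      w-support : ∀ x → x ∉ S → w x ≡ 0ℚ
      w-support x x∉ = trans (cong₂ (λ y z → c * y + 1ℚ * z) (δ-support j∈ x x∉) (δ-support k∈ x x∉))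
        (0-combination c)
      rel : ∀ a → sumℚ (λ x → w x * column M x a) ≡ 0ℚ
      rel a = begin
        w ∙ (λ x → column M x a)
          ≡⟨ ∙-linearˡ c 1ℚ (δ j) (δ k) (λ x → column M x a) ⟩
        c * (δ j ∙ (λ x → column M x a)) + 1ℚ * (δ k ∙ (λ x → column M x a))
          ≡⟨ cong₂ (λ y z → c * y + 1ℚ * z) (sum-δ-* j (λ x → column M x a)) (sum-δ-* k (λ x → column M x a)) ⟩
        c * column M j a + 1ℚ * column M k a
          ≡⟨ proj₂ sign a ⟩
        0ℚ
          ∎
      1≡0 : 1ℚ ≡ 0ℚ
      1≡0 = begin
        1ℚ                             ≡⟨ eq c ⟩
        c * 0ℚ + 1ℚ * 1ℚ               ≡⟨ cong₂ (λ y z → c * y + 1ℚ * z) (sym (δ-≢ j≢k)) (sym (δ-refl k)) ⟩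
        w k                            ≡⟨ indep w w-support rel k ⟩
        0ℚ                             ∎
        where
        eq : ∀ c → 1ℚ ≡ c * 0ℚ + 1ℚ * 1ℚ
        eq = solve-∀ ℚ-ring

    σ : Permutation′ n
    σ = proj₁ represents

    vec : Fin n → Pt r
    vec e = col M (σ ⟨$⟩ʳ e)

    vec-surjective : ∀ j → ∃[ e ] vec e ≡ col M j
    vec-surjective j = σ ⟨$⟩ˡ j , cong (col M) (inverseʳ σ)

    ∈-image⁻ : ∀ {S x} → x ∈ image σ S → σ ⟨$⟩ˡ x ∈ S
    ∈-image⁻ {S} {x} x∈ = lookup⇒[]= (σ ⟨$⟩ˡ x) S
      (trans (sym (lookup∘tabulate (λ j → lookup S (σ ⟨$⟩ˡ j)) x)) ([]=⇒lookup x∈))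

    ∈-image⁺ : ∀ {S e} → e ∈ S → σ ⟨$⟩ʳ e ∈ image σ S
    ∈-image⁺ {S} {e} e∈ = lookup⇒[]= (σ ⟨$⟩ʳ e) (image σ S)
      (trans (lookup∘tabulate (λ j → lookup S (σ ⟨$⟩ˡ j)) (σ ⟨$⟩ʳ e))
        (trans (cong (lookup S) (inverseˡ σ)) ([]=⇒lookup e∈)))

    ˡ≡⇒≡ʳ : ∀ {x e} → σ ⟨$⟩ˡ x ≡ e → x ≡ σ ⟨$⟩ʳ e
    ˡ≡⇒≡ʳ refl = sym (inverseʳ σ)

    ʳ-injective : ∀ {e f} → σ ⟨$⟩ʳ e ≡ σ ⟨$⟩ʳ f → e ≡ f
    ʳ-injective h = trans (sym (inverseˡ σ)) (trans (cong (σ ⟨$⟩ˡ_) h) (inverseˡ σ))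

    ind-nonzero : ∀ {S e} → Ind 𝓜 S → e ∈ S → vec e ≢ 0v
    ind-nonzero {S} S-ind e∈ =
      colIndep-nonzero {image σ S} (Equivalence.to (proj₂ represents S) S-ind) (∈-image⁺ e∈)

    ind-nonparallel : ∀ {S e f} → Ind 𝓜 S → e ∈ S → f ∈ S → e ≢ f → ¬ Parallel (vec e) (vec f)
    ind-nonparallel {S} S-ind e∈ f∈ e≢f =
      colIndep-nonparallel {image σ S} (Equivalence.to (proj₂ represents S) S-ind)
        (∈-image⁺ e∈) (∈-image⁺ f∈) (e≢f ∘ ʳ-injective)

    ind-single : ∀ {e} → vec e ≢ 0v → Ind 𝓜 ⁅ e ⁆
    ind-single {e} e≢0 = Equivalence.from (proj₂ represents ⁅ e ⁆)
      (colIndep-single (λ x x∈ → ˡ≡⇒≡ʳ (SubsetP.x∈⁅y⁆⇒x≡y e (∈-image⁻ x∈))) e≢0)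

    ind-pair : ∀ {e f} → vec e ≢ 0v → vec f ≢ 0v → ¬ Parallel (vec e) (vec f) → Ind 𝓜 (⁅ e ⁆ ∪ ⁅ f ⁆)
    ind-pair {e} {f} e≢0 f≢0 e∦f = Equivalence.from (proj₂ represents (⁅ e ⁆ ∪ ⁅ f ⁆))
      (colIndep-pair covered (λ h → e∦f (inj₁ (cong (col M) h))) e≢0 f≢0 e∦f)
      where
      covered : ∀ x → x ∈ image σ (⁅ e ⁆ ∪ ⁅ f ⁆) → x ≡ σ ⟨$⟩ʳ e ⊎ x ≡ σ ⟨$⟩ʳ f
      covered x x∈ with SubsetP.x∈p∪q⁻ ⁅ e ⁆ ⁅ f ⁆ (∈-image⁻ x∈)
      ... | inj₁ h = inj₁ (ˡ≡⇒≡ʳ (SubsetP.x∈⁅y⁆⇒x≡y e h))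
      ... | inj₂ h = inj₂ (ˡ≡⇒≡ʳ (SubsetP.x∈⁅y⁆⇒x≡y f h))

    -- Zero columns are the loops of the matroid and lie in every flat, so the closure of e contains
    -- them besides the elements parallel to e.
    InClass : Fin n → Fin n → Set
    InClass e f = vec f ≡ 0v ⊎ Parallel (vec e) (vec f)

    inClass? : ∀ e f → Dec (InClass e f)
    inClass? e f = ≡-dec _≟_ (vec f) 0v ⊎-dec parallel? (vec e) (vec f)

    class : Fin n → Subset n
    class e = tabulate λ f → does (inClass? e f)

    ∈-class⁺ : ∀ {e f} → InClass e f → f ∈ class e
    ∈-class⁺ {e} {f} h = lookup⇒[]= f (class e)
      (trans (lookup∘tabulate (λ f → does (inClass? e f)) f) (dec-true (inClass? e f) h))

    ∈-class⁻ : ∀ {e f} → f ∈ class e → InClass e f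
    ∈-class⁻ {e} {f} f∈ = from-true (inClass? e f)
      (trans (sym (lookup∘tabulate (λ f → does (inClass? e f)) f)) ([]=⇒lookup f∈))
      where
      from-true : ∀ {A : Set} (A? : Dec A) → does A? ≡ true → A
      from-true (yes a) _ = a

    ∉-class : ∀ {e f} → f ∉ class e → vec f ≢ 0v × ¬ Parallel (vec e) (vec f)
    ∉-class f∉ = (f∉ ∘ ∈-class⁺ ∘ inj₁) , (f∉ ∘ ∈-class⁺ ∘ inj₂)

    e∈class : ∀ e → e ∈ class e
    e∈class e = ∈-class⁺ (inj₂ (inj₁ refl))

    -- With two elements in T, the exchange axiom would enlarge the singleton of e by some x in T to
    -- an independent set; but x is a loop or parallel to e.
    class-rank≤1 : ∀ {e} → vec e ≢ 0v → ∀ T → T ⊆ class e → Ind 𝓜 T → ∣ T ∣ ℕ.≤ 1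
    class-rank≤1 {e} e≢0 T T⊆ T-ind = ℕP.≮⇒≥ λ 1<∣T∣ →
      let (x , x∈T , x∉e , ind) = ind-exch 𝓜 (ind-single e≢0) T-ind
            (subst (ℕ._< ∣ T ∣) (sym (SubsetP.∣⁅x⁆∣≡1 e)) 1<∣T∣)
          e∈ = SubsetP.p⊆p∪q ⁅ x ⁆ (SubsetP.x∈⁅x⁆ e)
          x∈ = SubsetP.q⊆p∪q ⁅ e ⁆ ⁅ x ⁆ (SubsetP.x∈⁅x⁆ x)
      in [ ind-nonzero ind x∈
         , ind-nonparallel ind e∈ x∈ (λ e≡x → x∉e (subst (_∈ ⁅ e ⁆) e≡x (SubsetP.x∈⁅x⁆ e))) ]′ (∈-class⁻ (T⊆ x∈T))

    hasRank-1 : ∀ {e S} → vec e ≢ 0v → e ∈ S → S ⊆ class e → HasRank 𝓜 S 1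
    hasRank-1 {e} {S} e≢0 e∈ S⊆ =
      (⁅ e ⁆ , (λ x∈ → subst (_∈ S) (sym (SubsetP.x∈⁅y⁆⇒x≡y e x∈)) e∈) , ind-single e≢0 , SubsetP.∣⁅x⁆∣≡1 e) ,
      λ T T⊆ → class-rank≤1 e≢0 T (S⊆ ∘ T⊆)

    -- An element of S outside the class would form an independent pair with e, against rank 1.
    rank-1⇒⊆class : ∀ {e S} → vec e ≢ 0v → e ∈ S → HasRank 𝓜 S 1 → S ⊆ class e
    rank-1⇒⊆class {e} {S} e≢0 e∈ (_ , max) {x} x∈ = decidable-stable (x SubsetP.∈? class e) λ x∉ →
      let (x≢0 , e∦x) = ∉-class x∉ in
      ℕP.<⇒≱ (1<∣⁅x⁆∪⁅y⁆∣ {x = e} {x} λ { refl → e∦x (inj₁ refl) })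
        (max (⁅ e ⁆ ∪ ⁅ x ⁆) (⁅x⁆∪⁅y⁆⊆ e∈ x∈) (ind-pair e≢0 x≢0 e∦x))

    class-atom : ∀ {e} → vec e ≢ 0v → IsAtom 𝓜 (class e)
    class-atom {e} e≢0 = flat , rank
      where
      rank : HasRank 𝓜 (class e) 1
      rank = hasRank-1 e≢0 (e∈class e) (λ x∈ → x∈)
      flat : IsFlat 𝓜 (class e)
      flat x x∉ k rank-k rank-k′ = x∉ (rank-1⇒⊆class e≢0 (SubsetP.p⊆p∪q ⁅ x ⁆ (e∈class e))
        (subst (HasRank 𝓜 (class e ∪ ⁅ x ⁆)) (hasRank-unique 𝓜 rank-k rank) rank-k′)
        (SubsetP.q⊆p∪q (class e) ⁅ x ⁆ (SubsetP.x∈⁅x⁆ x)))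

    -- Adding an element of the class to A leaves the rank at 1, so flatness forces that element to
    -- lie in A already.
    flat-class : ∀ {A e} → IsFlat 𝓜 A → HasRank 𝓜 A 1 → e ∈ A → vec e ≢ 0v → A ≡ class e
    flat-class {A} {e} flat rank e∈A e≢0 = SubsetP.⊆-antisym A⊆ ⊆A
      where
      A⊆ : A ⊆ class e
      A⊆ = rank-1⇒⊆class e≢0 e∈A rank
      ⊆A : class e ⊆ A
      ⊆A {x} x∈ = decidable-stable (x SubsetP.∈? A) λ x∉ → flat x x∉ 1 rank
        (hasRank-1 e≢0 (SubsetP.p⊆p∪q ⁅ x ⁆ e∈A) λ y∈ →
          [ A⊆ , (λ y∈x → subst (_∈ class e) (sym (SubsetP.x∈⁅y⁆⇒x≡y x y∈x)) x∈) ]′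
            (SubsetP.x∈p∪q⁻ A ⁅ x ⁆ y∈))

    atom-class : ∀ {A} → IsAtom 𝓜 A → ∃[ e ] (vec e ≢ 0v × A ≡ class e)
    atom-class {A} (flat , rank@((T , T⊆ , T-ind , ∣T∣≡1) , _)) = case SubsetP.nonempty? T of λ
      { (no T-empty)    → contradiction
          (trans (sym ∣T∣≡1) (trans (cong ∣_∣ (SubsetP.Empty-unique T-empty)) (SubsetP.∣⊥∣≡0 n))) λ ()
      ; (yes (e , e∈T)) → e , ind-nonzero T-ind e∈T , flat-class flat rank (T⊆ e∈T) (ind-nonzero T-ind e∈T) }

    class-cong : ∀ {e f} → Parallel (vec e) (vec f) → class e ≡ class f
    class-cong e∥f = SubsetP.⊆-antisym (moved e∥f) (moved (parallel-sym e∥f))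
      where
      moved : ∀ {e f} → Parallel (vec e) (vec f) → class e ⊆ class f
      moved e∥f x∈ = ∈-class⁺ ([ inj₁ , (λ e∥x → inj₂ (parallel-trans (parallel-sym e∥f) e∥x)) ]′ (∈-class⁻ x∈))

    -- Taking the least element of each parallel class gives a canonical choice. The same list
    -- indexes the atoms and the antipodal pairs of vertices, so the two counts are a and 2 * a by
    -- construction.
    Representative : Fin n → Set
    Representative e = vec e ≢ 0v × (∀ f → f Fin.< e → ¬ Parallel (vec f) (vec e))

    representative? : ∀ e → Dec (Representative e)
    representative? e = ¬? (≡-dec _≟_ (vec e) 0v) ×-dec
      all? λ f → (f FinP.<? e) →-dec ¬? (parallel? (vec f) (vec e))

    representative-unique : ∀ {e f} → Representative e → Representative f → Parallel (vec e) (vec f) → e ≡ f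
    representative-unique {e} {f} (_ , e-least) (_ , f-least) e∥f with FinP.<-cmp e f
    ... | tri< e<f _ _ = contradiction e∥f (f-least e e<f)
    ... | tri≈ _ e≡f _ = e≡f
    ... | tri> _ _ f<e = contradiction (parallel-sym e∥f) (e-least f f<e)

    representative-exists : ∀ {e} → vec e ≢ 0v → ∃[ f ] (Representative f × Parallel (vec f) (vec e))
    representative-exists {e} e≢0 =
      let (f , f∥e , f-least) = least (λ f → parallel? (vec f) (vec e)) (e , inj₁ refl) in
      f , (parallel-≢0v f∥e e≢0 , λ l l<f l∥f → f-least l l<f (parallel-trans l∥f f∥e)) , f∥e

    representatives : ∃[ a ] CountedBy Representative a
    representatives = enumerate representative?

    atoms-counted : CountedBy (IsAtom 𝓜) (proj₁ representatives)
    atoms-counted = let (a , ρ , ρ-inj , ρ-rep , ρ-all) = representatives in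
      class ∘ ρ ,
      (λ {i} {j} h → ρ-inj (representative-unique (ρ-rep i) (ρ-rep j)
        ([ (λ z → contradiction z (proj₁ (ρ-rep j))) , (λ p → p) ]′
          (∈-class⁻ (subst (ρ j ∈_) (sym h) (e∈class (ρ j))))))) ,
      (λ i → class-atom (proj₁ (ρ-rep i))) ,
      λ A A-atom →
        let (e , e≢0 , A≡) = atom-class A-atom
            (f , f-rep , f∥e) = representative-exists e≢0
            (i , ρi≡f) = ρ-all f f-rep
        in i , trans (cong class ρi≡f) (trans (class-cong f∥e) (sym A≡))

    signed : Fin 2 → Pt r → Pt r
    signed zero       x = x
    signed (suc zero) x = negv x

    parallel-signed : ∀ {x y} → Parallel x y → ∃[ b ] signed b x ≡ y
    parallel-signed (inj₁ h) = zero , h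
    parallel-signed (inj₂ h) = suc zero , h

    signed-parallel : ∀ b x → Parallel x (signed b x)
    signed-parallel zero       x = inj₁ refl
    signed-parallel (suc zero) x = inj₂ refl

    signed-injective : ∀ {x} → x ≢ 0v → ∀ b c → signed b x ≡ signed c x → b ≡ c
    signed-injective x≢0 zero       zero       h = refl
    signed-injective x≢0 zero       (suc zero) h = contradiction (negv≡⇒≡0v (sym h)) x≢0
    signed-injective x≢0 (suc zero) zero       h = contradiction (negv≡⇒≡0v h) x≢0
    signed-injective x≢0 (suc zero) (suc zero) h = refl

    genPM-parallel : ∀ k → ∃[ e ] Parallel (vec e) (genPM M k)
    genPM-parallel k with genPM-cases k
    ... | j , inj₁ h = let (e , e≡) = vec-surjective j in e , inj₁ (trans e≡ (sym h))
    ... | j , inj₂ h = let (e , e≡) = vec-surjective j in e , inj₂ (trans (cong negv e≡) (sym h))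

    parallel-genPM : ∀ {e x} → Parallel (vec e) x → ∃[ k ] genPM M k ≡ x
    parallel-genPM {e} (inj₁ h) = (σ ⟨$⟩ʳ e) ↑ˡ n , trans (genPM-↑ˡ (σ ⟨$⟩ʳ e)) h
    parallel-genPM {e} (inj₂ h) = n ↑ʳ (σ ⟨$⟩ʳ e) , trans (genPM-↑ʳ (σ ⟨$⟩ʳ e)) h

    -- An index encodes a sign and a representative. Different representatives are not parallel, and
    -- a nonzero vector differs from its negative, so no vertex is listed twice.
    vertices-counted : CountedBy (IsVertex (PM M)) (2 ℕ.* proj₁ representatives)
    vertices-counted = point ∘ remQuot a , point-injective , point-vertex , point-all
      where
      a : ℕ
      a = proj₁ representatives
      ρ : Fin a → Fin n
      ρ = proj₁ (proj₂ representatives)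
      ρ-inj : Injective _≡_ _≡_ ρ
      ρ-inj = proj₁ (proj₂ (proj₂ representatives))
      ρ-rep : ∀ i → Representative (ρ i)
      ρ-rep = proj₁ (proj₂ (proj₂ (proj₂ representatives)))
      ρ-all : ∀ e → Representative e → ∃[ i ] ρ i ≡ e
      ρ-all = proj₂ (proj₂ (proj₂ (proj₂ representatives)))
      point : Fin 2 × Fin a → Pt r
      point (b , i) = signed b (vec (ρ i))
      point-injective′ : ∀ p q → point p ≡ point q → p ≡ q
      point-injective′ (b , i) (c , j) h = same (ρ-inj (representative-unique (ρ-rep i) (ρ-rep j)
          (parallel-trans (signed-parallel b (vec (ρ i)))
            (subst (λ z → Parallel z (vec (ρ j))) (sym h) (parallel-sym (signed-parallel c (vec (ρ j))))))))
        where
        same : i ≡ j → (b , i) ≡ (c , j)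
        same i≡j = cong₂ _,_ (signed-injective (proj₁ (ρ-rep i)) b c
          (trans h (cong (λ l → signed c (vec (ρ l))) (sym i≡j)))) i≡j
      point-injective : Injective _≡_ _≡_ (point ∘ remQuot a)
      point-injective {k} {l} h = trans (sym (combine-remQuot {2} a k))
        (trans (cong (uncurry combine) (point-injective′ (remQuot a k) (remQuot a l) h)) (combine-remQuot {2} a l))
      point-vertex : ∀ k → IsVertex (PM M) (point (remQuot a k))
      point-vertex k = Equivalence.from (vertex⇔ _)
        (parallel-≢0v (parallel-sym ∥) (proj₁ (ρ-rep i)) , parallel-genPM ∥)
        where
        i : Fin a
        i = proj₂ (remQuot {2} a k)
        ∥ : Parallel (vec (ρ i)) (point (remQuot a k))
        ∥ = signed-parallel (proj₁ (remQuot {2} a k)) (vec (ρ i))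
      point-all : ∀ x → IsVertex (PM M) x → ∃[ k ] point (remQuot a k) ≡ x
      point-all x x-vertex =
        let (x≢0 , k , gk≡x) = Equivalence.to (vertex⇔ x) x-vertex
            (e , e∥gk) = genPM-parallel k
            e∥x = subst (Parallel (vec e)) gk≡x e∥gk
            (f , f-rep , f∥e) = representative-exists (parallel-≢0v e∥x x≢0)
            (i , ρi≡f) = ρ-all f f-rep
            (b , b-eq) = parallel-signed (parallel-trans f∥e e∥x)
        in combine b i , trans (cong point (remQuot-combine b i))
             (trans (cong (λ l → signed b (vec l)) ρi≡f) b-eq)

    module _ (simple : Simple 𝓜) where

      vec≢0 : ∀ e → vec e ≢ 0v
      vec≢0 e = ind-nonzero (proj₁ simple e) (SubsetP.x∈⁅x⁆ e)

      col≢0 : ∀ j → col M j ≢ 0v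
      col≢0 j = let (e , e≡) = vec-surjective j in subst (_≢ 0v) e≡ (vec≢0 e)

      vec-parallel : ∀ e f → Parallel (vec e) (vec f) → e ≡ f
      vec-parallel e f e∥f = decidable-stable (e Fin.≟ f) λ e≢f →
        ind-nonparallel (proj₂ simple e f e≢f) (SubsetP.p⊆p∪q ⁅ f ⁆ (SubsetP.x∈⁅x⁆ e))
          (SubsetP.q⊆p∪q ⁅ e ⁆ ⁅ f ⁆ (SubsetP.x∈⁅x⁆ f)) e≢f e∥f

      col-parallel : ∀ j k → Parallel (col M j) (col M k) → j ≡ k
      col-parallel j k j∥k = trans (sym (inverseʳ σ)) (trans (cong (σ ⟨$⟩ʳ_)
        (vec-parallel (σ ⟨$⟩ˡ j) (σ ⟨$⟩ˡ k)
          (subst₂ Parallel (cong (col M) (sym (inverseʳ σ))) (cong (col M) (sym (inverseʳ σ))) j∥k)))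
        (inverseʳ σ))

      -- A coincidence between generators makes two columns parallel, so simplicity identifies them;
      -- a coincidence across signs would then make a column its own negative, hence a loop.
      genPM-injective : Injective _≡_ _≡_ (genPM M)
      genPM-injective {k} {l} h = trans (sym (join-splitAt n n k))
        (trans (cong (join n n) (cases (splitAt n k) (splitAt n l) h)) (join-splitAt n n l))
        where
        ± : Fin n ⊎ Fin n → Pt r
        ± = [ col M , (λ j → negv (col M j)) ]′
        opposite : ∀ j k → negv (col M j) ≢ col M k
        opposite j k h = col≢0 j (negv≡⇒≡0v (trans h (cong (col M) (sym (col-parallel j k (inj₂ h))))))
        cases : ∀ s t → ± s ≡ ± t → s ≡ t
        cases (inj₁ j) (inj₁ k) h = cong inj₁ (col-parallel j k (inj₁ h))
        cases (inj₁ j) (inj₂ k) h = contradiction (sym h) (opposite k j)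
        cases (inj₂ j) (inj₁ k) h = contradiction h (opposite j k)
        cases (inj₂ j) (inj₂ k) h = cong inj₂ (col-parallel j k
          (inj₁ (trans (sym (negv-involutive (col M j))) (trans (cong negv h) (negv-involutive (col M k))))))

      vertices-genPM : ∀ x → IsVertex (PM M) x ⇔ (∃[ j ] genPM M j ≡ x)
      vertices-genPM x = mk⇔ (λ v → proj₂ (Equivalence.to (vertex⇔ x) v))
        (λ { (k , refl) → Equivalence.from (vertex⇔ x)
          (let (e , e∥gk) = genPM-parallel k in parallel-≢0v (parallel-sym e∥gk) (vec≢0 e) , k , refl) })

-- The five properties together.

open import Data.Nat using (_<_; _*_)

theorem4p3 : ∀ {r n : ℕ} (𝓜 : Matroid n) → Regular 𝓜 → 0 < r → HasRank 𝓜 ⊤ r →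
    (M : Mat r n) → FullRank M → WeaklyUnimodular M → Represents M 𝓜 →
    CentrallySymmetric (PM M)
    × (∀ k → HasRank 𝓜 ⊤ k → HasDim (PM M) k)
    × Reflexive (PM M)
    × Terminal (PM M)
    × (∃[ a ] (CountedBy (IsAtom 𝓜) a × CountedBy (IsVertex (PM M)) (2 * a)))
    × (Simple 𝓜 → Injective _≡_ _≡_ (genPM M)
    × (∀ x → IsVertex (PM M) x ⇔ (∃[ j ] genPM M j ≡ x)))
theorem4p3 𝓜 _ 0<r rank-r M fullRank unimodular represents =
    centrallySymmetric
  -- The dimension was computed as the number r of rows; uniqueness of the rank of the ground set
  -- identifies k with r.
  , (λ k rank-k → subst (HasDim (PM M)) (hasRank-unique 𝓜 rank-r rank-k) hasDim)
  , reflexive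
  , terminal
  , (proj₁ representatives , atoms-counted , vertices-counted)
  , λ simple → genPM-injective simple , vertices-genPM simple
  where
  open MatroidOfColumns using (hasRank-unique)
  open SymmetricPolytope.Polytope M fullRank unimodular 0<r
  open SymmetricPolytope.PolarDual M fullRank unimodular 0<r using (reflexive)
  open MatroidOfColumns.Atoms 𝓜 M fullRank unimodular 0<r represents
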